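{- For $k=3$, the minimum maximum density satisfies $\tau_3^*\ge 12/11$. Hence, the integrality gap of the geometric relaxation of the $3$-way cut problem is $12/11$.
   Context: Let $k\ge 3$ and $\Delta=\{x\in\mathbb{R}^k : x\ge 0,\ \sum_i x_i=1\}$; its $i$-th vertex is the point with $x_i=1$. The length $|e|$ of a line segment $e$ in $\Delta$ is half the $L_1$ distance between its endpoints. Multiway cut. An instance is a finite undirected graph $G$ with nonnegative edge costs and $k$ distinguished nodes, terminals $1,\dots,k$. A $k$-way cut of $G$ is a set of edges whose removal disconnects each terminal from all the others; its cost is the sum of the costs of its edges. Geometric relaxation. An embedding of $G$ maps each node to a point of $\Delta$, with terminal $i$ mapped to the $i$-th vertex of $\Delta$; each edge is mapped to the straight segment between the images of its endpoints. The volume of the embedding is $\mathrm{vol}(G)=\sum_{e}\mathrm{cost}(e)\cdot|e|$. The relaxation asks for a minimum-volume embedding. Its integrality gap is the supremum, over all instances $G$ (with positive minimum volume), of the minimum cost of any $k$-way cut of $G$ divided by the minimum volume of any embedding of $G$. Cutting schemes. A $k$-way cut of the simplex is a partition of $\Delta$ into $k$ polytopes (polyhedral regions, not necessarily convex), each containing exactly one vertex of $\Delta$. A cutting scheme is a probability distribution $P$ on $k$-way cuts of $\Delta$. For a segment $e$ of positive length, $\tau_k(P,e)$ is the expected number of times a random cut from $P$ cuts $e$ (the number of points of $e$ at which $e$ crosses a boundary between blocks), divided by $|e|$; $\tau_k(P)=\sup_e\tau_k(P,e)$ and $\tau_k^*=\inf_P\tau_k(P)$ over all cutting schemes $P$.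 -}

module Defs where

open import Level using (0ℓ; suc; _⊔_)
open import Algebra.Bundles using (CommutativeRing)
open import Data.Bool.Base using (Bool; if_then_else_)
open import Data.Fin.Base using (Fin; toℕ)
open import Data.Fin.Properties using (_≟_)
open import Data.Fin.Subset using (Subset; _∉_)
open import Data.List.Base using (List)
open import Data.List.Relation.Unary.All using (All)
open import Data.List.Relation.Unary.Any using (Any)
open import Data.Nat.Base using (ℕ)
open import Data.Product using (Σ; ∃; ∃-syntax; ∃!; _×_)
open import Data.Sum.Base using (_⊎_; [_,_]′)
open import Data.Vec.Base using (lookup)
open import Function.Base using (flip; const)
open import Function.Definitions using (Injective)
open import Relation.Binary.Core using (Rel)
open import Relation.Binary.Structures using (IsTotalOrder)
open import Relation.Binary.PropositionalEquality.Core using (_≡_; _≢_)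
open import Relation.Binary.Construct.Closure.ReflexiveTransitive using (Star)
open import Relation.Nullary using (¬_; does)
open import Relation.Nullary.Construct.Add.Supremum using (_⁺; [_]; ⊤⁺)
open import Relation.Unary using (Pred; U; ∁; _≐_; _⊥_)
import Relation.Unary as Unary
import Algebra.Properties.Monoid.Sum as Sum
import Algebra.Properties.Monoid.Mult as Mult
import Relation.Binary.Construct.Add.Supremum.NonStrict as Sup⁺
import Relation.Binary.Construct.NonStrictToStrict as Strict

IsLUB : ∀ {a ℓ p} {A : Set a} → Rel A ℓ → Pred A p → Pred A (a ⊔ ℓ ⊔ p)
IsLUB _≤_ S x = (∀ y → S y → y ≤ x) × (∀ z → (∀ y → S y → y ≤ z) → x ≤ z)

IsGLB : ∀ {a ℓ p} {A : Set a} → Rel A ℓ → Pred A p → Pred A (a ⊔ ℓ ⊔ p)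
IsGLB _≤_ = IsLUB (flip _≤_)

-- Complete ordered fields: the axiomatic characterisation of the real numbers.
-- The inverse is total; its value at 0 is unspecified.
record CompleteOrderedField : Set₁ where
  field
    commutativeRing : CommutativeRing 0ℓ 0ℓ

  open CommutativeRing commutativeRing public

  infix 8 _⁻¹
  infix 4 _≤_

  field
    _⁻¹          : Carrier → Carrier
    _≤_          : Rel Carrier 0ℓ
    0≉1          : ¬ (0# ≈ 1#)
    ⁻¹-inverseʳ  : ∀ x → ¬ (x ≈ 0#) → x * x ⁻¹ ≈ 1#
    isTotalOrder : IsTotalOrder _≈_ _≤_
    +-monoˡ-≤    : ∀ z {x y} → x ≤ y → x + z ≤ y + z
    *-nonNeg     : ∀ {x y} → 0# ≤ x → 0# ≤ y → 0# ≤ x * y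
    complete     : (S : Pred Carrier 0ℓ) → ∃ S →
                   (∃[ b ] (∀ y → S y → y ≤ b)) → ∃ (IsLUB _≤_ S)

module Multiway (ℝ : CompleteOrderedField) where

  open CompleteOrderedField ℝ
  open Strict _≈_ _≤_ public using (_<_)
  open Sum +-monoid using (sum)
  open Mult +-monoid using () renaming (_×_ to _ℕ·_)

  fromℕ : ℕ → Carrier
  fromℕ n = n ℕ· 1#

  infixl 7 _÷_
  _÷_ : Carrier → Carrier → Carrier
  x ÷ y = x * y ⁻¹

  ∣_∣ : Carrier → Carrier
  ∣ x ∣ = [ const x , const (- x) ]′ (IsTotalOrder.total isTotalOrder 0# x)

  IsMinimum : ∀ {a p} {A : Set a} → Pred A p → (A → Carrier) → Pred Carrier (a ⊔ p)
  IsMinimum P f x = (∃[ a ] P a × x ≈ f a) × (∀ a → P a → x ≤ f a)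

  ℝ∞ : Set
  ℝ∞ = Carrier ⁺

  open Sup⁺ _≤_ public using () renaming (_≤⁺_ to _≤∞_)

  infixl 7 _*∞_
  -- Used only with a positive second argument.
  _*∞_ : ℝ∞ → Carrier → ℝ∞
  [ x ] *∞ y = [ x * y ]
  ⊤⁺    *∞ y = ⊤⁺

  -- s is the value of the series Σₙ f n, whose terms are nonnegative in every use.
  IsSeriesSum : (ℕ → Carrier) → Pred ℝ∞ 0ℓ
  IsSeriesSum f = IsLUB _≤∞_ (λ s → ∃[ N ] s ≡ [ sum {N} (λ i → f (toℕ i)) ])

  Point : ℕ → Set
  Point k = Fin k → Carrier

  _≋_ : ∀ {k} → Rel (Point k) 0ℓ
  x ≋ y = ∀ i → x i ≈ y i

  Δ : ∀ {k} → Pred (Point k) 0ℓ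
  Δ x = (∀ i → 0# ≤ x i) × sum x ≈ 1#

  vertex : ∀ {k} → Fin k → Point k
  vertex i j = if does (i ≟ j) then 1# else 0#

  dist : ∀ {k} → Point k → Point k → Carrier
  dist x y = sum (λ i → ∣ x i - y i ∣) ÷ fromℕ 2

  -- Multigraphs: parallel edges and loops are allowed.
  record Instance (k : ℕ) : Set where
    field
      nodes edges        : ℕ
      end₁ end₂          : Fin edges → Fin nodes
      cost               : Fin edges → Carrier
      cost-nonNeg        : ∀ e → 0# ≤ cost e
      terminal           : Fin k → Fin nodes
      terminal-injective : Injective _≡_ _≡_ terminal

    AdjacentOutside : Subset edges → Rel (Fin nodes) 0ℓ
    AdjacentOutside S u v = ∃[ e ] e ∉ S ×
      ((end₁ e ≡ u × end₂ e ≡ v) ⊎ (end₁ e ≡ v × end₂ e ≡ u))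

    IsKWayCut : Pred (Subset edges) 0ℓ
    IsKWayCut S = ∀ i j → i ≢ j → ¬ Star (AdjacentOutside S) (terminal i) (terminal j)

    cutCost : Subset edges → Carrier
    cutCost S = sum (λ e → if lookup S e then cost e else 0#)

    IsEmbedding : Pred (Fin nodes → Point k) 0ℓ
    IsEmbedding f = (∀ v → Δ (f v)) × (∀ i → f (terminal i) ≋ vertex i)

    volume : (Fin nodes → Point k) → Carrier
    volume f = sum (λ e → cost e * dist (f (end₁ e)) (f (end₂ e)))

    IsMinCut : Pred Carrier 0ℓ
    IsMinCut = IsMinimum IsKWayCut cutCost

    IsMinVolume : Pred Carrier 0ℓ
    IsMinVolume = IsMinimum IsEmbedding volume

  IsIntegralityGap : ℕ → Pred ℝ∞ 0ℓ
  IsIntegralityGap k = IsLUB _≤∞_ λ r →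
    ∃[ G ] ∃[ c ] ∃[ v ] Instance.IsMinCut {k} G c × Instance.IsMinVolume G v ×
                         0# < v × r ≡ [ c ÷ v ]

  -- The half-space b ≤ a·x, or b < a·x if strict.
  record HalfSpace (k : ℕ) : Set where
    field
      normal : Point k
      offset : Carrier
      strict : Bool

  Satisfies : ∀ {k} → Point k → Pred (HalfSpace k) 0ℓ
  Satisfies x h = if strict then offset < a·x else offset ≤ a·x
    where
    open HalfSpace h
    a·x : Carrier
    a·x = sum (λ i → normal i * x i)

  -- Not necessarily convex: a finite union of finite intersections of
  -- half-spaces, each of which may be open or closed, so that regions can
  -- partition Δ exactly.
  Polytope : ℕ → Set
  Polytope k = List (List (HalfSpace k))

  infix 4 _∈ₚ_
  _∈ₚ_ : ∀ {k} → Point k → Polytope k → Set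
  x ∈ₚ R = Any (All (Satisfies x)) R

  record SimplexCut (k : ℕ) : Set where
    field
      block      : Fin k → Polytope k
      partition  : ∀ x → Δ x → ∃! _≡_ (λ b → x ∈ₚ block b)
      one-vertex : ∀ b → ∃! _≡_ (λ i → vertex i ∈ₚ block b)

  record Segment (k : ℕ) : Set where
    field
      start end   : Point k
      start∈Δ     : Δ start
      end∈Δ       : Δ end
      nondegenerate : 0# < dist start end

    length : Carrier
    length = dist start end

    at : Carrier → Point k
    at t i = start i + t * (end i - start i)

  module _ {k : ℕ} (C : SimplexCut k) (e : Segment k) where
    open SimplexCut C
    open Segment e

    -- Along e, the parameter t ∈ [0,1] is a boundary point of two blocks:
    -- each of its neighbourhoods in [0,1] meets two distinct blocks.
    IsCrossing : Pred Carrier 0ℓ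
    IsCrossing t = InUnit t × (∀ ε → 0# < ε →
      ∃[ s ] ∃[ s′ ] ∃[ b ] ∃[ b′ ]
        InUnit s × InUnit s′ × ∣ s - t ∣ < ε × ∣ s′ - t ∣ < ε ×
        at s ∈ₚ block b × at s′ ∈ₚ block b′ × b ≢ b′)
      where
      InUnit : Pred Carrier 0ℓ
      InUnit t = 0# ≤ t × t ≤ 1#

    -- e has exactly n crossings; as e is nondegenerate, distinct parameters
    -- are distinct points.
    HasCrossings : ℕ → Set
    HasCrossings n = Σ (Fin n → Carrier) λ t →
      Injective _≡_ _≈_ t × (∀ i → IsCrossing (t i)) × (∀ s → IsCrossing s → ∃[ i ] s ≈ t i)

  -- μ is only constrained on measurable sets.
  record ProbabilityMeasure (A : Set) : Set₁ where
    field
      Measurable : Pred (Pred A 0ℓ) 0ℓ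
      resp-≐     : ∀ {E F} → E ≐ F → Measurable E → Measurable F
      U-meas     : Measurable U
      ∁-meas     : ∀ {E} → Measurable E → Measurable (∁ E)
      ⋃-meas     : ∀ (E : ℕ → Pred A 0ℓ) → (∀ n → Measurable (E n)) →
                   Measurable (Unary.⋃ ℕ E)
      μ          : Pred A 0ℓ → Carrier
      μ-cong     : ∀ {E F} → E ≐ F → Measurable E → μ E ≈ μ F
      μ-nonNeg   : ∀ {E} → Measurable E → 0# ≤ μ E
      μ-U        : μ U ≈ 1#
      μ-⋃        : ∀ (E : ℕ → Pred A 0ℓ) → (∀ n → Measurable (E n)) →
                   (∀ m n → m ≢ n → E m ⊥ E n) →
                   IsSeriesSum (λ n → μ (E n)) [ μ (Unary.⋃ ℕ E) ]

  -- The sample space consists of presentations of cuts by inequalities; every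
  -- distribution on cuts is the image of one on presentations. The σ-algebra is
  -- arbitrary, subject to all crossing numbers being random variables.
  record CuttingScheme (k : ℕ) : Set₁ where
    field
      probability    : ProbabilityMeasure (SimplexCut k)
    open ProbabilityMeasure probability public
    field
      crossings-meas : ∀ e n → Measurable (λ C → HasCrossings C e n)

  module _ {k : ℕ} (P : CuttingScheme k) where
    open CuttingScheme P

    IsExpectedCrossings : Segment k → Pred ℝ∞ 0ℓ
    IsExpectedCrossings e =
      IsSeriesSum (λ n → fromℕ n * μ (λ C → HasCrossings C e n))

    -- d = τₖ(P,e)
    IsSegmentDensity : Segment k → Pred ℝ∞ 0ℓ
    IsSegmentDensity e d = IsExpectedCrossings e (d *∞ Segment.length e)

    -- τ = τₖ(P)
    IsMaximumDensity : Pred ℝ∞ 0ℓ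
    IsMaximumDensity = IsLUB _≤∞_ (λ d → ∃[ e ] IsSegmentDensity e d)

  -- τ = τₖ*
  IsMinimumMaximumDensity : ℕ → Pred ℝ∞ (suc 0ℓ)
  IsMinimumMaximumDensity k =
    IsGLB _≤∞_ (λ τ → Σ (CuttingScheme k) λ P → IsMaximumDensity P τ)

  12/11 : Carrier
  12/11 = fromℕ 12 ÷ fromℕ 11

{-# OPTIONS --safe #-}

-- Lower bounds. On the triangular grid of side N = 3n in Δ, identify the points nearer
-- than n to a vertex of Δ with that vertex; let every edge of an upward grid triangle cost
-- 1, and every grid edge on the boundary of Δ another 2n. As a straight-line drawing this
-- graph has volume 11n + 1, but every 3-way cut costs at least 12n. Indeed, regard a cut as
-- a labelling of the grid points. The monochromatic upward triangles inject into the
-- downward ones, apart from those of colour i on the side opposite to vertex i, and there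
-- are 3n more upward than downward triangles. Each upward triangle that is not
-- monochromatic costs 2. The labels change on every side, which costs 2n per side; the
-- exceptional triangles on a side, at most n of them, each lose 2, but force a second
-- change of label there. For a cutting scheme of maximum density τ, label the grid points by
-- their blocks and average over the scheme: 12n ≤ τ (11n + 1).
--
-- Upper bound. Given an embedding, scale coordinates by 3 and take t uniform in (0, 1).
-- With probability 8/11 give the coordinates the thresholds t, 1 + t, 2 - 2t in a random
-- cyclic order, and label a node by the first of two random distinct coordinates that
-- reaches its threshold, or else by the third one. With probability 3/11 do the same with
-- the thresholds 2 + t. In each of the three coordinates, the chance to cut a segment is
-- then at most proportional to the change of that coordinate, so that a segment e is cut
-- with probability at most 12/11 |e|.
--
-- The minimum volume in the integrality gap is attained because the volume is Lipschitz in
-- a parametrisation of the embeddings by a box.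

module Submission where

open import Axiom.ExcludedMiddle using (ExcludedMiddle)
open import Data.Product.Base using (∃-syntax; _×_)
open import Relation.Nullary.Construct.Add.Supremum using ([_])
open import Defs
open import Data.Bool.Base using (Bool; true; false; if_then_else_; not; _∨_; _xor_)
open import Data.Empty using (⊥-elim)
open import Data.Fin.Base using (Fin; toℕ) renaming (zero to fzero; suc to fsuc)
open import Data.Fin.Patterns using (0F; 1F; 2F; 3F)
open import Data.Fin.Properties using (_≟_; all?)
open import Data.List.Base using (List; []; _∷_; _++_; concatMap)
open import Data.Nat.Base as ℕ using (ℕ; zero; suc)
import Data.Nat.Properties as ℕ
open import Data.Product.Base using (Σ; ∃; _,_; proj₁; proj₂)
open import Data.Sum.Base using (_⊎_; inj₁; inj₂)
open import Data.Unit.Base using (tt)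
open import Level using (0ℓ)
open import Relation.Binary.PropositionalEquality.Core as ≡ using (_≡_; _≢_)
open import Relation.Nullary using (¬_; Dec; yes; no; does; contradiction)
open import Relation.Nullary.Construct.Add.Supremum using (⊤⁺)
open import Relation.Nullary.Decidable using (True; toWitness; fromWitness; dec-true; dec-false; _⊎-dec_)

-- The mixture 8/11, 3/11 equalises densities. Over the three cyclic shifts, the thresholds t, 1 +
-- t, 2 - 2t of a scaled coordinate sweep [0, 2] with density 3/2; 2 + t sweeps [2, 3] with density
-- 1. When one coordinate passes its threshold, at most 3 of the 6 ball rules are cut, and at most 2
-- of the 3 corner rules. Counting ball cuts 4 times and corner cuts 9 times gives the density 4 * 3
-- * 3/2 = 9 * 2 = 18 on all of [0, 3]. This makes 4 * 18 + 9 * 3 = 99 cuts; undoing the scaling by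
-- 3, and with |e| half the L1 distance, 18 becomes 2 * 3 * 18 = 108, and 108/99 = 12/11. In the
-- lower bound for schemes the obstacle is measurability: only events about crossing numbers are
-- known to be measurable. A scheme is therefore averaged over the events that a segment is crossed,
-- which contain the events that its ends get different labels. Expectations are finite weighted
-- sums of probabilities there, and of lengths of intervals of t in the upper bound.

module IntegerCoefficients (ℝ : CompleteOrderedField) where
  open CompleteOrderedField ℝ
  open Multiway ℝ using (fromℕ)
  open import Algebra.Bundles.Raw using (RawRing)
  open import Algebra.Properties.Monoid.Mult +-monoid using (×-homo-+)
  open import Algebra.Properties.Semiring.Mult semiring using (×1-homo-*)
  open import Algebra.Properties.Ring ring
    using (-0#≈0#; -‿+-comm; -‿distribˡ-*; -‿distribʳ-*; -‿involutive)
  open import Algebra.Solver.Ring.AlmostCommutativeRing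
    using (fromCommutativeRing; _-Raw-AlmostCommutative⟶_)
  open import Data.Integer.Base as ℤ using (ℤ; +_; -[1+_]; _⊖_)
  import Data.Integer.Properties as ℤ
  open import Data.Maybe.Base using (Maybe; just; nothing)
  open import Relation.Binary.Reasoning.Setoid setoid

  -- The value at 1 is 1# itself, not fromℕ 1 = 1# + 0#, so that the solver also
  -- applies to terms containing 1#.
  ⟦_⟧ₙ : ℕ → Carrier
  ⟦ suc zero ⟧ₙ = 1#
  ⟦ n ⟧ₙ        = fromℕ n

  ⟦_⟧ : ℤ → Carrier
  ⟦ + n ⟧      = ⟦ n ⟧ₙ
  ⟦ -[1+ n ] ⟧ = - ⟦ suc n ⟧ₙ

  ⟦⟧ₙ≈fromℕ : ∀ n → ⟦ n ⟧ₙ ≈ fromℕ n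
  ⟦⟧ₙ≈fromℕ zero          = refl
  ⟦⟧ₙ≈fromℕ (suc zero)    = sym (+-identityʳ 1#)
  ⟦⟧ₙ≈fromℕ (suc (suc n)) = refl

  ⟦⟧ₙ-+ : ∀ m n → ⟦ m ℕ.+ n ⟧ₙ ≈ ⟦ m ⟧ₙ + ⟦ n ⟧ₙ
  ⟦⟧ₙ-+ m n = begin
    ⟦ m ℕ.+ n ⟧ₙ        ≈⟨ ⟦⟧ₙ≈fromℕ (m ℕ.+ n) ⟩
    fromℕ (m ℕ.+ n)     ≈⟨ ×-homo-+ 1# m n ⟩
    fromℕ m + fromℕ n   ≈⟨ +-cong (⟦⟧ₙ≈fromℕ m) (⟦⟧ₙ≈fromℕ n) ⟨
    ⟦ m ⟧ₙ + ⟦ n ⟧ₙ     ∎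

  ⟦⟧ₙ-* : ∀ m n → ⟦ m ℕ.* n ⟧ₙ ≈ ⟦ m ⟧ₙ * ⟦ n ⟧ₙ
  ⟦⟧ₙ-* m n = begin
    ⟦ m ℕ.* n ⟧ₙ        ≈⟨ ⟦⟧ₙ≈fromℕ (m ℕ.* n) ⟩
    fromℕ (m ℕ.* n)     ≈⟨ ×1-homo-* m n ⟩
    fromℕ m * fromℕ n   ≈⟨ *-cong (⟦⟧ₙ≈fromℕ m) (⟦⟧ₙ≈fromℕ n) ⟨
    ⟦ m ⟧ₙ * ⟦ n ⟧ₙ     ∎

  ⟦-⟧ : ∀ i → ⟦ ℤ.- i ⟧ ≈ - ⟦ i ⟧
  ⟦-⟧ (+ zero)   = sym -0#≈0#
  ⟦-⟧ (+ suc n)  = refl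
  ⟦-⟧ (-[1+ n ]) = sym (-‿involutive _)

  ⟦⊖⟧ : ∀ m n → ⟦ m ⊖ n ⟧ ≈ ⟦ m ⟧ₙ - ⟦ n ⟧ₙ
  ⟦⊖⟧ zero    zero    = sym (-‿inverseʳ _)
  ⟦⊖⟧ zero    (suc n) = sym (+-identityˡ _)
  ⟦⊖⟧ (suc m) zero    = sym (trans (+-congˡ -0#≈0#) (+-identityʳ _))
  ⟦⊖⟧ (suc m) (suc n) = begin
    ⟦ suc m ⊖ suc n ⟧                 ≡⟨ ≡.cong ⟦_⟧ (ℤ.[1+m]⊖[1+n]≡m⊖n m n) ⟩
    ⟦ m ⊖ n ⟧                         ≈⟨ ⟦⊖⟧ m n ⟩
    ⟦ m ⟧ₙ - ⟦ n ⟧ₙ                   ≈⟨ +-congʳ (+-identityˡ _) ⟨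
    (0# + ⟦ m ⟧ₙ) - ⟦ n ⟧ₙ            ≈⟨ +-congʳ (+-congʳ (-‿inverseʳ 1#)) ⟨
    ((1# - 1#) + ⟦ m ⟧ₙ) - ⟦ n ⟧ₙ     ≈⟨ +-congʳ (+-assoc _ _ _) ⟩
    (1# + (- 1# + ⟦ m ⟧ₙ)) - ⟦ n ⟧ₙ   ≈⟨ +-congʳ (+-congˡ (+-comm _ _)) ⟩
    (1# + (⟦ m ⟧ₙ - 1#)) - ⟦ n ⟧ₙ     ≈⟨ +-congʳ (+-assoc _ _ _) ⟨
    ((1# + ⟦ m ⟧ₙ) - 1#) - ⟦ n ⟧ₙ     ≈⟨ +-assoc _ _ _ ⟩
    (1# + ⟦ m ⟧ₙ) + (- 1# - ⟦ n ⟧ₙ)   ≈⟨ +-congˡ (-‿+-comm _ _) ⟩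
    (1# + ⟦ m ⟧ₙ) - (1# + ⟦ n ⟧ₙ)     ≈⟨ +-cong (⟦⟧ₙ-+ 1 m) (-‿cong (⟦⟧ₙ-+ 1 n)) ⟨
    ⟦ suc m ⟧ₙ - ⟦ suc n ⟧ₙ           ∎

  ⟦+⟧ : ∀ i j → ⟦ i ℤ.+ j ⟧ ≈ ⟦ i ⟧ + ⟦ j ⟧
  ⟦+⟧ (+ m)      (+ n)      = ⟦⟧ₙ-+ m n
  ⟦+⟧ (+ m)      (-[1+ n ]) = ⟦⊖⟧ m (suc n)
  ⟦+⟧ (-[1+ m ]) (+ n)      = trans (⟦⊖⟧ n (suc m)) (+-comm _ _)
  ⟦+⟧ (-[1+ m ]) (-[1+ n ]) = begin
    - ⟦ suc (suc (m ℕ.+ n)) ⟧ₙ   ≡⟨ ≡.cong (λ k → - ⟦ k ⟧ₙ) (ℕ.+-suc (suc m) n) ⟨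
    - ⟦ suc m ℕ.+ suc n ⟧ₙ       ≈⟨ -‿cong (⟦⟧ₙ-+ (suc m) (suc n)) ⟩
    - (⟦ suc m ⟧ₙ + ⟦ suc n ⟧ₙ)  ≈⟨ -‿+-comm _ _ ⟨
    - ⟦ suc m ⟧ₙ - ⟦ suc n ⟧ₙ    ∎

  ⟦*⟧⁺ : ∀ m j → ⟦ + m ℤ.* j ⟧ ≈ ⟦ m ⟧ₙ * ⟦ j ⟧
  ⟦*⟧⁺ m (+ n)      = trans (reflexive (≡.cong ⟦_⟧ (≡.sym (ℤ.pos-* m n)))) (⟦⟧ₙ-* m n)
  ⟦*⟧⁺ m (-[1+ n ]) = begin
    ⟦ + m ℤ.* -[1+ n ] ⟧       ≡⟨ ≡.cong ⟦_⟧ (ℤ.neg-distribʳ-* (+ m) (+ suc n)) ⟨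
    ⟦ ℤ.- (+ m ℤ.* + suc n) ⟧  ≈⟨ ⟦-⟧ (+ m ℤ.* + suc n) ⟩
    - ⟦ + m ℤ.* + suc n ⟧      ≈⟨ -‿cong (⟦*⟧⁺ m (+ suc n)) ⟩
    - (⟦ m ⟧ₙ * ⟦ suc n ⟧ₙ)    ≈⟨ -‿distribʳ-* _ _ ⟩
    ⟦ m ⟧ₙ * - ⟦ suc n ⟧ₙ      ∎

  ⟦*⟧ : ∀ i j → ⟦ i ℤ.* j ⟧ ≈ ⟦ i ⟧ * ⟦ j ⟧
  ⟦*⟧ (+ m)      j = ⟦*⟧⁺ m j
  ⟦*⟧ (-[1+ m ]) j = begin
    ⟦ -[1+ m ] ℤ.* j ⟧       ≡⟨ ≡.cong ⟦_⟧ (ℤ.neg-distribˡ-* (+ suc m) j) ⟨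
    ⟦ ℤ.- (+ suc m ℤ.* j) ⟧  ≈⟨ ⟦-⟧ (+ suc m ℤ.* j) ⟩
    - ⟦ + suc m ℤ.* j ⟧      ≈⟨ -‿cong (⟦*⟧⁺ (suc m) j) ⟩
    - (⟦ suc m ⟧ₙ * ⟦ j ⟧)   ≈⟨ -‿distribˡ-* _ _ ⟩
    - ⟦ suc m ⟧ₙ * ⟦ j ⟧     ∎

  -- The solver takes its coefficients in the integers because their equality is decided by
  -- computation, so that numerals cancel during normalisation.
  ℤ-rawRing : RawRing _ _
  ℤ-rawRing = record
    { Carrier = ℤ ; _≈_ = _≡_ ; _+_ = ℤ._+_ ; _*_ = ℤ._*_ ; -_ = ℤ.-_ ; 0# = ℤ.0ℤ ; 1# = ℤ.1ℤ }

  ⟦⟧-morphism : ℤ-rawRing -Raw-AlmostCommutative⟶ fromCommutativeRing commutativeRing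
  ⟦⟧-morphism = record
    { ⟦_⟧ = ⟦_⟧ ; +-homo = ⟦+⟧ ; *-homo = ⟦*⟧ ; -‿homo = ⟦-⟧ ; 0-homo = refl ; 1-homo = refl }

  _≟⟦⟧_ : ∀ i j → Maybe (⟦ i ⟧ ≈ ⟦ j ⟧)
  i ≟⟦⟧ j with i ℤ.≟ j
  ... | yes i≡j = just (reflexive (≡.cong ⟦_⟧ i≡j))
  ... | no  _   = nothing

  open import Algebra.Solver.Ring ℤ-rawRing (fromCommutativeRing commutativeRing) ⟦⟧-morphism _≟⟦⟧_
    public using (solve; Polynomial; con; _:+_; _:*_; _:-_; :-_; _:=_)

  infix 9 #_
  #_ : ∀ {n} → ℕ → Polynomial n
  # n = con (+ n)

-- Arithmetic of ordered fields and the Archimedean property.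

module OrderedField (ℝ : CompleteOrderedField) where
  open CompleteOrderedField ℝ public
  open Multiway ℝ public
  open IntegerCoefficients ℝ public
    using (solve; #_; _:+_; _:*_; _:-_; :-_; _:=_)
  open import Algebra.Properties.Monoid.Mult +-monoid using (×-homo-+)
  open import Algebra.Properties.Semiring.Mult semiring using (×1-homo-*)
  open import Algebra.Properties.Semiring.Sum semiring public
    using (sum; sum-cong-≋; ∑-distrib-+; ∑-comm; *-distribˡ-sum; sum-replicate-zero)
  open import Relation.Binary.Structures using (IsTotalOrder)
  open IsTotalOrder isTotalOrder public
    using (total)
    renaming (reflexive to ≤-reflexive; refl to ≤-refl; trans to ≤-trans; antisym to ≤-antisym
             ; ≤-respʳ-≈ to ≤-respʳ; ≤-respˡ-≈ to ≤-respˡ)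

  import Relation.Binary.Construct.NonStrictToStrict _≈_ _≤_ as Strict≤

  <-respʳ : ∀ {x y z} → y ≈ z → x < y → x < z
  <-respʳ = Strict≤.<-respʳ-≈ sym trans ≤-respʳ

  <-respˡ : ∀ {x y z} → y ≈ z → y < x → z < x
  <-respˡ = Strict≤.<-respˡ-≈ trans ≤-respˡ

  <-≤-trans : ∀ {x y z} → x < y → y ≤ z → x < z
  <-≤-trans = Strict≤.<-≤-trans sym ≤-trans ≤-antisym ≤-respʳ

  ≤-<-trans : ∀ {x y z} → x ≤ y → y < z → x < z
  ≤-<-trans = Strict≤.≤-<-trans ≤-trans ≤-antisym ≤-respˡ

  <⇒≤ : ∀ {x y} → x < y → x ≤ y
  <⇒≤ = proj₁

  <⇒≱ : ∀ {x y} → x < y → ¬ y ≤ x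
  <⇒≱ (x≤y , x≉y) y≤x = x≉y (≤-antisym x≤y y≤x)

  <-irrefl : ∀ {x} → ¬ x < x
  <-irrefl x<x = proj₂ x<x refl

  ≰⇒> : ∀ {x y} → ¬ x ≤ y → y < x
  ≰⇒> {x} {y} x≰y with total x y
  ... | inj₁ x≤y = contradiction x≤y x≰y
  ... | inj₂ y≤x = y≤x , λ y≈x → x≰y (≤-reflexive (sym y≈x))

  0≤y-x⇒x≤y : ∀ {x y} → 0# ≤ y - x → x ≤ y
  0≤y-x⇒x≤y {x} {y} 0≤y-x = ≤-respˡ (+-identityˡ x)
    (≤-respʳ (solve 2 (λ x y → y :- x :+ x := y) refl x y) (+-monoˡ-≤ x 0≤y-x))

  x≤y⇒0≤y-x : ∀ {x y} → x ≤ y → 0# ≤ y - x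
  x≤y⇒0≤y-x {x} {y} x≤y = ≤-respˡ (-‿inverseʳ x) (+-monoˡ-≤ (- x) x≤y)

  -- An inequality x ≤ y is mostly proved by exhibiting y - x as a nonnegative
  -- combination of known nonnegative quantities; the identity is left to the solver.
  ≤-by : ∀ {x y p} → 0# ≤ p → y - x ≈ p → x ≤ y
  ≤-by 0≤p eq = 0≤y-x⇒x≤y (≤-respʳ (sym eq) 0≤p)

  +-nonNeg : ∀ {x y} → 0# ≤ x → 0# ≤ y → 0# ≤ x + y
  +-nonNeg {x} {y} 0≤x 0≤y = ≤-trans 0≤y (≤-respˡ (+-identityˡ y) (+-monoˡ-≤ y 0≤x))

  +-mono-≤ : ∀ {x y u v} → x ≤ y → u ≤ v → x + u ≤ y + v
  +-mono-≤ {x} {y} {u} {v} x≤y u≤v = ≤-by (+-nonNeg (x≤y⇒0≤y-x x≤y) (x≤y⇒0≤y-x u≤v))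
    (solve 4 (λ x y u v → (y :+ v) :- (x :+ u) := (y :- x) :+ (v :- u)) refl x y u v)

  *-monoˡ-≤ : ∀ {c x y} → 0# ≤ c → x ≤ y → c * x ≤ c * y
  *-monoˡ-≤ {c} {x} {y} 0≤c x≤y = ≤-by (*-nonNeg 0≤c (x≤y⇒0≤y-x x≤y))
    (solve 3 (λ c x y → c :* y :- c :* x := c :* (y :- x)) refl c x y)

  *-monoʳ-≤ : ∀ {c x y} → 0# ≤ c → x ≤ y → x * c ≤ y * c
  *-monoʳ-≤ {c} {x} {y} 0≤c x≤y = ≤-respˡ (*-comm c x) (≤-respʳ (*-comm c y) (*-monoˡ-≤ 0≤c x≤y))

  -‿mono-≤ : ∀ {x y} → x ≤ y → - y ≤ - x
  -‿mono-≤ {x} {y} x≤y = ≤-by (x≤y⇒0≤y-x x≤y)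
    (solve 2 (λ x y → :- x :- (:- y) := y :- x) refl x y)

  -‿nonNeg : ∀ {x} → x ≤ 0# → 0# ≤ - x
  -‿nonNeg {x} x≤0 = ≤-respʳ (+-identityˡ (- x)) (x≤y⇒0≤y-x x≤0)

  0≤1 : 0# ≤ 1#
  0≤1 with total 0# 1#
  ... | inj₁ 0≤1 = 0≤1
  ... | inj₂ 1≤0 = ≤-respʳ (solve 0 (:- # 1 :* (:- # 1) := # 1) refl)
                     (*-nonNeg (-‿nonNeg 1≤0) (-‿nonNeg 1≤0))

  0<1 : 0# < 1#
  0<1 = 0≤1 , 0≉1

  x<y⇒0<y-x : ∀ {x y} → x < y → 0# < y - x
  x<y⇒0<y-x {x} {y} (x≤y , x≉y) = x≤y⇒0≤y-x x≤y , λ 0≈y-x →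
    x≉y (trans (sym (+-identityˡ x)) (trans (+-congʳ 0≈y-x) (solve 2 (λ x y → y :- x :+ x := y) refl x y)))

  0<y-x⇒x<y : ∀ {x y} → 0# < y - x → x < y
  0<y-x⇒x<y {x} {y} (0≤y-x , 0≉y-x) = 0≤y-x⇒x≤y 0≤y-x , λ x≈y →
    0≉y-x (trans (sym (-‿inverseʳ x)) (+-congʳ x≈y))

  <-by : ∀ {x y p} → 0# < p → y - x ≈ p → x < y
  <-by 0<p eq = 0<y-x⇒x<y (<-respʳ (sym eq) 0<p)

  +-pos-nonNeg : ∀ {x y} → 0# < x → 0# ≤ y → 0# < x + y
  +-pos-nonNeg {x} {y} 0<x 0≤y =
    <-≤-trans 0<x (≤-by 0≤y (solve 2 (λ x y → (x :+ y) :- x := y) refl x y))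

  *-pos : ∀ {x y} → 0# < x → 0# < y → 0# < x * y
  *-pos {x} {y} (0≤x , 0≉x) (0≤y , 0≉y) = *-nonNeg 0≤x 0≤y , λ 0≈xy → 0≉y (begin
      0#               ≈⟨ zeroˡ (x ⁻¹) ⟨
      0# * x ⁻¹        ≈⟨ *-congʳ 0≈xy ⟩
      x * y * x ⁻¹     ≈⟨ solve 3 (λ x y z → x :* y :* z := (x :* z) :* y) refl x y (x ⁻¹) ⟩
      (x * x ⁻¹) * y   ≈⟨ *-congʳ (⁻¹-inverseʳ x (λ x≈0 → 0≉x (sym x≈0))) ⟩
      1# * y           ≈⟨ *-identityˡ y ⟩
      y                ∎)
    where open import Relation.Binary.Reasoning.Setoid setoid

  pos⇒≉0 : ∀ {x} → 0# < x → ¬ x ≈ 0#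
  pos⇒≉0 (_ , 0≉x) x≈0 = 0≉x (sym x≈0)

  ⁻¹-pos : ∀ {x} → 0# < x → 0# < x ⁻¹
  ⁻¹-pos {x} 0<x = ≰⇒> λ x⁻¹≤0 → <⇒≱ 0<1
    (≤-respˡ (⁻¹-inverseʳ x (pos⇒≉0 0<x)) (≤-respʳ (zeroʳ x) (*-monoˡ-≤ (<⇒≤ 0<x) x⁻¹≤0)))

  *-÷-cancel : ∀ {x} y → ¬ x ≈ 0# → x * (y ÷ x) ≈ y
  *-÷-cancel {x} y x≉0 = trans (solve 3 (λ x y z → x :* (y :* z) := (x :* z) :* y) refl x y (x ⁻¹))
    (trans (*-congʳ (⁻¹-inverseʳ x x≉0)) (*-identityˡ y))

  ÷-*-cancel : ∀ {x} y → ¬ x ≈ 0# → (y ÷ x) * x ≈ y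
  ÷-*-cancel y x≉0 = trans (*-comm _ _) (*-÷-cancel y x≉0)

  *-cancelˡ-≤ : ∀ {c x y} → 0# < c → c * x ≤ c * y → x ≤ y
  *-cancelˡ-≤ {c} {x} {y} 0<c cx≤cy =
    ≤-respˡ (cancel x) (≤-respʳ (cancel y) (*-monoˡ-≤ (<⇒≤ (⁻¹-pos 0<c)) cx≤cy))
    where
    cancel : ∀ z → c ⁻¹ * (c * z) ≈ z
    cancel z = trans (solve 3 (λ c z w → w :* (c :* z) := c :* (z :* w)) refl c z (c ⁻¹))
                     (*-÷-cancel z (pos⇒≉0 0<c))

  fromℕ-+ : ∀ m n → fromℕ (m ℕ.+ n) ≈ fromℕ m + fromℕ n
  fromℕ-+ = ×-homo-+ 1#

  fromℕ-* : ∀ m n → fromℕ (m ℕ.* n) ≈ fromℕ m * fromℕ n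
  fromℕ-* = ×1-homo-*

  fromℕ-nonNeg : ∀ n → 0# ≤ fromℕ n
  fromℕ-nonNeg zero    = ≤-refl
  fromℕ-nonNeg (suc n) = +-nonNeg 0≤1 (fromℕ-nonNeg n)

  fromℕ-pos : ∀ n → 0# < fromℕ (suc n)
  fromℕ-pos n = +-pos-nonNeg 0<1 (fromℕ-nonNeg n)

  fromℕ-mono : ∀ {m n} → m ℕ.≤ n → fromℕ m ≤ fromℕ n
  fromℕ-mono {n = n} ℕ.z≤n = fromℕ-nonNeg n
  fromℕ-mono (ℕ.s≤s m≤n) = +-mono-≤ ≤-refl (fromℕ-mono m≤n)

  half : Carrier → Carrier
  half x = x ÷ fromℕ 2

  half+half : ∀ x → half x + half x ≈ x
  half+half x = trans (solve 1 (λ x → x :+ x := # 2 :* x) refl (half x)) (*-÷-cancel x (pos⇒≉0 (fromℕ-pos 1)))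

  half-pos : ∀ {x} → 0# < x → 0# < half x
  half-pos 0<x = *-pos 0<x (⁻¹-pos (fromℕ-pos 1))

  half-< : ∀ {x} → 0# < x → half x < x
  half-< {x} 0<x = <-by (half-pos 0<x)
    (trans (+-congʳ (sym (half+half x))) (solve 1 (λ h → h :+ h :- h := h) refl (half x)))

  x≤∣x∣ : ∀ x → x ≤ ∣ x ∣
  x≤∣x∣ x with total 0# x
  ... | inj₁ 0≤x = ≤-refl
  ... | inj₂ x≤0 = ≤-trans x≤0 (-‿nonNeg x≤0)

  -x≤∣x∣ : ∀ x → - x ≤ ∣ x ∣
  -x≤∣x∣ x with total 0# x
  ... | inj₁ 0≤x = ≤-trans (≤-respʳ (solve 0 (:- # 0 := # 0) refl) (-‿mono-≤ 0≤x)) 0≤x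
  ... | inj₂ x≤0 = ≤-refl

  ∣x∣≤ : ∀ {x b} → x ≤ b → - x ≤ b → ∣ x ∣ ≤ b
  ∣x∣≤ {x} x≤b -x≤b with total 0# x
  ... | inj₁ _ = x≤b
  ... | inj₂ _ = -x≤b

  ∣x∣-nonNeg : ∀ x → 0# ≤ ∣ x ∣
  ∣x∣-nonNeg x with total 0# x
  ... | inj₁ 0≤x = 0≤x
  ... | inj₂ x≤0 = -‿nonNeg x≤0

  ∣x∣-cong : ∀ {x y} → x ≈ y → ∣ x ∣ ≈ ∣ y ∣
  ∣x∣-cong {x} {y} x≈y = ≤-antisym
    (∣x∣≤ (≤-respˡ (sym x≈y) (x≤∣x∣ y)) (≤-respˡ (-‿cong (sym x≈y)) (-x≤∣x∣ y)))
    (∣x∣≤ (≤-respˡ x≈y (x≤∣x∣ x)) (≤-respˡ (-‿cong x≈y) (-x≤∣x∣ x)))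

  ∣x∣<⇒ : ∀ {x b} → ∣ x ∣ < b → x < b × - x < b
  ∣x∣<⇒ {x} ∣x∣<b = ≤-<-trans (x≤∣x∣ x) ∣x∣<b , ≤-<-trans (-x≤∣x∣ x) ∣x∣<b

  ∣x∣< : ∀ {x b} → x < b → - x < b → ∣ x ∣ < b
  ∣x∣< {x} x<b -x<b with total 0# x
  ... | inj₁ _ = x<b
  ... | inj₂ _ = -x<b

  ∣x+y∣≤ : ∀ x y → ∣ x + y ∣ ≤ ∣ x ∣ + ∣ y ∣
  ∣x+y∣≤ x y = ∣x∣≤ (+-mono-≤ (x≤∣x∣ x) (x≤∣x∣ y))
    (≤-respˡ (solve 2 (λ x y → :- x :+ (:- y) := :- (x :+ y)) refl x y) (+-mono-≤ (-x≤∣x∣ x) (-x≤∣x∣ y)))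

  ∣x-y∣≈∣y-x∣ : ∀ x y → ∣ x - y ∣ ≈ ∣ y - x ∣
  ∣x-y∣≈∣y-x∣ x y = ≤-antisym (flip x y) (flip y x)
    where
    flip : ∀ x y → ∣ x - y ∣ ≤ ∣ y - x ∣
    flip x y = ∣x∣≤
      (≤-respˡ (solve 2 (λ x y → :- (y :- x) := x :- y) refl x y) (-x≤∣x∣ (y - x)))
      (≤-respˡ (solve 2 (λ x y → y :- x := :- (x :- y)) refl x y) (x≤∣x∣ (y - x)))

  nonNeg⇒∣x∣≈x : ∀ {x} → 0# ≤ x → ∣ x ∣ ≈ x
  nonNeg⇒∣x∣≈x {x} 0≤x = ≤-antisym (∣x∣≤ ≤-refl (≤-trans
    (≤-respʳ (solve 0 (:- # 0 := # 0) refl) (-‿mono-≤ 0≤x)) 0≤x)) (x≤∣x∣ x)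

  ∣x*c∣≈ : ∀ x {c} → 0# ≤ c → ∣ x * c ∣ ≈ ∣ x ∣ * c
  ∣x*c∣≈ x {c} 0≤c with total 0# x
  ... | inj₁ 0≤x = nonNeg⇒∣x∣≈x (*-nonNeg 0≤x 0≤c)
  ... | inj₂ x≤0 = begin
    ∣ x * c ∣         ≈⟨ ∣x∣-cong (solve 2 (λ x c → x :* c := # 0 :- (:- x :* c)) refl x c) ⟩
    ∣ 0# - - x * c ∣  ≈⟨ ∣x-y∣≈∣y-x∣ 0# (- x * c) ⟩
    ∣ - x * c - 0# ∣  ≈⟨ ∣x∣-cong (solve 2 (λ x c → :- x :* c :- # 0 := :- x :* c) refl x c) ⟩
    ∣ - x * c ∣       ≈⟨ nonNeg⇒∣x∣≈x (*-nonNeg (-‿nonNeg x≤0) 0≤c) ⟩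
    - x * c           ∎
    where open import Relation.Binary.Reasoning.Setoid setoid

  sum-mono : ∀ {n} {f g : Fin n → Carrier} → (∀ i → f i ≤ g i) → sum f ≤ sum g
  sum-mono {zero}  f≤g = ≤-refl
  sum-mono {suc n} f≤g = +-mono-≤ (f≤g fzero) (sum-mono (λ i → f≤g (fsuc i)))

  sum-nonNeg : ∀ {n} {f : Fin n → Carrier} → (∀ i → 0# ≤ f i) → 0# ≤ sum f
  sum-nonNeg {zero}  0≤f = ≤-refl
  sum-nonNeg {suc n} 0≤f = +-nonNeg (0≤f fzero) (sum-nonNeg (λ i → 0≤f (fsuc i)))

  term≤sum : ∀ {n} {f : Fin n → Carrier} → (∀ i → 0# ≤ f i) → ∀ i → f i ≤ sum f
  term≤sum {suc n} {f} 0≤f fzero    = ≤-respˡ (+-identityʳ _) (+-mono-≤ ≤-refl (sum-nonNeg (λ i → 0≤f (fsuc i))))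
  term≤sum {suc n} {f} 0≤f (fsuc i) = ≤-respˡ (+-identityˡ _) (+-mono-≤ (0≤f fzero) (term≤sum (λ i → 0≤f (fsuc i)) i))

  -- Archimedean property: a bounded set of multiples of c would have a supremum s,
  -- and s - c would still bound it.
  multiples-bounded⇒≤0 : ∀ c b → (∀ n → fromℕ n * c ≤ b) → c ≤ 0#
  multiples-bounded⇒≤0 c b bound = ≤-by (x≤y⇒0≤y-x s≤s-c) (solve 2 (λ c s → # 0 :- c := (s :- c) :- s) refl c s)
    where
    Multiple : Carrier → Set
    Multiple x = ∃[ n ] x ≈ fromℕ n * c

    lub = complete Multiple (0# , 0 , sym (zeroˡ c)) (b , λ { x (n , x≈nc) → ≤-respˡ (sym x≈nc) (bound n) })
    s = proj₁ lub

    s≤s-c : s ≤ s - c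
    s≤s-c = proj₂ (proj₂ lub) (s - c) λ { x (n , x≈nc) →
      ≤-by (x≤y⇒0≤y-x (proj₁ (proj₂ lub) (fromℕ (suc n) * c) (suc n , refl)))
        (trans (+-congˡ (-‿cong x≈nc))
          (solve 3 (λ c s n → s :- c :- n :* c := s :- (# 1 :+ n) :* c) refl c s (fromℕ n))) }

module Suprema (em : ∀ ℓ → ExcludedMiddle ℓ) (ℝ : CompleteOrderedField) where
  open OrderedField ℝ

  lub-approximable : ∀ {S : Carrier → Set} {x δ} → IsLUB _≤_ S x → 0# < δ → ∃[ s ] S s × x - δ < s
  lub-approximable {S} {x} {δ} (_ , least) 0<δ with em 0ℓ {∃[ s ] S s × x - δ < s}
  ... | yes found = found
  ... | no ¬found = contradiction (least (x - δ) below) (<⇒≱ (<-by 0<δ (solve 2 (λ x d → x :- (x :- d) := d) refl x δ)))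
    where
    below : ∀ s → S s → s ≤ x - δ
    below s Ss with em 0ℓ {s ≤ x - δ}
    ... | yes p = p
    ... | no ¬p = contradiction (s , Ss , ≰⇒> ¬p) ¬found

-- Colourings of the triangular grid.

module TriangularGrid where
  open import Data.Nat.Base
  open import Data.Nat.Properties renaming (_≟_ to _≟ℕ_)
  open import Data.Nat.Solver using (module +-*-Solver)
  open import Relation.Binary.PropositionalEquality
  open +-*-Solver using (solve; _:+_; _:*_; _:=_; con)

  -- Σ₂ m g and Σ₃ m f sum over all q + r = m and all p + q + r = m respectively.
  Σ₂ : ℕ → (ℕ → ℕ → ℕ) → ℕ
  Σ₂ zero    g = g 0 0
  Σ₂ (suc m) g = g 0 (suc m) + Σ₂ m (λ q r → g (suc q) r)

  Σ₃ : ℕ → (ℕ → ℕ → ℕ → ℕ) → ℕ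
  Σ₃ zero    f = f 0 0 0
  Σ₃ (suc m) f = Σ₂ (suc m) (f 0) + Σ₃ m (λ p → f (suc p))

  Σ₂-mono : ∀ m {f g} → (∀ q r → q + r ≡ m → f q r ≤ g q r) → Σ₂ m f ≤ Σ₂ m g
  Σ₂-mono zero    f≤g = f≤g 0 0 refl
  Σ₂-mono (suc m) f≤g = +-mono-≤ (f≤g 0 (suc m) refl) (Σ₂-mono m λ q r eq → f≤g (suc q) r (cong suc eq))

  Σ₃-mono : ∀ m {f g} → (∀ p q r → p + q + r ≡ m → f p q r ≤ g p q r) → Σ₃ m f ≤ Σ₃ m g
  Σ₃-mono zero    f≤g = f≤g 0 0 0 refl
  Σ₃-mono (suc m) f≤g = +-mono-≤ (Σ₂-mono (suc m) (f≤g 0)) (Σ₃-mono m λ p q r eq → f≤g (suc p) q r (cong suc eq))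

  Σ₂-cong : ∀ m {f g} → (∀ q r → q + r ≡ m → f q r ≡ g q r) → Σ₂ m f ≡ Σ₂ m g
  Σ₂-cong m f≡g = ≤-antisym (Σ₂-mono m λ q r eq → ≤-reflexive (f≡g q r eq))
                            (Σ₂-mono m λ q r eq → ≤-reflexive (sym (f≡g q r eq)))

  Σ₃-cong : ∀ m {f g} → (∀ p q r → p + q + r ≡ m → f p q r ≡ g p q r) → Σ₃ m f ≡ Σ₃ m g
  Σ₃-cong m f≡g = ≤-antisym (Σ₃-mono m λ p q r eq → ≤-reflexive (f≡g p q r eq))
                            (Σ₃-mono m λ p q r eq → ≤-reflexive (sym (f≡g p q r eq)))

  Σ₂-+ : ∀ m f g → Σ₂ m (λ q r → f q r + g q r) ≡ Σ₂ m f + Σ₂ m g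
  Σ₂-+ zero    f g = refl
  Σ₂-+ (suc m) f g = trans (cong (f 0 (suc m) + g 0 (suc m) +_) (Σ₂-+ m _ _))
    (solve 4 (λ a b c d → (a :+ b) :+ (c :+ d) := (a :+ c) :+ (b :+ d)) refl (f 0 (suc m)) (g 0 (suc m)) _ _)

  Σ₃-+ : ∀ m f g → Σ₃ m (λ p q r → f p q r + g p q r) ≡ Σ₃ m f + Σ₃ m g
  Σ₃-+ zero    f g = refl
  Σ₃-+ (suc m) f g = trans (cong₂ _+_ (Σ₂-+ (suc m) (f 0) (g 0)) (Σ₃-+ m _ _))
    (solve 4 (λ a b c d → (a :+ b) :+ (c :+ d) := (a :+ c) :+ (b :+ d)) refl (Σ₂ (suc m) (f 0)) (Σ₂ (suc m) (g 0)) _ _)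

  Σ₂-* : ∀ m c f → Σ₂ m (λ q r → c * f q r) ≡ c * Σ₂ m f
  Σ₂-* zero    c f = refl
  Σ₂-* (suc m) c f = trans (cong (c * f 0 (suc m) +_) (Σ₂-* m c _)) (sym (*-distribˡ-+ c _ _))

  Σ₃-* : ∀ m c f → Σ₃ m (λ p q r → c * f p q r) ≡ c * Σ₃ m f
  Σ₃-* zero    c f = refl
  Σ₃-* (suc m) c f = trans (cong₂ _+_ (Σ₂-* (suc m) c (f 0)) (Σ₃-* m c _)) (sym (*-distribˡ-+ c _ _))

  Σ₂-const : ∀ m c → Σ₂ m (λ _ _ → c) ≡ suc m * c
  Σ₂-const zero    c = sym (+-identityʳ c)
  Σ₂-const (suc m) c = cong (c +_) (Σ₂-const m c)

  Σ₂-0 : ∀ m → Σ₂ m (λ _ _ → 0) ≡ 0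
  Σ₂-0 m = trans (Σ₂-const m 0) (*-zeroʳ (suc m))

  Σ₃-0 : ∀ m → Σ₃ m (λ _ _ _ → 0) ≡ 0
  Σ₃-0 zero    = refl
  Σ₃-0 (suc m) = cong₂ _+_ (Σ₂-0 (suc m)) (Σ₃-0 m)

  Σ₂-[≡0] : ∀ m → Σ₂ m (λ q r → if does (0 ≟ℕ q) then 1 else 0) ≡ 1
  Σ₂-[≡0] zero    = refl
  Σ₂-[≡0] (suc m) = cong suc (Σ₂-0 m)

  Σ₃-[≡0] : ∀ m → Σ₃ m (λ p q r → if does (0 ≟ℕ p) then 1 else 0) ≡ suc m
  Σ₃-[≡0] zero    = refl
  Σ₃-[≡0] (suc m) = trans (cong₂ _+_ (trans (Σ₂-const (suc m) 1) (*-identityʳ (2+ m))) (Σ₃-0 m)) (+-identityʳ (2+ m))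

  Σ₂-sucʳ : ∀ m g → Σ₂ (suc m) g ≡ g (suc m) 0 + Σ₂ m (λ q r → g q (suc r))
  Σ₂-sucʳ zero    g = +-comm (g 0 1) (g 1 0)
  Σ₂-sucʳ (suc m) g = trans (cong (g 0 (suc (suc m)) +_) (Σ₂-sucʳ m (λ q r → g (suc q) r)))
    (solve 3 (λ a b c → a :+ (b :+ c) := b :+ (a :+ c)) refl (g 0 (suc (suc m))) (g (suc (suc m)) 0) _)

  -- The recursion of `Σ₃` peels off the side p = 0. The matching of triangles needs the same
  -- decomposition along the side q = 0 here, and along r = 0 in `Σ₃-suc₃`.
  Σ₃-suc₂ : ∀ m f → Σ₃ (suc m) f ≡ Σ₂ (suc m) (λ p r → f p 0 r) + Σ₃ m (λ p q r → f p (suc q) r)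
  Σ₃-suc₂ zero    f = solve 3 (λ a b c → (a :+ b) :+ c := (a :+ c) :+ b) refl (f 0 0 1) (f 0 1 0) (f 1 0 0)
  Σ₃-suc₂ (suc m) f = trans (cong (Σ₂ (suc (suc m)) (f 0) +_) (Σ₃-suc₂ m (λ p → f (suc p))))
    (solve 4 (λ a b c d → (a :+ b) :+ (c :+ d) := (a :+ c) :+ (b :+ d)) refl
       (f 0 0 (suc (suc m))) (Σ₂ (suc m) (λ q r → f 0 (suc q) r)) (Σ₂ (suc m) (λ p r → f (suc p) 0 r)) _)

  Σ₃-suc₃ : ∀ m f → Σ₃ (suc m) f ≡ Σ₂ (suc m) (λ p q → f p q 0) + Σ₃ m (λ p q r → f p q (suc r))
  Σ₃-suc₃ zero    f = solve 3 (λ a b c → (a :+ b) :+ c := (b :+ c) :+ a) refl (f 0 0 1) (f 0 1 0) (f 1 0 0)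
  Σ₃-suc₃ (suc m) f = trans (cong₂ _+_ (Σ₂-sucʳ (suc m) (f 0)) (Σ₃-suc₃ m (λ p → f (suc p))))
    (solve 4 (λ a b c d → (a :+ b) :+ (c :+ d) := (a :+ c) :+ (b :+ d)) refl
       (f 0 (suc (suc m)) 0) (Σ₂ (suc m) (λ q r → f 0 q (suc r))) (Σ₂ (suc m) (λ p q → f (suc p) q 0)) _)

  ⟦_≢_⟧ : Fin 3 → Fin 3 → ℕ
  ⟦ a ≢ b ⟧ = if does (a ≟ b) then 0 else 1

  ⟦_≡_⟧ : Fin 3 → Fin 3 → ℕ
  ⟦ a ≡ b ⟧ = if does (a ≟ b) then 1 else 0

  [≢]-triangle : ∀ a b c → ⟦ a ≢ c ⟧ ≤ ⟦ a ≢ b ⟧ + ⟦ b ≢ c ⟧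
  [≢]-triangle = toWitness {a? = all? λ a → all? λ b → all? λ c → _ ≤? _} tt

  [≢]-refl : ∀ a → ⟦ a ≢ a ⟧ ≡ 0
  [≢]-refl a rewrite dec-true (a ≟ a) refl = refl

  multicoloured : Fin 3 → Fin 3 → Fin 3 → ℕ
  multicoloured a b c = ⟦ a ≢ b ⟧ + ⟦ b ≢ c ⟧ + ⟦ a ≢ c ⟧

  monochromatic : Fin 3 → Fin 3 → Fin 3 → Fin 3 → ℕ
  monochromatic i a b c = ⟦ a ≡ i ⟧ * ⟦ b ≡ i ⟧ * ⟦ c ≡ i ⟧

  -- A triangle with two or three colours has at least two bichromatic sides. The left-hand side is
  -- written `2 * 1` to fit `Σ₃-*`.
  2≤multicoloured+monochromatic : ∀ a b c → 2 * 1 ≤ multicoloured a b c +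
    2 * (monochromatic 0F a b c + (monochromatic 1F a b c + monochromatic 2F a b c))
  2≤multicoloured+monochromatic = toWitness {a? = all? λ a → all? λ b → all? λ c → _ ≤? _} tt

  module _ (L : ℕ → ℕ → ℕ → Fin 3) where

    up : (Fin 3 → Fin 3 → Fin 3 → ℕ) → ℕ → ℕ → ℕ → ℕ
    up f p q r = f (L (suc p) q r) (L p (suc q) r) (L p q (suc r))

    corners-disjoint : ∀ a b c u v w →
      monochromatic 0F a u v + (monochromatic 1F u b w + monochromatic 2F v w c) ≤ 1
    corners-disjoint = toWitness {a? = all? λ a → all? λ b → all? λ c → all? λ u → all? λ v → all? λ w → _ ≤? 1} tt

    boundary : Fin 3 → ℕ → ℕ
    boundary 0F m = Σ₂ m (λ q r → up (monochromatic 0F) 0 q r)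
    boundary 1F m = Σ₂ m (λ p r → up (monochromatic 1F) p 0 r)
    boundary 2F m = Σ₂ m (λ p q → up (monochromatic 2F) p q 0)

    -- An upward triangle b of colour i with b_i ≥ 1 is matched with the downward
    -- triangle b - e_i. Two triangles matched with the same one share a vertex, so the
    -- matching is injective (Mirzakhani and Vondrák).
    sperner : ∀ m → 2 * suc (suc m) ≤
      Σ₃ (suc m) (up multicoloured) + 2 * (boundary 0F (suc m) + (boundary 1F (suc m) + boundary 2F (suc m)))
    sperner m = +-cancelʳ-≤ (2 * T) _ _ (begin
      2 * suc (suc m) + 2 * T                            ≡⟨ *-distribˡ-+ 2 (suc (suc m)) T ⟨
      2 * (suc (suc m) + T)                              ≡⟨ cong (λ z → 2 * (z + T)) (*-identityʳ (suc (suc m))) ⟨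
      2 * (suc (suc m) * 1 + T)                          ≡⟨ cong (λ z → 2 * (z + T)) (Σ₂-const (suc m) 1) ⟨
      2 * Σ₃ (suc m) (λ _ _ _ → 1)                       ≡⟨ Σ₃-* (suc m) 2 (λ _ _ _ → 1) ⟨
      Σ₃ (suc m) (λ _ _ _ → 2 * 1)
        ≤⟨ Σ₃-mono (suc m) {g = λ p q r → U p q r + 2 * M₊ p q r} (λ p q r _ →
             2≤multicoloured+monochromatic (L (suc p) q r) (L p (suc q) r) (L p q (suc r))) ⟩
      Σ₃ (suc m) (λ p q r → U p q r + 2 * M₊ p q r)      ≡⟨ Σ₃-+ (suc m) U (λ p q r → 2 * M₊ p q r) ⟩
      C + Σ₃ (suc m) (λ p q r → 2 * M₊ p q r)            ≡⟨ cong (C +_) (Σ₃-* (suc m) 2 M₊) ⟩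
      C + 2 * Σ₃ (suc m) M₊                              ≡⟨ cong (λ z → C + 2 * z) (Σ₃-+ (suc m) (M 0F) (λ p q r → M 1F p q r + M 2F p q r)) ⟩
      C + 2 * (Σ₃ (suc m) (M 0F) + Σ₃ (suc m) (λ p q r → M 1F p q r + M 2F p q r))
        ≡⟨ cong (λ z → C + 2 * (Σ₃ (suc m) (M 0F) + z)) (Σ₃-+ (suc m) (M 1F) (M 2F)) ⟩
      C + 2 * (Σ₃ (suc m) (M 0F) + (Σ₃ (suc m) (M 1F) + Σ₃ (suc m) (M 2F)))
        -- The triangles of colour i are split by their i-th coordinate: those where it is 0 lie on
        -- the side opposite to vertex i, the others are matched with downward triangles. For i = 0
        -- this split is the definition of `Σ₃`.
        ≡⟨ cong₂ (λ y z → C + 2 * ((B₀ + Σ₃ m I₀) + (y + z))) (Σ₃-suc₂ m (M 1F)) (Σ₃-suc₃ m (M 2F)) ⟩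
      C + 2 * ((B₀ + Σ₃ m I₀) + ((B₁ + Σ₃ m I₁) + (B₂ + Σ₃ m I₂)))
        ≡⟨ solve 7 (λ c x y z u v w → c :+ con 2 :* ((x :+ u) :+ ((y :+ v) :+ (z :+ w)))
             := (c :+ con 2 :* (x :+ (y :+ z))) :+ con 2 :* (u :+ (v :+ w))) refl C B₀ B₁ B₂ (Σ₃ m I₀) (Σ₃ m I₁) (Σ₃ m I₂) ⟩
      (C + 2 * (B₀ + (B₁ + B₂))) + 2 * (Σ₃ m I₀ + (Σ₃ m I₁ + Σ₃ m I₂))
        ≡⟨ cong (λ z → C + 2 * (B₀ + (B₁ + B₂)) + 2 * z)
             (trans (cong (Σ₃ m I₀ +_) (sym (Σ₃-+ m I₁ I₂))) (sym (Σ₃-+ m I₀ (λ p q r → I₁ p q r + I₂ p q r)))) ⟩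
      (C + 2 * (B₀ + (B₁ + B₂))) + 2 * Σ₃ m (λ p q r → I₀ p q r + (I₁ p q r + I₂ p q r))
        ≤⟨ +-monoʳ-≤ (C + 2 * (B₀ + (B₁ + B₂))) (*-monoʳ-≤ 2 (Σ₃-mono m {f = λ p q r → I₀ p q r + (I₁ p q r + I₂ p q r)} {g = λ _ _ _ → 1} λ p q r _ →
             corners-disjoint (L (2+ p) q r) (L p (2+ q) r) (L p q (2+ r)) (L (suc p) (suc q) r) (L (suc p) q (suc r)) (L p (suc q) (suc r)))) ⟩
      (C + 2 * (B₀ + (B₁ + B₂))) + 2 * T               ∎)
      where
      open ≤-Reasoning
      M : Fin 3 → ℕ → ℕ → ℕ → ℕ
      M i = up (monochromatic i)
      U M₊ I₀ I₁ I₂ : ℕ → ℕ → ℕ → ℕ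
      U = up multicoloured
      M₊ p q r = M 0F p q r + (M 1F p q r + M 2F p q r)
      I₀ p q r = M 0F (suc p) q r
      I₁ p q r = M 1F p (suc q) r
      I₂ p q r = M 2F p q (suc r)
      T = Σ₃ m (λ _ _ _ → 1)
      C = Σ₃ (suc m) U
      B₀ = boundary 0F (suc m)
      B₁ = boundary 1F (suc m)
      B₂ = boundary 2F (suc m)

  Σ₂-shiftˡ : ∀ k m g → (∀ q r → q < k → q + r ≡ k + m → g q r ≡ 0) →
              Σ₂ (k + m) g ≡ Σ₂ m (λ q r → g (k + q) r)
  Σ₂-shiftˡ zero    m g g≡0 = refl
  Σ₂-shiftˡ (suc k) m g g≡0 = cong₂ _+_ (g≡0 0 (suc (k + m)) z<s refl)
    (Σ₂-shiftˡ k m (λ q r → g (suc q) r) λ q r q<k eq → g≡0 (suc q) r (s<s q<k) (cong suc eq))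

  Σ₂-shiftʳ : ∀ k m g → (∀ q r → r < k → q + r ≡ k + m → g q r ≡ 0) →
              Σ₂ (k + m) g ≡ Σ₂ m (λ q r → g q (k + r))
  Σ₂-shiftʳ zero    m g g≡0 = refl
  Σ₂-shiftʳ (suc k) m g g≡0 = trans (Σ₂-sucʳ (k + m) g)
    (cong₂ _+_ (g≡0 (suc (k + m)) 0 z<s (+-identityʳ _))
      (Σ₂-shiftʳ k m (λ q r → g q (suc r)) λ q r r<k eq → g≡0 q (suc r) (s<s r<k) (trans (+-suc q r) (cong suc eq))))

  changes : ℕ → (ℕ → ℕ → Fin 3) → ℕ
  changes m c = Σ₂ m (λ q r → ⟦ c q (suc r) ≢ c (suc q) r ⟧)

  -- The triangle inequality for `⟦_≢_⟧` along the path, once from its first point to the chosen one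
  -- and once from there to the last.
  changes≥via : ∀ m c q r → q + r ≡ suc m →
    ⟦ c 0 (suc m) ≢ c q r ⟧ + ⟦ c q r ≢ c (suc m) 0 ⟧ ≤ changes m c
  changes≥via zero    c zero       r refl rewrite [≢]-refl (c 0 1) = ≤-refl
  changes≥via zero    c (suc zero) r refl rewrite [≢]-refl (c 1 0) = ≤-reflexive (+-identityʳ _)
  changes≥via (suc m) c zero       r refl rewrite [≢]-refl (c 0 (2+ m)) =
    ≤-trans ([≢]-triangle (c 0 (2+ m)) (c 1 (suc m)) (c (2+ m) 0))
      (+-monoʳ-≤ _ (≤-trans (m≤n+m _ _) (changes≥via m (λ q → c (suc q)) 0 (suc m) refl)))
  changes≥via (suc m) c (suc q)    r eq = begin
    ⟦ a ≢ x ⟧ + ⟦ x ≢ z ⟧               ≤⟨ +-monoˡ-≤ _ ([≢]-triangle a b x) ⟩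
    ⟦ a ≢ b ⟧ + ⟦ b ≢ x ⟧ + ⟦ x ≢ z ⟧   ≡⟨ +-assoc ⟦ a ≢ b ⟧ _ _ ⟩
    ⟦ a ≢ b ⟧ + (⟦ b ≢ x ⟧ + ⟦ x ≢ z ⟧) ≤⟨ +-monoʳ-≤ ⟦ a ≢ b ⟧ (changes≥via m (λ q → c (suc q)) q r (suc-injective eq)) ⟩
    changes (suc m) c                   ∎
    where
    open ≤-Reasoning
    a = c 0 (2+ m)
    b = c 1 (suc m)
    x = c (suc q) r
    z = c (2+ m) 0

  -- A visit to the colour i between the ends l and j forces two changes; without it, l and j still
  -- differ.
  detour : ∀ {i j l} → i ≢ j → i ≢ l → l ≢ j → ∀ x → suc ⟦ x ≡ i ⟧ ≤ ⟦ l ≢ x ⟧ + ⟦ x ≢ j ⟧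
  detour {i} {j} {l} i≢j i≢l l≢j x with x ≟ i
  ... | yes refl rewrite dec-false (l ≟ x) (≢-sym i≢l) | dec-false (x ≟ j) i≢j = ≤-refl
  ... | no  _    = ≤-trans (≤-reflexive l≢j≡1) ([≢]-triangle l x j)
    where
    l≢j≡1 : 1 ≡ ⟦ l ≢ j ⟧
    l≢j≡1 rewrite dec-false (l ≟ j) l≢j = refl

  side-bound : ∀ k c {i j l} → i ≢ j → i ≢ l → l ≢ j → let n = suc k; m = n + (n + k) in
    (∀ q r → q + r ≡ suc m → n + n < q → c q r ≡ j) →
    (∀ q r → q + r ≡ suc m → n + n < r → c q r ≡ l) →
    n + Σ₂ m (λ q r → ⟦ c (suc q) r ≡ i ⟧ * ⟦ c q (suc r) ≡ i ⟧) ≤ n * changes m c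
  side-bound k c {i} {j} {l} i≢j i≢l l≢j near-j near-l = begin
    n + Σ₂ m g                                ≡⟨ cong (n +_) (trans (Σ₂-shiftˡ n (n + k) g left≡0)
                                                   (Σ₂-shiftʳ n k (λ q r → g (n + q) r) right≡0)) ⟩
    n + Σ₂ k (λ q r → g (n + q) (n + r))      ≤⟨ +-monoʳ-≤ n (Σ₂-mono k {g = λ _ _ → P ∸ 1} λ q r eq →
                                                   g≤P∸1 (n + q) (n + r) (shifted q r eq)) ⟩
    n + Σ₂ k (λ _ _ → P ∸ 1)                  ≡⟨ cong (n +_) (Σ₂-const k (P ∸ 1)) ⟩
    n + n * (P ∸ 1)                           ≡⟨ *-suc n (P ∸ 1) ⟨
    n * suc (P ∸ 1)                           ≡⟨ cong (n *_) (m+[n∸m]≡n (≤-trans (s≤s z≤n) (via 0 (suc m) refl))) ⟩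
    n * P                                     ∎
    where
    open ≤-Reasoning
    n = suc k
    m = n + (n + k)
    P = changes m c
    g : ℕ → ℕ → ℕ
    g q r = ⟦ c (suc q) r ≡ i ⟧ * ⟦ c q (suc r) ≡ i ⟧

    [≡]-no : ∀ {x y} → x ≢ y → ⟦ x ≡ y ⟧ ≡ 0
    [≡]-no {x} {y} x≢y rewrite dec-false (x ≟ y) x≢y = refl

    [≡]≤1 : ∀ x y → ⟦ x ≡ y ⟧ ≤ 1
    [≡]≤1 x y with x ≟ y
    ... | yes _ = ≤-refl
    ... | no  _ = z≤n

    n+n<sm : n + n < suc m
    n+n<sm = s≤s (+-monoʳ-≤ n (m≤m+n n k))

    via : ∀ q r → q + r ≡ suc m → suc ⟦ c q r ≡ i ⟧ ≤ P
    via q r eq = ≤-trans (detour i≢j i≢l l≢j (c q r))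
      (subst₂ (λ a b → ⟦ a ≢ c q r ⟧ + ⟦ c q r ≢ b ⟧ ≤ P) (near-l 0 (suc m) refl n+n<sm) (near-j (suc m) 0 (+-identityʳ _) n+n<sm)
        (changes≥via m c q r eq))

    g≤P∸1 : ∀ q r → q + r ≡ m → g q r ≤ P ∸ 1
    g≤P∸1 q r eq = ≤-trans (*-monoʳ-≤ ⟦ c (suc q) r ≡ i ⟧ ([≡]≤1 (c q (suc r)) i))
      (≤-trans (≤-reflexive (*-identityʳ _)) (∸-monoˡ-≤ 1 (via (suc q) r (cong suc eq))))

    shifted : ∀ q r → q + r ≡ k → (n + q) + (n + r) ≡ m
    shifted q r refl = solve 3 (λ n q r → (n :+ q) :+ (n :+ r) := n :+ (n :+ (q :+ r))) refl n q r

    left≡0 : ∀ q r → q < n → q + r ≡ m → g q r ≡ 0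
    left≡0 q r (s≤s q≤k) eq = trans (cong (⟦ c (suc q) r ≡ i ⟧ *_)
        ([≡]-no (λ e → i≢l (trans (sym e) (near-l q (suc r) (trans (+-suc q r) (cong suc eq)) (s≤s n+n≤r))))))
      (*-zeroʳ ⟦ c (suc q) r ≡ i ⟧)
      where
      n+n≤r : n + n ≤ r
      n+n≤r = +-cancelʳ-≤ k (n + n) r (≤-trans (≤-reflexive (trans (+-assoc n n k) (sym eq)))
        (≤-trans (+-monoˡ-≤ r q≤k) (≤-reflexive (+-comm k r))))

    right≡0 : ∀ q r → r < n → q + r ≡ n + k → g (n + q) r ≡ 0
    right≡0 q r (s≤s r≤k) eq = cong (_* ⟦ c (n + q) (suc r) ≡ i ⟧)
      ([≡]-no (λ e → i≢j (trans (sym e) (near-j (suc (n + q)) r (cong suc (trans (+-assoc n q r) (cong (n +_) eq))) (s≤s (+-monoʳ-≤ n n≤q))))))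
      where
      n≤q : n ≤ q
      n≤q = +-cancelʳ-≤ k n q (≤-trans (≤-reflexive (sym eq)) (+-monoʳ-≤ q r≤k))

  module _ (k : ℕ) (L : ℕ → ℕ → ℕ → Fin 3) where
    private
      n = suc k
      m = n + (n + k)

    labelling-cost : ℕ
    labelling-cost = Σ₃ m (up L multicoloured) +
      (n + n) * (changes m (L 0) + (changes m (λ p r → L p 0 r) + changes m (λ p q → L p q 0)))

    labelling-cost≥12n :
      (∀ p q r → p + q + r ≡ suc m → n + n < p → L p q r ≡ 0F) →
      (∀ p q r → p + q + r ≡ suc m → n + n < q → L p q r ≡ 1F) →
      (∀ p q r → p + q + r ≡ suc m → n + n < r → L p q r ≡ 2F) →
      12 * n ≤ labelling-cost
    labelling-cost≥12n near₀ near₁ near₂ = begin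
      -- One half, 6n, is twice the excess `suc m` = 3n of upward over downward triangles; the other
      -- half pays 2n for each of the three sides. Since `sperner` is stated for a successor, its
      -- argument is m - 1.
      12 * n                                                ≡⟨ solve 1 (λ k → let n = con 1 :+ k in
          con 12 :* n := con 2 :* (con 2 :+ (k :+ (n :+ k))) :+ con 2 :* (n :+ (n :+ n))) refl k ⟩
      2 * suc m + 2 * (n + (n + n))                         ≤⟨ +-monoˡ-≤ (2 * (n + (n + n))) (sperner L (k + (n + k))) ⟩
      C + 2 * (B₀ + (B₁ + B₂)) + 2 * (n + (n + n))          ≡⟨ solve 5 (λ c x y z n →
          c :+ con 2 :* (x :+ (y :+ z)) :+ con 2 :* (n :+ (n :+ n)) :=
          c :+ con 2 :* ((n :+ x) :+ ((n :+ y) :+ (n :+ z)))) refl C B₀ B₁ B₂ n ⟩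
      C + 2 * ((n + B₀) + ((n + B₁) + (n + B₂)))            ≤⟨ +-monoʳ-≤ C (*-monoʳ-≤ 2 (+-mono-≤ side₀ (+-mono-≤ side₁ side₂))) ⟩
      C + 2 * (n * P₀ + (n * P₁ + n * P₂))                  ≡⟨ solve 5 (λ c x y z n →
          c :+ con 2 :* (n :* x :+ (n :* y :+ n :* z)) := c :+ (n :+ n) :* (x :+ (y :+ z))) refl C P₀ P₁ P₂ n ⟩
      labelling-cost                                        ∎
      where
      open ≤-Reasoning
      C = Σ₃ m (up L multicoloured)
      B₀ = boundary L 0F m
      B₁ = boundary L 1F m
      B₂ = boundary L 2F m
      P₀ = changes m (L 0)
      P₁ = changes m (λ p r → L p 0 r)
      P₂ = changes m (λ p q → L p q 0)

      drop : ∀ i a b c → monochromatic i a b c ≤ ⟦ b ≡ i ⟧ * ⟦ c ≡ i ⟧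
      drop = toWitness {a? = all? λ i → all? λ a → all? λ b → all? λ c → _ ≤? _} tt

      drop₂ : ∀ i a b c → monochromatic i a b c ≤ ⟦ a ≡ i ⟧ * ⟦ c ≡ i ⟧
      drop₂ = toWitness {a? = all? λ i → all? λ a → all? λ b → all? λ c → _ ≤? _} tt

      drop₃ : ∀ i a b c → monochromatic i a b c ≤ ⟦ a ≡ i ⟧ * ⟦ b ≡ i ⟧
      drop₃ = toWitness {a? = all? λ i → all? λ a → all? λ b → all? λ c → _ ≤? _} tt

      zeroᵐ : ∀ p q → p + q ≡ suc m → p + 0 + q ≡ suc m
      zeroᵐ p q eq = trans (cong (_+ q) (+-identityʳ p)) eq

      side₀ : n + B₀ ≤ n * P₀
      side₀ = ≤-trans (+-monoʳ-≤ n (Σ₂-mono m λ q r _ → drop 0F (L 1 q r) (L 0 (suc q) r) (L 0 q (suc r))))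
        (side-bound k (L 0) {0F} {1F} {2F} (λ ()) (λ ()) (λ ()) (λ q r → near₁ 0 q r) (λ q r → near₂ 0 q r))

      side₁ : n + B₁ ≤ n * P₁
      side₁ = ≤-trans (+-monoʳ-≤ n (Σ₂-mono m λ p r _ → drop₂ 1F (L (suc p) 0 r) (L p 1 r) (L p 0 (suc r))))
        (side-bound k (λ p r → L p 0 r) {1F} {0F} {2F} (λ ()) (λ ()) (λ ())
          (λ p r eq → near₀ p 0 r (zeroᵐ p r eq)) (λ p r eq → near₂ p 0 r (zeroᵐ p r eq)))

      side₂ : n + B₂ ≤ n * P₂
      side₂ = ≤-trans (+-monoʳ-≤ n (Σ₂-mono m λ p q _ → drop₃ 2F (L (suc p) q 0) (L p (suc q) 0) (L p q 1)))
        (side-bound k (λ p q → L p q 0) {2F} {0F} {1F} (λ ()) (λ ()) (λ ())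
          (λ p q eq → near₀ p q 0 (trans (+-identityʳ _) eq)) (λ p q eq → near₁ p q 0 (trans (+-identityʳ _) eq)))

  -- Lengths in the grid with contracted corners.

  Σ₃-shift₁ : ∀ k m f → (∀ p q r → p < k → f p q r ≡ 0) → Σ₃ (k + m) f ≡ Σ₃ m (λ p q r → f (k + p) q r)
  Σ₃-shift₁ zero    m f f≡0 = refl
  Σ₃-shift₁ (suc k) m f f≡0 = cong₂ _+_ (trans (Σ₂-cong (suc k + m) {g = λ _ _ → 0} λ q r _ → f≡0 0 q r z<s) (Σ₂-0 (suc k + m)))
    (Σ₃-shift₁ k m (λ p → f (suc p)) λ p q r p<k → f≡0 (suc p) q r (s<s p<k))

  Σ₃-swap₁₂ : ∀ m f → Σ₃ m f ≡ Σ₃ m (λ p q r → f q p r)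
  Σ₃-swap₁₂ zero    f = refl
  Σ₃-swap₁₂ (suc m) f = trans (cong (Σ₂ (suc m) (f 0) +_) (Σ₃-swap₁₂ m (λ p → f (suc p))))
                              (sym (Σ₃-suc₂ m (λ p q r → f q p r)))

  Σ₂-swap : ∀ m g → Σ₂ m g ≡ Σ₂ m (λ q r → g r q)
  Σ₂-swap zero    g = refl
  Σ₂-swap (suc m) g = trans (cong (g 0 (suc m) +_) (Σ₂-swap m (λ q → g (suc q)))) (sym (Σ₂-sucʳ m (λ q r → g r q)))

  Σ₃-swap₁₃ : ∀ m f → Σ₃ m f ≡ Σ₃ m (λ p q r → f r q p)
  Σ₃-swap₁₃ zero    f = refl
  Σ₃-swap₁₃ (suc m) f = trans (cong₂ _+_ (Σ₂-swap (suc m) (f 0)) (Σ₃-swap₁₃ m (λ p → f (suc p))))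
    (trans (cong (_+ Σ₃ m (λ p q r → f (suc r) q p)) (Σ₂-cong (suc m) {g = λ p q → f 0 q p} λ _ _ _ → refl))
           (sym (Σ₃-suc₃ m (λ p q r → f r q p))))

  2*Σ₃-1 : ∀ m → 2 * Σ₃ m (λ _ _ _ → 1) ≡ suc m * suc (suc m)
  2*Σ₃-1 zero    = refl
  2*Σ₃-1 (suc m) = trans (*-distribˡ-+ 2 (Σ₂ (suc m) (λ _ _ → 1)) (Σ₃ m (λ _ _ _ → 1)))
    (trans (cong₂ _+_ (cong (2 *_) (trans (Σ₂-const (suc m) 1) (*-identityʳ (suc (suc m))))) (2*Σ₃-1 m))
      (solve 1 (λ m → con 2 :* (con 2 :+ m) :+ (con 1 :+ m) :* (con 2 :+ m) := (con 2 :+ m) :* (con 3 :+ m)) refl m))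

  open import Relation.Binary.Definitions using (tri<; tri≈; tri>)

  Triple : Set
  Triple = ℕ × ℕ × ℕ

  ℓ₁ : Triple → Triple → ℕ
  ℓ₁ (p , q , r) (p′ , q′ , r′) = ∣ p - p′ ∣ + (∣ q - q′ ∣ + ∣ r - r′ ∣)

  ∣suc-∣ : ∀ p → ∣ suc p - p ∣ ≡ 1
  ∣suc-∣ zero    = refl
  ∣suc-∣ (suc p) = ∣suc-∣ p

  ∣-suc∣ : ∀ p → ∣ p - suc p ∣ ≡ 1
  ∣-suc∣ zero    = refl
  ∣-suc∣ (suc p) = ∣-suc∣ p

  ∣-∣-+ʳ : ∀ a b → ∣ a + b - a ∣ ≡ b
  ∣-∣-+ʳ zero    b = ∣-∣-identityʳ b
  ∣-∣-+ʳ (suc a) b = ∣-∣-+ʳ a b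

  module Contraction (k : ℕ) where
    n = suc k
    m = n + (n + k)
    N = suc m

    -- The grid points nearer than n to a vertex of Δ are identified with that vertex.
    contract : ℕ → ℕ → ℕ → Triple
    contract p q r = if does (suc (n + n) ≤? p) then (N , 0 , 0) else
                     if does (suc (n + n) ≤? q) then (0 , N , 0) else
                     if does (suc (n + n) ≤? r) then (0 , 0 , N) else (p , q , r)

    contract₀ : ∀ {p q r} → n + n < p → contract p q r ≡ (N , 0 , 0)
    contract₀ {p} 2n<p rewrite dec-true (suc (n + n) ≤? p) 2n<p = refl

    contract₁ : ∀ {p q r} → p ≤ n + n → n + n < q → contract p q r ≡ (0 , N , 0)
    contract₁ {p} {q} p≤ 2n<q rewrite dec-false (suc (n + n) ≤? p) (≤⇒≯ p≤) | dec-true (suc (n + n) ≤? q) 2n<q = refl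

    contract₂ : ∀ {p q r} → p ≤ n + n → q ≤ n + n → n + n < r → contract p q r ≡ (0 , 0 , N)
    contract₂ {p} {q} {r} p≤ q≤ 2n<r rewrite dec-false (suc (n + n) ≤? p) (≤⇒≯ p≤)
      | dec-false (suc (n + n) ≤? q) (≤⇒≯ q≤) | dec-true (suc (n + n) ≤? r) 2n<r = refl

    contract-mid : ∀ {p q r} → p ≤ n + n → q ≤ n + n → r ≤ n + n → contract p q r ≡ (p , q , r)
    contract-mid {p} {q} {r} p≤ q≤ r≤ rewrite dec-false (suc (n + n) ≤? p) (≤⇒≯ p≤)
      | dec-false (suc (n + n) ≤? q) (≤⇒≯ q≤) | dec-false (suc (n + n) ≤? r) (≤⇒≯ r≤) = refl

    perimeter : ℕ → ℕ → ℕ → ℕ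
    perimeter p q r = ℓ₁ a b + ℓ₁ b c + ℓ₁ a c
      where
      a = contract (suc p) q r
      b = contract p (suc q) r
      c = contract p q (suc r)

    [2n≤_] [2n≡_] : ℕ → ℕ
    [2n≤ x ] = if does (n + n ≤? x) then 1 else 0
    [2n≡ x ] = if does (n + n ≟ℕ x) then 1 else 0

    data Position (x : ℕ) : Set where
      below : x < n + n → [2n≤ x ] ≡ 0 → [2n≡ x ] ≡ 0 → Position x
      at    : x ≡ n + n → [2n≤ x ] ≡ 1 → [2n≡ x ] ≡ 1 → Position x
      above : n + n < x → [2n≤ x ] ≡ 1 → [2n≡ x ] ≡ 0 → Position x

    indicators-below₁ : ∀ {x} → x < n + n → [2n≤ x ] ≡ 0
    indicators-below₁ {x} x<2n = cong (if_then 1 else 0) (dec-false (n + n ≤? x) (<⇒≱ x<2n))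

    indicators-below₂ : ∀ {x} → x < n + n → [2n≡ x ] ≡ 0
    indicators-below₂ {x} x<2n = cong (if_then 1 else 0) (dec-false (n + n ≟ℕ x) (λ eq → <⇒≢ x<2n (sym eq)))

    position : ∀ x → Position x
    position x with <-cmp x (n + n)
    ... | tri< x<2n _ _ = below x<2n (indicators-below₁ x<2n) (indicators-below₂ x<2n)
    ... | tri≈ _ x≡2n _ = at x≡2n (cong (if_then 1 else 0) (dec-true (n + n ≤? x) (≤-reflexive (sym x≡2n))))
                                  (cong (if_then 1 else 0) (dec-true (n + n ≟ℕ x) (sym x≡2n)))
    ... | tri> _ _ 2n<x = above 2n<x (cong (if_then 1 else 0) (dec-true (n + n ≤? x) (<⇒≤ 2n<x)))
                                     (cong (if_then 1 else 0) (dec-false (n + n ≟ℕ x) (<⇒≢ 2n<x)))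

    N≡3n : N ≡ (n + n) + n
    N≡3n = solve 1 (λ k → let n = con 1 :+ k in con 1 :+ (n :+ (n :+ k)) := (n :+ n) :+ n) refl k

    ∣N-2n∣ : ∣ N - (n + n) ∣ ≡ n
    ∣N-2n∣ = trans (cong ∣_- (n + n) ∣ N≡3n) (∣-∣-+ʳ (n + n) n)

    ∣2n-N∣ : ∣ (n + n) - N ∣ ≡ n
    ∣2n-N∣ = trans (∣-∣-comm (n + n) N) ∣N-2n∣

    k<2n : k < n + n
    k<2n = s≤s (m≤m+n k n)

    -- The coordinates of an upward triangle sum to m = 2n + k with k < 2n, so at most one of them
    -- reaches 2n. This makes the three corners independent.
    others-small : ∀ {a b c} → n + n ≤ a → b ≤ c → a + c ≡ m → b < n + n
    others-small {a} {b} {c} 2n≤a b≤c eq = ≤-<-trans (≤-trans b≤c (+-cancelˡ-≤ (n + n) c k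
      (≤-trans (+-monoˡ-≤ c 2n≤a) (≤-reflexive (trans eq (sym (+-assoc n n k))))))) k<2n

    corner-sum : ∀ {a c} → a ≡ n + n → a + c ≡ m → c ≡ k
    corner-sum {c = c} refl eq = +-cancelˡ-≡ (n + n) c k (trans eq (sym (+-assoc n n k)))

    perimeter-mid : ∀ {p q r} → p < n + n → q < n + n → r < n + n → perimeter p q r ≡ 6
    perimeter-mid {p} {q} {r} p< q< r<
      rewrite contract-mid p< (<⇒≤ q<) (<⇒≤ r<) | contract-mid (<⇒≤ p<) q< (<⇒≤ r<) | contract-mid (<⇒≤ p<) (<⇒≤ q<) r<
            | ∣suc-∣ p | ∣-suc∣ q | ∣suc-∣ q | ∣-suc∣ r | ∣n-n∣≡0 p | ∣n-n∣≡0 q | ∣n-n∣≡0 r = refl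

    -- ℓ₁ is twice the length; an upward triangle whose top vertex is contracted has two
    -- sides of length n and one of length 1.
    cut-off : ℕ
    cut-off = 4 * n + 2

    cut-off≡ : ∀ {s} → s ≡ k → 2 * n + 2 * s + 4 ≡ cut-off
    cut-off≡ refl = solve 1 (λ k → con 2 :* (con 1 :+ k) :+ con 2 :* k :+ con 4 := con 4 :* (con 1 :+ k) :+ con 2) refl k

    perimeter-at₀ : ∀ {p q r} → p ≡ n + n → q + r ≡ k → q < n + n → r < n + n → perimeter p q r ≡ cut-off
    perimeter-at₀ {p} {q} {r} refl eq q< r<
      rewrite contract₀ {suc (n + n)} {q} {r} ≤-refl | contract-mid {n + n} ≤-refl q< (<⇒≤ r<)
            | contract-mid {n + n} ≤-refl (<⇒≤ q<) r<
            | ∣N-2n∣ | ∣n-n∣≡0 (n + n) | ∣suc-∣ q | ∣-suc∣ r =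
      trans (solve 3 (λ n q r → (n :+ (con 1 :+ q :+ r)) :+ con 2 :+ (n :+ (q :+ (con 1 :+ r))) :=
                                con 2 :* n :+ con 2 :* (q :+ r) :+ con 4) refl n q r)
        (cut-off≡ eq)

    perimeter-at₁ : ∀ {p q r} → q ≡ n + n → p + r ≡ k → p < n + n → r < n + n → perimeter p q r ≡ cut-off
    perimeter-at₁ {p} {q} {r} refl eq p< r<
      rewrite contract₁ {p} {suc (n + n)} {r} (<⇒≤ p<) ≤-refl | contract-mid {suc p} {n + n} p< ≤-refl (<⇒≤ r<)
            | contract-mid {p} {n + n} (<⇒≤ p<) ≤-refl r<
            | ∣2n-N∣ | ∣N-2n∣ | ∣n-n∣≡0 (n + n) | ∣suc-∣ p | ∣-suc∣ r | ∣-∣-identityʳ r =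
      trans (solve 3 (λ n q r → ((con 1 :+ q) :+ (n :+ r)) :+ (q :+ (n :+ (con 1 :+ r))) :+ con 2 :=
                                con 2 :* n :+ con 2 :* (q :+ r) :+ con 4) refl n p r)
        (cut-off≡ eq)

    perimeter-at₂ : ∀ {p q r} → r ≡ n + n → p + q ≡ k → p < n + n → q < n + n → perimeter p q r ≡ cut-off
    perimeter-at₂ {p} {q} {r} refl eq p< q<
      rewrite contract₂ {p} {q} {suc (n + n)} (<⇒≤ p<) (<⇒≤ q<) ≤-refl | contract-mid {suc p} {q} {n + n} p< (<⇒≤ q<) ≤-refl
            | contract-mid {p} {suc q} {n + n} (<⇒≤ p<) q< ≤-refl
            | ∣2n-N∣ | ∣n-n∣≡0 (n + n) | ∣suc-∣ p | ∣-suc∣ q | ∣-∣-identityʳ q | ∣-∣-identityʳ p =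
      trans (solve 3 (λ n p q → con 2 :+ (p :+ ((con 1 :+ q) :+ n)) :+ ((con 1 :+ p) :+ (q :+ n)) :=
                                con 2 :* n :+ con 2 :* (p :+ q) :+ con 4) refl n p q)
        (cut-off≡ eq)

    ℓ₁-refl : ∀ t → ℓ₁ t t ≡ 0
    ℓ₁-refl (p , q , r) rewrite ∣n-n∣≡0 p | ∣n-n∣≡0 q | ∣n-n∣≡0 r = refl

    collapsed : ∀ {a b c t} → a ≡ t → b ≡ t → c ≡ t → ℓ₁ a b + ℓ₁ b c + ℓ₁ a c ≡ 0
    collapsed {t = t} refl refl refl rewrite ℓ₁-refl t = refl

    perimeter-above₀ : ∀ {p q r} → n + n < p → perimeter p q r ≡ 0
    perimeter-above₀ {p} {q} {r} 2n<p =
      collapsed (contract₀ {suc p} {q} {r} (m<n⇒m<1+n 2n<p)) (contract₀ {p} {suc q} {r} 2n<p) (contract₀ {p} {q} {suc r} 2n<p)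

    perimeter-above₁ : ∀ {p q r} → n + n < q → p < n + n → perimeter p q r ≡ 0
    perimeter-above₁ {p} {q} {r} 2n<q p< =
      collapsed (contract₁ {suc p} {q} {r} p< 2n<q) (contract₁ {p} {suc q} {r} (<⇒≤ p<) (m<n⇒m<1+n 2n<q)) (contract₁ {p} {q} {suc r} (<⇒≤ p<) 2n<q)

    perimeter-above₂ : ∀ {p q r} → n + n < r → p < n + n → q < n + n → perimeter p q r ≡ 0
    perimeter-above₂ {p} {q} {r} 2n<r p< q< =
      collapsed (contract₂ {suc p} {q} {r} p< (<⇒≤ q<) 2n<r) (contract₂ {p} {suc q} {r} (<⇒≤ p<) q< 2n<r) (contract₂ {p} {q} {suc r} (<⇒≤ p<) (<⇒≤ q<) (m<n⇒m<1+n 2n<r))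

    -- The perimeter is 6, `cut-off` or 0 according to whether the largest coordinate is below, at
    -- or above 2n. Moving the correction for the corners to the left avoids subtraction, and leaves
    -- sums of indicators that are easy to evaluate.
    perimeter-bound : ∀ p q r → p + q + r ≡ m →
      perimeter p q r + 6 * ([2n≤ p ] + ([2n≤ q ] + [2n≤ r ])) ≤ 6 + cut-off * ([2n≡ p ] + ([2n≡ q ] + [2n≡ r ]))
    perimeter-bound p q r eq = go (position p) (position q) (position r)
      where
      p+[q+r] : p + (q + r) ≡ m
      p+[q+r] = trans (sym (+-assoc p q r)) eq
      q+[p+r] : q + (p + r) ≡ m
      q+[p+r] = trans (trans (sym (+-assoc q p r)) (cong (_+ r) (+-comm q p))) eq
      r+[p+q] : r + (p + q) ≡ m
      r+[p+q] = trans (+-comm r (p + q)) eq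

      Bound : Set
      Bound = perimeter p q r + 6 * ([2n≤ p ] + ([2n≤ q ] + [2n≤ r ])) ≤ 6 + cut-off * ([2n≡ p ] + ([2n≡ q ] + [2n≡ r ]))

      at-value : ∀ {E} → E ≡ cut-off → E + 6 * 1 ≤ 6 + cut-off * 1
      at-value refl = ≤-reflexive (trans (+-comm cut-off 6) (cong (6 +_) (sym (*-identityʳ cut-off))))

      above-value : ∀ {E} → E ≡ 0 → E + 6 * 1 ≤ 6 + cut-off * 0
      above-value refl = m≤m+n 6 _

      at-or-above₀ : n + n ≤ p → Bound
      at-or-above₀ 2n≤p with others-small 2n≤p (m≤m+n q r) p+[q+r] | others-small 2n≤p (m≤n+m r q) p+[q+r] | position p
      ... | q< | r< | below p<2n _ _ = contradiction 2n≤p (<⇒≱ p<2n)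
      ... | q< | r< | at p≡ e f rewrite indicators-below₁ q< | indicators-below₂ q< | indicators-below₁ r< | indicators-below₂ r< | e | f =
        at-value (perimeter-at₀ p≡ (corner-sum p≡ p+[q+r]) q< r<)
      ... | q< | r< | above p> e f rewrite indicators-below₁ q< | indicators-below₂ q< | indicators-below₁ r< | indicators-below₂ r< | e | f =
        above-value (perimeter-above₀ {p} {q} {r} p>)

      at-or-above₁ : n + n ≤ q → Bound
      at-or-above₁ 2n≤q with others-small 2n≤q (m≤m+n p r) q+[p+r] | others-small 2n≤q (m≤n+m r p) q+[p+r] | position q
      ... | p< | r< | below q<2n _ _ = contradiction 2n≤q (<⇒≱ q<2n)
      ... | p< | r< | at q≡ e f rewrite indicators-below₁ p< | indicators-below₂ p< | indicators-below₁ r< | indicators-below₂ r< | e | f =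
        at-value (perimeter-at₁ q≡ (corner-sum q≡ q+[p+r]) p< r<)
      ... | p< | r< | above q> e f rewrite indicators-below₁ p< | indicators-below₂ p< | indicators-below₁ r< | indicators-below₂ r< | e | f =
        above-value (perimeter-above₁ {p} {q} {r} q> p<)

      at-or-above₂ : n + n ≤ r → Bound
      at-or-above₂ 2n≤r with others-small 2n≤r (m≤m+n p q) r+[p+q] | others-small 2n≤r (m≤n+m q p) r+[p+q] | position r
      ... | p< | q< | below r<2n _ _ = contradiction 2n≤r (<⇒≱ r<2n)
      ... | p< | q< | at r≡ e f rewrite indicators-below₁ p< | indicators-below₂ p< | indicators-below₁ q< | indicators-below₂ q< | e | f =
        at-value (perimeter-at₂ r≡ (corner-sum r≡ r+[p+q]) p< q<)
      ... | p< | q< | above r> e f rewrite indicators-below₁ p< | indicators-below₂ p< | indicators-below₁ q< | indicators-below₂ q< | e | f =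
        above-value (perimeter-above₂ {p} {q} {r} r> p< q<)

      go : Position p → Position q → Position r → Bound
      go (at p≡ _ _)    _ _ = at-or-above₀ (≤-reflexive (sym p≡))
      go (above p> _ _) _ _ = at-or-above₀ (<⇒≤ p>)
      go _ (at q≡ _ _)    _ = at-or-above₁ (≤-reflexive (sym q≡))
      go _ (above q> _ _) _ = at-or-above₁ (<⇒≤ q>)
      go _ _ (at r≡ _ _)    = at-or-above₂ (≤-reflexive (sym r≡))
      go _ _ (above r> _ _) = at-or-above₂ (<⇒≤ r>)
      go (below p< a b) (below q< c d) (below r< e f) rewrite perimeter-mid p< q< r< | a | b | c | d | e | f = ≤-reflexive (cong (6 +_) (sym (*-zeroʳ cut-off)))

    Σ₃-[2n≤] : Σ₃ m (λ p q r → [2n≤ p ]) ≡ Σ₃ k (λ _ _ _ → 1)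
    Σ₃-[2n≤] = trans (cong (λ z → Σ₃ z (λ p q r → [2n≤ p ])) (sym (+-assoc n n k)))
      (trans (Σ₃-shift₁ (n + n) k (λ p q r → [2n≤ p ]) (λ p q r → indicators-below₁))
        (Σ₃-cong k {f = λ p q r → [2n≤ n + n + p ]} λ p q r _ → cong (if_then 1 else 0) (dec-true (n + n ≤? n + n + p) (m≤m+n (n + n) p))))

    Σ₂-[2n≤] : Σ₂ m (λ q r → [2n≤ q ]) ≡ n
    Σ₂-[2n≤] = trans (cong (λ z → Σ₂ z (λ q r → [2n≤ q ])) (sym (+-assoc n n k)))
      (trans (Σ₂-shiftˡ (n + n) k (λ q r → [2n≤ q ]) (λ q r q< _ → indicators-below₁ q<))
        (trans (Σ₂-cong k {f = λ q r → [2n≤ n + n + q ]} {g = λ _ _ → 1} λ q r _ → cong (if_then 1 else 0) (dec-true (n + n ≤? n + n + q) (m≤m+n (n + n) q)))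
          (trans (Σ₂-const k 1) (*-identityʳ n))))

    [2n≡2n+] : ∀ x → [2n≡ n + n + x ] ≡ (if does (0 ≟ℕ x) then 1 else 0)
    [2n≡2n+] zero    = cong (if_then 1 else 0) (dec-true (n + n ≟ℕ n + n + 0) (sym (+-identityʳ (n + n))))
    [2n≡2n+] (suc x) = cong (if_then 1 else 0) (dec-false (n + n ≟ℕ n + n + suc x) λ eq → <⇒≢ (m<m+n (n + n) z<s) eq)

    Σ₃-[2n≡] : Σ₃ m (λ p q r → [2n≡ p ]) ≡ n
    Σ₃-[2n≡] = trans (cong (λ z → Σ₃ z (λ p q r → [2n≡ p ])) (sym (+-assoc n n k)))
      (trans (Σ₃-shift₁ (n + n) k (λ p q r → [2n≡ p ]) (λ p q r → indicators-below₂))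
        (trans (Σ₃-cong k {f = λ p q r → [2n≡ n + n + p ]} λ p q r _ → [2n≡2n+] p) (Σ₃-[≡0] k)))

    Σ₂-[2n≡] : Σ₂ m (λ q r → [2n≡ q ]) ≡ 1
    Σ₂-[2n≡] = trans (cong (λ z → Σ₂ z (λ q r → [2n≡ q ])) (sym (+-assoc n n k)))
      (trans (Σ₂-shiftˡ (n + n) k (λ q r → [2n≡ q ]) (λ q r q< _ → indicators-below₂ q<))
        (trans (Σ₂-cong k {f = λ q r → [2n≡ n + n + q ]} λ q r _ → [2n≡2n+] q) (Σ₂-[≡0] k)))

    Σ₃-thrice : ∀ (g : ℕ → ℕ) s → Σ₃ m (λ p q r → g p) ≡ s → Σ₃ m (λ p q r → g p + (g q + g r)) ≡ s + (s + s)
    Σ₃-thrice g s eq = trans (Σ₃-+ m (λ p q r → g p) (λ p q r → g q + g r))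
      (cong₂ _+_ eq (trans (Σ₃-+ m (λ p q r → g q) (λ p q r → g r))
        (cong₂ _+_ (trans (Σ₃-swap₁₂ m (λ p q r → g q)) eq) (trans (Σ₃-swap₁₃ m (λ p q r → g r)) eq))))

    Σ₂-twice : ∀ (g : ℕ → ℕ) s → Σ₂ m (λ q r → g q) ≡ s → Σ₂ m (λ q r → g q + g r) ≡ s + s
    Σ₂-twice g s eq = trans (Σ₂-+ m (λ q r → g q) (λ q r → g r)) (cong₂ _+_ eq (trans (Σ₂-swap m (λ q r → g r)) eq))

    -- Of the 3n (3n + 1) / 2 triangles, 3n (n + 1) / 2 have a coordinate of at least 2n. The
    -- remaining 3n² contribute 18n², and the 3n triangles with a coordinate equal to 2n contribute
    -- 3n (4n + 2).
    Σ₃-perimeter : Σ₃ m perimeter ≤ 30 * (n * n) + 6 * n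
    Σ₃-perimeter = +-cancelʳ-≤ (18 * T) _ _ (begin
      Σ₃ m perimeter + 18 * T
        ≡⟨ cong (Σ₃ m perimeter +_) (solve 1 (λ t → con 18 :* t := con 6 :* (t :+ (t :+ t))) refl T) ⟩
      Σ₃ m perimeter + 6 * (T + (T + T))
        ≡⟨ cong (λ z → Σ₃ m perimeter + 6 * z) (Σ₃-thrice [2n≤_] T Σ₃-[2n≤]) ⟨
      Σ₃ m perimeter + 6 * Σ₃ m (λ p q r → [2n≤ p ] + ([2n≤ q ] + [2n≤ r ]))
        ≡⟨ cong (Σ₃ m perimeter +_) (Σ₃-* m 6 (λ p q r → [2n≤ p ] + ([2n≤ q ] + [2n≤ r ]))) ⟨
      Σ₃ m perimeter + Σ₃ m (λ p q r → 6 * ([2n≤ p ] + ([2n≤ q ] + [2n≤ r ])))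
        ≡⟨ Σ₃-+ m perimeter (λ p q r → 6 * ([2n≤ p ] + ([2n≤ q ] + [2n≤ r ]))) ⟨
      Σ₃ m (λ p q r → perimeter p q r + 6 * ([2n≤ p ] + ([2n≤ q ] + [2n≤ r ])))
        ≤⟨ Σ₃-mono m perimeter-bound ⟩
      Σ₃ m (λ p q r → 6 + cut-off * ([2n≡ p ] + ([2n≡ q ] + [2n≡ r ])))
        ≡⟨ Σ₃-+ m (λ _ _ _ → 6 * 1) (λ p q r → cut-off * ([2n≡ p ] + ([2n≡ q ] + [2n≡ r ]))) ⟩
      Σ₃ m (λ _ _ _ → 6 * 1) + Σ₃ m (λ p q r → cut-off * ([2n≡ p ] + ([2n≡ q ] + [2n≡ r ])))
        ≡⟨ cong₂ _+_ (Σ₃-* m 6 (λ _ _ _ → 1)) (trans (Σ₃-* m cut-off (λ p q r → [2n≡ p ] + ([2n≡ q ] + [2n≡ r ])))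
             (cong (cut-off *_) (Σ₃-thrice [2n≡_] n Σ₃-[2n≡]))) ⟩
      6 * Σ₃ m (λ _ _ _ → 1) + cut-off * (n + (n + n))
        ≡⟨ cong (_+ cut-off * (n + (n + n))) (trans (*-assoc 3 2 (Σ₃ m (λ _ _ _ → 1))) (cong (3 *_) (2*Σ₃-1 m))) ⟩
      3 * (suc m * suc (suc m)) + cut-off * (n + (n + n))
        ≡⟨ solve 1 (λ k → let n = con 1 :+ k ; m = n :+ (n :+ k) in
             con 3 :* ((con 1 :+ m) :* (con 2 :+ m)) :+ (con 4 :* n :+ con 2) :* (n :+ (n :+ n)) :=
             (con 30 :* (n :* n) :+ con 6 :* n) :+ con 9 :* (n :* (con 2 :+ k))) refl k ⟩
      30 * (n * n) + 6 * n + 9 * (n * suc n)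
        ≡⟨ cong (30 * (n * n) + 6 * n +_) (trans (*-assoc 9 2 T) (cong (9 *_) (2*Σ₃-1 k))) ⟨
      30 * (n * n) + 6 * n + 18 * T  ∎)
      where
      open ≤-Reasoning
      T = Σ₃ k (λ _ _ _ → 1)

    module Side (s mid : ℕ → ℕ → Triple)
      (s-mid   : ∀ {q r} → q ≤ n + n → r ≤ n + n → s q r ≡ mid q r)
      (s-left  : ∀ {q r} → n + n < q → r ≤ n + n → s q r ≡ mid N 0)
      (s-right : ∀ {q r} → q ≤ n + n → n + n < r → s q r ≡ mid 0 N)
      (ℓ₁-mid  : ∀ q r q′ r′ → ℓ₁ (mid q r) (mid q′ r′) ≡ ∣ q - q′ ∣ + ∣ r - r′ ∣) where

      step : ℕ → ℕ → ℕ
      step q r = ℓ₁ (s q (suc r)) (s (suc q) r)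

      step-bound : ∀ q r → q + r ≡ m → step q r + 2 * ([2n≤ q ] + [2n≤ r ]) ≤ 2 + (n + n) * ([2n≡ q ] + [2n≡ r ])
      step-bound q r eq = go (position q) (position r)
        where
        Bound : Set
        Bound = step q r + 2 * ([2n≤ q ] + [2n≤ r ]) ≤ 2 + (n + n) * ([2n≡ q ] + [2n≡ r ])

        eq′ : r + q ≡ m
        eq′ = trans (+-comm r q) eq

        at-left : q ≡ n + n → r ≡ k → r < n + n → step q r ≡ n + n
        at-left refl refl r< rewrite s-mid {n + n} {suc k} ≤-refl r< | s-left {suc (n + n)} {k} ≤-refl (<⇒≤ r<)
          | ℓ₁-mid (n + n) (suc k) N 0 | ∣2n-N∣ = refl

        at-right : r ≡ n + n → q ≡ k → q < n + n → step q r ≡ n + n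
        at-right refl refl q< rewrite s-mid {suc k} {n + n} q< ≤-refl | s-right {k} {suc (n + n)} (<⇒≤ q<) ≤-refl
          | ℓ₁-mid 0 N (suc k) (n + n) | ∣N-2n∣ = refl

        at-value : ∀ {E} → E ≡ n + n → E + 2 * 1 ≤ 2 + (n + n) * 1
        at-value refl = ≤-reflexive (trans (+-comm (n + n) 2) (cong (2 +_) (sym (*-identityʳ (n + n)))))

        above-value : ∀ {E} → E ≡ 0 → E + 2 * 1 ≤ 2 + (n + n) * 0
        above-value refl = m≤m+n 2 _

        collapsed₂ : ∀ {a b t} → a ≡ t → b ≡ t → ℓ₁ a b ≡ 0
        collapsed₂ {t = t} refl refl = ℓ₁-refl t

        go : Position q → Position r → Bound
        go (below q< a b) (below r< c d)
          rewrite s-mid {q} {suc r} (<⇒≤ q<) r< | s-mid {suc q} {r} q< (<⇒≤ r<) | ℓ₁-mid q (suc r) (suc q) r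
                | ∣-suc∣ q | ∣suc-∣ r | a | b | c | d = ≤-reflexive (cong (2 +_) (sym (*-zeroʳ (n + n))))
        go (at q≡ a b) _ with others-small (≤-reflexive (sym q≡)) ≤-refl eq
        ... | r< rewrite a | b | indicators-below₁ r< | indicators-below₂ r< = at-value (at-left q≡ (corner-sum q≡ eq) r<)
        go (above q> a b) _ with others-small (<⇒≤ q>) ≤-refl eq
        ... | r< rewrite a | b | indicators-below₁ r< | indicators-below₂ r< =
          above-value (collapsed₂ (s-left {q} {suc r} q> r<) (s-left {suc q} {r} (m<n⇒m<1+n q>) (<⇒≤ r<)))
        go (below _ _ _) (at r≡ a b) with others-small (≤-reflexive (sym r≡)) ≤-refl eq′
        ... | q< rewrite a | b | indicators-below₁ q< | indicators-below₂ q< = at-value (at-right r≡ (corner-sum r≡ eq′) q<)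
        go (below _ _ _) (above r> a b) with others-small (<⇒≤ r>) ≤-refl eq′
        ... | q< rewrite a | b | indicators-below₁ q< | indicators-below₂ q< =
          above-value (collapsed₂ (s-right {q} {suc r} (<⇒≤ q<) (m<n⇒m<1+n r>)) (s-right {suc q} {r} q< r>))

      -- The images of the steps follow one another along a side of Δ, whose ℓ₁-length is 2N = 6n on
      -- the scale of the grid; contraction redistributes this length without changing it.
      Σ₂-step : Σ₂ m step ≤ 6 * n
      Σ₂-step = +-cancelʳ-≤ (2 * (n + n)) _ _ (begin
        Σ₂ m step + 2 * (n + n)
          ≡⟨ cong (λ z → Σ₂ m step + 2 * z) (Σ₂-twice [2n≤_] n Σ₂-[2n≤]) ⟨
        Σ₂ m step + 2 * Σ₂ m (λ q r → [2n≤ q ] + [2n≤ r ])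
          ≡⟨ cong (Σ₂ m step +_) (Σ₂-* m 2 (λ q r → [2n≤ q ] + [2n≤ r ])) ⟨
        Σ₂ m step + Σ₂ m (λ q r → 2 * ([2n≤ q ] + [2n≤ r ]))
          ≡⟨ Σ₂-+ m step (λ q r → 2 * ([2n≤ q ] + [2n≤ r ])) ⟨
        Σ₂ m (λ q r → step q r + 2 * ([2n≤ q ] + [2n≤ r ]))
          ≤⟨ Σ₂-mono m step-bound ⟩
        Σ₂ m (λ q r → 2 + (n + n) * ([2n≡ q ] + [2n≡ r ]))
          ≡⟨ Σ₂-+ m (λ _ _ → 2) (λ q r → (n + n) * ([2n≡ q ] + [2n≡ r ])) ⟩
        Σ₂ m (λ _ _ → 2) + Σ₂ m (λ q r → (n + n) * ([2n≡ q ] + [2n≡ r ]))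
          ≡⟨ cong₂ _+_ (Σ₂-const m 2) (trans (Σ₂-* m (n + n) (λ q r → [2n≡ q ] + [2n≡ r ]))
               (cong ((n + n) *_) (Σ₂-twice [2n≡_] 1 Σ₂-[2n≡]))) ⟩
        suc m * 2 + (n + n) * 2
          ≡⟨ solve 1 (λ k → let n = con 1 :+ k in (con 1 :+ (n :+ (n :+ k))) :* con 2 :+ (n :+ n) :* con 2 :=
               con 6 :* n :+ con 2 :* (n :+ n)) refl k ⟩
        6 * n + 2 * (n + n)  ∎)
        where open ≤-Reasoning

    module Side₀ = Side (contract 0) (λ q r → 0 , q , r)
      (contract-mid z≤n) (λ 2n<q _ → contract₁ z≤n 2n<q) (contract₂ z≤n) (λ _ _ _ _ → refl)
    module Side₁ = Side (λ p r → contract p 0 r) (λ p r → p , 0 , r)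
      (λ {p} {r} p≤ → contract-mid {p} {0} {r} p≤ z≤n) (λ {p} {r} 2n<p _ → contract₀ {p} {0} {r} 2n<p)
      (λ {p} {r} p≤ → contract₂ {p} {0} {r} p≤ z≤n) (λ _ _ _ _ → refl)
    module Side₂ = Side (λ p q → contract p q 0) (λ p q → p , q , 0)
      (λ {p} {q} p≤ q≤ → contract-mid {p} {q} {0} p≤ q≤ z≤n) (λ {p} {q} 2n<p _ → contract₀ {p} {q} {0} 2n<p) (λ {p} {q} p≤ 2n<q → contract₁ {p} {q} {0} p≤ 2n<q)
      (λ p q p′ q′ → cong (∣ p - p′ ∣ +_) (+-identityʳ ∣ q - q′ ∣))

    double-volume : ℕ
    double-volume = Σ₃ m perimeter + (n + n) * (Σ₂ m Side₀.step + (Σ₂ m Side₁.step + Σ₂ m Side₂.step))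

    double-volume≤ : double-volume ≤ (N + N) * (11 * n + 1)
    double-volume≤ = begin
      double-volume
        ≤⟨ +-mono-≤ Σ₃-perimeter (*-monoʳ-≤ (n + n) (+-mono-≤ Side₀.Σ₂-step (+-mono-≤ Side₁.Σ₂-step Side₂.Σ₂-step))) ⟩
      30 * (n * n) + 6 * n + (n + n) * (6 * n + (6 * n + 6 * n))
        ≡⟨ solve 1 (λ n → con 30 :* (n :* n) :+ con 6 :* n :+ (n :+ n) :* (con 6 :* n :+ (con 6 :* n :+ con 6 :* n)) :=
             (((n :+ n) :+ n) :+ ((n :+ n) :+ n)) :* (con 11 :* n :+ con 1)) refl n ⟩
      (((n + n) + n) + ((n + n) + n)) * (11 * n + 1)
        ≡⟨ cong (λ z → (z + z) * (11 * n + 1)) N≡3n ⟨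
      (N + N) * (11 * n + 1)  ∎
      where open ≤-Reasoning

-- Cuts as labellings, and the minimum cut.

module Cuts (em : ∀ ℓ → ExcludedMiddle ℓ) (ℝ : CompleteOrderedField) where
  open OrderedField ℝ
  open import Data.Fin.Subset using (Subset; _∉_; ⊤)
  open import Data.Fin.Subset.Properties using (∈⊤)
  open import Data.Vec.Base using (Vec; []; _∷_; lookup; tabulate)
  open import Data.Vec.Properties using (lookup∘tabulate; lookup⇒[]=; []=⇒lookup)
  open import Relation.Binary.Construct.Closure.ReflexiveTransitive using (Star; ε; _◅_; _◅◅_; return)

  module _ {k : ℕ} (G : Instance k) where
    open Instance G

    crossing-cost : ∀ {l} → (Fin nodes → Fin l) → Fin edges → Carrier
    crossing-cost g e = if does (g (end₁ e) ≟ g (end₂ e)) then 0# else cost e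

    labelling-cut : ∀ {l} → (Fin nodes → Fin l) → Subset edges
    labelling-cut g = tabulate (λ e → not (does (g (end₁ e) ≟ g (end₂ e))))

    cutCost-labelling : ∀ {l} (g : Fin nodes → Fin l) → cutCost (labelling-cut g) ≈ sum (crossing-cost g)
    cutCost-labelling g = sum-cong-≋ λ e → reflexive (≡.trans
      (≡.cong (λ b → if b then cost e else 0#) (lookup∘tabulate _ e)) (if-not (does (g (end₁ e) ≟ g (end₂ e)))))
      where
      if-not : ∀ b {x y : Carrier} → (if not b then x else y) ≡ (if b then y else x)
      if-not true  = ≡.refl
      if-not false = ≡.refl

    outside-labelling : ∀ {l} (g : Fin nodes → Fin l) e → e ∉ labelling-cut g → g (end₁ e) ≡ g (end₂ e)
    outside-labelling g e e∉ with g (end₁ e) ≟ g (end₂ e) in eq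
    ... | yes p = p
    ... | no  _ = contradiction (lookup⇒[]= e _ (≡.trans (lookup∘tabulate _ e) (≡.cong (λ d → not (does d)) eq))) e∉

    labelling-cut-separates : ∀ {l} (g : Fin nodes → Fin l) → (∀ i j → i ≢ j → g (terminal i) ≢ g (terminal j)) →
                              IsKWayCut (labelling-cut g)
    labelling-cut-separates g separates i j i≢j path = separates i j i≢j (constant path)
      where
      constant : ∀ {u v} → Star (AdjacentOutside (labelling-cut g)) u v → g u ≡ g v
      constant ε = ≡.refl
      constant ((e , e∉ , inj₁ (≡.refl , ≡.refl)) ◅ p) = ≡.trans (outside-labelling g e e∉) (constant p)
      constant ((e , e∉ , inj₂ (≡.refl , ≡.refl)) ◅ p) = ≡.trans (≡.sym (outside-labelling g e e∉)) (constant p)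

    CutBound : Carrier → Set
    CutBound κ = ∀ S → IsKWayCut S → κ ≤ cutCost S

    labelling-bound : ∀ {κ} → CutBound κ → ∀ {l} (g : Fin nodes → Fin l) →
      (∀ i j → i ≢ j → g (terminal i) ≢ g (terminal j)) → κ ≤ sum (crossing-cost g)
    labelling-bound bound g separates =
      ≤-respʳ (cutCost-labelling g) (bound (labelling-cut g) (labelling-cut-separates g separates))

    all-edges-cut : IsKWayCut ⊤
    all-edges-cut i j i≢j path = i≢j (terminal-injective (stuck path))
      where
      stuck : ∀ {u v} → Star (AdjacentOutside ⊤) u v → u ≡ v
      stuck ε                   = ≡.refl
      stuck ((e , e∉⊤ , _) ◅ _) = contradiction ∈⊤ e∉⊤

    private
      subset-minimum : ∀ m (P : Subset m → Set) (f : Subset m → Carrier) → ∃ P →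
                       ∃[ S ] P S × (∀ S′ → P S′ → f S ≤ f S′)
      subset-minimum zero    P f ([] , p) = [] , p , λ { [] _ → ≤-refl }
      subset-minimum (suc m) P f (b ∷ S , p)
        with em 0ℓ {∃ (λ S → P (true ∷ S))} | em 0ℓ {∃ (λ S → P (false ∷ S))}
      ... | no ¬t | no ¬f = contradiction (S , p) (¬both b)
        where
        ¬both : ∀ b → ¬ ∃ (λ S → P (b ∷ S))
        ¬both true  = ¬t
        ¬both false = ¬f
      ... | yes t | no ¬f =
        let (S , PS , min) = subset-minimum m (λ S → P (true ∷ S)) (λ S → f (true ∷ S)) t in
        true ∷ S , PS , λ { (true ∷ S′) q → min S′ q ; (false ∷ S′) q → contradiction (S′ , q) ¬f }
      ... | no ¬t | yes t =
        let (S , PS , min) = subset-minimum m (λ S → P (false ∷ S)) (λ S → f (false ∷ S)) t in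
        false ∷ S , PS , λ { (false ∷ S′) q → min S′ q ; (true ∷ S′) q → contradiction (S′ , q) ¬t }
      ... | yes t | yes t′ with subset-minimum m (λ S → P (true ∷ S)) (λ S → f (true ∷ S)) t
                              | subset-minimum m (λ S → P (false ∷ S)) (λ S → f (false ∷ S)) t′
      ...   | (S , PS , min) | (S₂ , PS₂ , min₂) with total (f (true ∷ S)) (f (false ∷ S₂))
      ...     | inj₁ le = true ∷ S , PS , λ { (true ∷ S′) q → min S′ q ; (false ∷ S′) q → ≤-trans le (min₂ S′ q) }
      ...     | inj₂ le = false ∷ S₂ , PS₂ , λ { (false ∷ S′) q → min₂ S′ q ; (true ∷ S′) q → ≤-trans le (min S′ q) }

    minimum-cut : ∃ IsMinCut
    minimum-cut with subset-minimum edges IsKWayCut cutCost (⊤ , all-edges-cut)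
    ... | S , cut , min = cutCost S , (S , cut , refl) , min

  module _ (G : Instance 3) where
    open Instance G

    -- The nodes outside the components of the first two terminals all get the third label.
    cut⇒labelling : ∀ S → IsKWayCut S → ∃[ g ] (∀ i → g (terminal i) ≡ i) × sum (crossing-cost G g) ≤ cutCost S
    cut⇒labelling S cut = g , g-terminal , sum-mono cost≤
      where
      Reach : Fin 3 → Fin nodes → Set
      Reach i v = Star (AdjacentOutside S) (terminal i) v

      g′ : ∀ {v} → Dec (Reach 0F v) → Dec (Reach 1F v) → Fin 3
      g′ (yes _) _       = 0F
      g′ (no _)  (yes _) = 1F
      g′ (no _)  (no _)  = 2F

      g : Fin nodes → Fin 3
      g v = g′ (em 0ℓ {Reach 0F v}) (em 0ℓ {Reach 1F v})

      g-terminal : ∀ i → g (terminal i) ≡ i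
      g-terminal i with em 0ℓ {Reach 0F (terminal i)} | em 0ℓ {Reach 1F (terminal i)}
      g-terminal 0F | yes _ | _     = ≡.refl
      g-terminal 0F | no ¬p | _     = contradiction ε ¬p
      g-terminal 1F | yes p | _     = contradiction p (cut 0F 1F λ ())
      g-terminal 1F | no _  | yes _ = ≡.refl
      g-terminal 1F | no _  | no ¬p = contradiction ε ¬p
      g-terminal 2F | yes p | _     = contradiction p (cut 0F 2F λ ())
      g-terminal 2F | no _  | yes p = contradiction p (cut 1F 2F λ ())
      g-terminal 2F | no _  | no _  = ≡.refl

      g-adjacent : ∀ {u v} → AdjacentOutside S u v → AdjacentOutside S v u → g u ≡ g v
      g-adjacent {u} {v} uv vu with em 0ℓ {Reach 0F u} | em 0ℓ {Reach 0F v} | em 0ℓ {Reach 1F u} | em 0ℓ {Reach 1F v}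
      ... | yes _ | yes _ | _     | _     = ≡.refl
      ... | yes p | no ¬p | _     | _     = contradiction (p ◅◅ return uv) ¬p
      ... | no ¬p | yes p | _     | _     = contradiction (p ◅◅ return vu) ¬p
      ... | no _  | no _  | yes _ | yes _ = ≡.refl
      ... | no _  | no _  | yes p | no ¬p = contradiction (p ◅◅ return uv) ¬p
      ... | no _  | no _  | no ¬p | yes p = contradiction (p ◅◅ return vu) ¬p
      ... | no _  | no _  | no _  | no _  = ≡.refl

      outside : ∀ {e} → lookup S e ≡ false → e ∉ S
      outside eq e∈S with ≡.trans (≡.sym eq) ([]=⇒lookup e∈S)
      ... | ()

      cost≤ : ∀ e → crossing-cost G g e ≤ (if lookup S e then cost e else 0#)
      cost≤ e with lookup S e in eq
      cost≤ e | true with does (g (end₁ e) ≟ g (end₂ e))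
      ... | true  = cost-nonNeg e
      ... | false = ≤-refl
      cost≤ e | false rewrite dec-true (g (end₁ e) ≟ g (end₂ e))
        (g-adjacent (e , outside eq , inj₁ (≡.refl , ≡.refl)) (e , outside eq , inj₂ (≡.refl , ≡.refl))) = ≤-refl

-- Sums over lists.

module ListSums where
  open import Data.List.Base using (map)
  open import Data.Nat.Base
  open import Data.Nat.Properties
  open import Relation.Binary.PropositionalEquality
  open TriangularGrid using (Triple; Σ₂; Σ₃)

  Σˡ : ∀ {A : Set} → (A → ℕ) → List A → ℕ
  Σˡ f []       = 0
  Σˡ f (x ∷ xs) = f x + Σˡ f xs

  Σˡ-++ : ∀ {A : Set} (f : A → ℕ) xs ys → Σˡ f (xs ++ ys) ≡ Σˡ f xs + Σˡ f ys
  Σˡ-++ f []       ys = refl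
  Σˡ-++ f (x ∷ xs) ys = trans (cong (f x +_) (Σˡ-++ f xs ys)) (sym (+-assoc (f x) _ _))

  Σˡ-map : ∀ {A B : Set} (f : B → ℕ) (g : A → B) xs → Σˡ f (map g xs) ≡ Σˡ (λ x → f (g x)) xs
  Σˡ-map f g []       = refl
  Σˡ-map f g (x ∷ xs) = cong (f (g x) +_) (Σˡ-map f g xs)

  Σˡ-concatMap : ∀ {A B : Set} (f : B → ℕ) (g : A → List B) xs → Σˡ f (concatMap g xs) ≡ Σˡ (λ x → Σˡ f (g x)) xs
  Σˡ-concatMap f g []       = refl
  Σˡ-concatMap f g (x ∷ xs) = trans (Σˡ-++ f (g x) (concatMap g xs)) (cong (Σˡ f (g x) +_) (Σˡ-concatMap f g xs))

  pairs : ℕ → List (ℕ × ℕ)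
  pairs zero    = (0 , 0) ∷ []
  pairs (suc m) = (0 , suc m) ∷ map (λ (q , r) → suc q , r) (pairs m)

  triples : ℕ → List Triple
  triples zero    = (0 , 0 , 0) ∷ []
  triples (suc m) = map (0 ,_) (pairs (suc m)) ++ map (λ (p , q , r) → suc p , q , r) (triples m)

  Σˡ-pairs : ∀ m (g : ℕ × ℕ → ℕ) → Σˡ g (pairs m) ≡ Σ₂ m (λ q r → g (q , r))
  Σˡ-pairs zero    g = +-identityʳ _
  Σˡ-pairs (suc m) g = cong (g (0 , suc m) +_) (trans (Σˡ-map g (λ (q , r) → suc q , r) (pairs m))
    (Σˡ-pairs m (λ (q , r) → g (suc q , r))))

  Σˡ-triples : ∀ m (f : Triple → ℕ) → Σˡ f (triples m) ≡ Σ₃ m (λ p q r → f (p , q , r))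
  Σˡ-triples zero    f = +-identityʳ _
  Σˡ-triples (suc m) f = trans (Σˡ-++ f (map (0 ,_) (pairs (suc m))) _)
    (cong₂ _+_ (trans (Σˡ-map f (0 ,_) (pairs (suc m))) (Σˡ-pairs (suc m) (λ x → f (0 , x))))
               (trans (Σˡ-map f (λ (p , q , r) → suc p , q , r) (triples m)) (Σˡ-triples m (λ (p , q , r) → f (suc p , q , r)))))

-- Encoding grid points as nodes.

module GridNodes (N : ℕ) where
  open import Data.Fin.Base using (combine; remQuot)
  open import Data.Fin.Properties using (remQuot-combine; toℕ-fromℕ<)
  open import Data.Nat.Base
  open import Data.Nat.DivMod using (_mod_; m<n⇒m%n≡m; m%n<n)
  open import Data.Nat.Properties
  open import Relation.Binary.PropositionalEquality
  open TriangularGrid using (Triple)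

  Node : Set
  Node = Fin (suc N * suc N)

  -- The remainders only make the encoding total: they change nothing for p, q ≤ N, and r is
  -- recovered from the sum N.
  node : Triple → Node
  node (p , q , r) = combine (p mod suc N) (q mod suc N)

  -- Pairs (p , q) with p + q > N encode no grid point; they are isolated nodes.
  complete : ℕ → ℕ → Triple
  complete p q with p + q ≤? N
  ... | yes _ = p , q , N ∸ (p + q)
  ... | no  _ = N , 0 , 0

  coordinates : Node → Triple
  coordinates v = complete (toℕ (proj₁ (remQuot {suc N} (suc N) v))) (toℕ (proj₂ (remQuot {suc N} (suc N) v)))

  total₃ : Triple → ℕ
  total₃ (p , q , r) = p + q + r

  toℕ-mod : ∀ {p} → p ≤ N → toℕ (p mod suc N) ≡ p
  toℕ-mod {p} p≤N = trans (toℕ-fromℕ< (m%n<n p (suc N))) (m<n⇒m%n≡m (s≤s p≤N))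

  coordinates-node : ∀ t → total₃ t ≡ N → coordinates (node t) ≡ t
  coordinates-node (p , q , r) eq = trans (cong₂ complete
      (trans (cong (λ x → toℕ (proj₁ x)) decode) (toℕ-mod (≤-trans (m≤m+n p q) p+q≤N)))
      (trans (cong (λ x → toℕ (proj₂ x)) decode) (toℕ-mod (≤-trans (m≤n+m q p) p+q≤N))))
    completed
    where
    decode = remQuot-combine {suc N} {suc N} (p mod suc N) (q mod suc N)

    p+q≤N : p + q ≤ N
    p+q≤N = ≤-trans (m≤m+n (p + q) r) (≤-reflexive eq)

    completed : complete p q ≡ (p , q , r)
    completed with p + q ≤? N
    ... | yes _  = cong (λ z → p , q , z) (trans (cong (_∸ (p + q)) (sym eq)) (m+n∸m≡n (p + q) r))
    ... | no ¬le = contradiction p+q≤N ¬le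

  corner : Fin 3 → Triple
  corner 0F = N , 0 , 0
  corner 1F = 0 , N , 0
  corner 2F = 0 , 0 , N

  total₃-corner : ∀ i → total₃ (corner i) ≡ N
  total₃-corner 0F = trans (+-identityʳ (N + 0)) (+-identityʳ N)
  total₃-corner 1F = +-identityʳ N
  total₃-corner 2F = refl

  total₃-coordinates : ∀ v → total₃ (coordinates v) ≡ N
  total₃-coordinates v = total₃-complete (toℕ (proj₁ (remQuot {suc N} (suc N) v))) (toℕ (proj₂ (remQuot {suc N} (suc N) v)))
    where
    total₃-complete : ∀ p q → total₃ (complete p q) ≡ N
    total₃-complete p q with p + q ≤? N
    ... | yes le = m+[n∸m]≡n le
    ... | no _   = total₃-corner 0F

  coordinates-corner : ∀ i → coordinates (node (corner i)) ≡ corner i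
  coordinates-corner i = coordinates-node (corner i) (total₃-corner i)

-- The graph of the lower bound.

module GapGraph (k : ℕ) where
  open import Data.Nat.Base
  open import Data.Nat.Properties
  open import Relation.Binary.PropositionalEquality
  open TriangularGrid
  open Contraction k
  open ListSums
  open GridNodes N public

  contract-total₃ : ∀ p q r → p + q + r ≡ N → total₃ (contract p q r) ≡ N
  contract-total₃ p q r eq =
    either (does (suc (n + n) ≤? p)) (total₃-corner 0F) (either (does (suc (n + n) ≤? q)) (total₃-corner 1F)
      (either (does (suc (n + n) ≤? r)) (total₃-corner 2F) eq))
    where
    either : ∀ b {s t} → total₃ s ≡ N → total₃ t ≡ N → total₃ (if b then s else t) ≡ N
    either true  s≡ t≡ = s≡
    either false s≡ t≡ = t≡

  corner-injective : ∀ {i j} → corner i ≡ corner j → i ≡ j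
  corner-injective {0F} {0F} _ = refl
  corner-injective {1F} {1F} _ = refl
  corner-injective {2F} {2F} _ = refl
  corner-injective {0F} {1F} ()
  corner-injective {0F} {2F} ()
  corner-injective {1F} {0F} ()
  corner-injective {1F} {2F} ()
  corner-injective {2F} {0F} ()
  corner-injective {2F} {1F} ()

  terminal : Fin 3 → Node
  terminal i = node (corner i)

  terminal-injective : ∀ {i j} → terminal i ≡ terminal j → i ≡ j
  terminal-injective {i} {j} eq = corner-injective
    (trans (sym (coordinates-corner i)) (trans (cong coordinates eq) (coordinates-corner j)))

  -- Contraction happens here: edges are attached to the node of the contracted point. The nodes of
  -- the points that have been moved stay behind as isolated nodes, and edges inside a corner become
  -- loops.
  vertexNode : ℕ → ℕ → ℕ → Node
  vertexNode p q r = node (contract p q r)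

  Edge : Set
  Edge = Node × Node × ℕ

  triangle-edges : Triple → List Edge
  triangle-edges (p , q , r) = (a , b , 1) ∷ (b , c , 1) ∷ (a , c , 1) ∷ []
    where
    a = vertexNode (suc p) q r
    b = vertexNode p (suc q) r
    c = vertexNode p q (suc r)

  side-edges : ℕ × ℕ → List Edge
  side-edges (q , r) =
    (vertexNode 0 q (suc r) , vertexNode 0 (suc q) r , n + n) ∷
    (vertexNode q 0 (suc r) , vertexNode (suc q) 0 r , n + n) ∷
    (vertexNode q (suc r) 0 , vertexNode (suc q) r 0 , n + n) ∷ []

  opaque
    -- Kept opaque, so that the list does not unfold in later types; its weighted sums are reached
    -- through `Σˡ-edges`.
    edge-list : List Edge
    edge-list = concatMap triangle-edges (triples m) ++ concatMap side-edges (pairs m)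

    -- Serves both halves of the estimate: with h the indicator of different labels it gives the
    -- cost of a cut, with h the ℓ₁-length it gives the volume.
    Σˡ-edges : ∀ (h : Node → Node → ℕ) → Σˡ (λ (u , v , w) → w * h u v) edge-list ≡
      Σ₃ m (λ p q r → h (vertexNode (suc p) q r) (vertexNode p (suc q) r) +
                      h (vertexNode p (suc q) r) (vertexNode p q (suc r)) +
                      h (vertexNode (suc p) q r) (vertexNode p q (suc r))) +
      (n + n) * (Σ₂ m (λ q r → h (vertexNode 0 q (suc r)) (vertexNode 0 (suc q) r)) +
                (Σ₂ m (λ q r → h (vertexNode q 0 (suc r)) (vertexNode (suc q) 0 r)) +
                 Σ₂ m (λ q r → h (vertexNode q (suc r) 0) (vertexNode (suc q) r 0))))
    Σˡ-edges h = trans (Σˡ-++ w (concatMap triangle-edges (triples m)) (concatMap side-edges (pairs m)))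
      (cong₂ _+_
        (trans (Σˡ-concatMap w triangle-edges (triples m)) (trans (Σˡ-triples m (λ t → Σˡ w (triangle-edges t)))
          (Σ₃-cong m {f = λ p q r → Σˡ w (triangle-edges (p , q , r))} {g = λ p q r → t₀ p q r + t₁ p q r + t₂ p q r}
            λ p q r _ → three-edges (t₀ p q r) (t₁ p q r) (t₂ p q r))))
        (trans (Σˡ-concatMap w side-edges (pairs m)) (trans (Σˡ-pairs m (λ t → Σˡ w (side-edges t)))
          (trans (Σ₂-cong m {f = λ q r → Σˡ w (side-edges (q , r))} {g = λ q r → (n + n) * (s₀ q r + (s₁ q r + s₂ q r))} λ q r _ → three-sides (s₀ q r) (s₁ q r) (s₂ q r))
            (trans (Σ₂-* m (n + n) (λ q r → s₀ q r + (s₁ q r + s₂ q r)))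
              (cong ((n + n) *_) (trans (Σ₂-+ m s₀ (λ q r → s₁ q r + s₂ q r)) (cong (Σ₂ m s₀ +_) (Σ₂-+ m s₁ s₂)))))))))
      where
      w : Edge → ℕ
      w (u , v , c) = c * h u v
      t₀ t₁ t₂ : ℕ → ℕ → ℕ → ℕ
      t₀ p q r = h (vertexNode (suc p) q r) (vertexNode p (suc q) r)
      t₁ p q r = h (vertexNode p (suc q) r) (vertexNode p q (suc r))
      t₂ p q r = h (vertexNode (suc p) q r) (vertexNode p q (suc r))
      s₀ s₁ s₂ : ℕ → ℕ → ℕ
      s₀ q r = h (vertexNode 0 q (suc r)) (vertexNode 0 (suc q) r)
      s₁ q r = h (vertexNode q 0 (suc r)) (vertexNode (suc q) 0 r)
      s₂ q r = h (vertexNode q (suc r) 0) (vertexNode (suc q) r 0)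
      open import Data.Nat.Solver using (module +-*-Solver)
      open +-*-Solver
      three-edges : ∀ a b d → 1 * a + (1 * b + (1 * d + 0)) ≡ a + b + d
      three-edges = solve 3 (λ a b d → con 1 :* a :+ (con 1 :* b :+ (con 1 :* d :+ con 0)) := a :+ b :+ d) refl
      three-sides : ∀ a b d → (n + n) * a + ((n + n) * b + ((n + n) * d + 0)) ≡ (n + n) * (a + (b + d))
      three-sides = solve 4 (λ n a b d → (n :+ n) :* a :+ ((n :+ n) :* b :+ ((n :+ n) :* d :+ con 0)) := (n :+ n) :* (a :+ (b :+ d))) refl n

  -- Read on the grid, a labelling of the nodes is constant on every contracted corner, with the
  -- label of its terminal. This is the boundary condition of `labelling-cost≥12n`.
  cut-cost≥12n : ∀ (g : Node → Fin 3) → (∀ i → g (terminal i) ≡ i) →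
                 12 * n ≤ Σˡ (λ (u , v , w) → w * ⟦ g u ≢ g v ⟧) edge-list
  cut-cost≥12n g g-terminal = ≤-trans
    (labelling-cost≥12n k (λ p q r → g (vertexNode p q r))
      (λ p q r eq p> → at-corner {p} {q} {r} 0F (contract₀ {p} {q} {r} p>))
      (λ p q r eq q> → at-corner {p} {q} {r} 1F (contract₁ (small (trans (cong (_+ r) (+-comm q p)) eq) q>) q>))
      (λ p q r eq r> → at-corner {p} {q} {r} 2F (contract₂
        (small (trans (trans (+-assoc r p q) (+-comm r (p + q))) eq) r>)
        (small (trans (trans (cong (_+ p) (+-comm r q)) (trans (+-assoc q r p) (trans (+-comm q (r + p)) (trans (+-assoc r p q) (+-comm r (p + q)))))) eq) r>) r>)))
    (≤-reflexive (sym (Σˡ-edges (λ u v → ⟦ g u ≢ g v ⟧))))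
    where
    at-corner : ∀ {p q r} i → contract p q r ≡ corner i → g (vertexNode p q r) ≡ i
    at-corner i eq = trans (cong (λ t → g (node t)) eq) (g-terminal i)

    small : ∀ {a b c} → a + b + c ≡ N → n + n < a → b ≤ n + n
    small {a} {b} {c} eq 2n<a = ≤-trans (<⇒≤ (+-cancelˡ-< (n + n) b n (begin-strict
      n + n + b       <⟨ +-monoˡ-< b 2n<a ⟩
      a + b           ≤⟨ m≤m+n (a + b) c ⟩
      a + b + c       ≡⟨ trans eq N≡3n ⟩
      n + n + n       ∎))) (m≤m+n n n)
      where open ≤-Reasoning

  length₁ : Node → Node → ℕ
  length₁ u v = ℓ₁ (coordinates u) (coordinates v)

  total-length≤ : Σˡ (λ (u , v , w) → w * length₁ u v) edge-list ≤ (N + N) * (11 * n + 1)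
  total-length≤ = ≤-trans (≤-reflexive (trans (Σˡ-edges length₁)
      (cong₂ _+_ (Σ₃-cong m {f = λ p q r → len (suc p) q r p (suc q) r + len p (suc q) r p q (suc r) + len (suc p) q r p q (suc r)} {g = perimeter}
          λ p q r eq → cong₂ _+_ (cong₂ _+_ (len≡ (suc p) q r p (suc q) r (cong suc eq) (sum₂ p q r eq)) (len≡ p (suc q) r p q (suc r) (sum₂ p q r eq) (sum₃ p q r eq))) (len≡ (suc p) q r p q (suc r) (cong suc eq) (sum₃ p q r eq)))
        (cong ((n + n) *_) (cong₂ _+_
          (Σ₂-cong m {f = λ q r → len 0 q (suc r) 0 (suc q) r} {g = Side₀.step} λ q r eq → len≡ 0 q (suc r) 0 (suc q) r (sum₃ 0 q r eq) (sum₂ 0 q r eq))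
          (cong₂ _+_
            (Σ₂-cong m {f = λ q r → len q 0 (suc r) (suc q) 0 r} {g = Side₁.step} λ q r eq →
              len≡ q 0 (suc r) (suc q) 0 r (sum₃ q 0 r (trans (cong (_+ r) (+-identityʳ q)) eq)) (cong suc (trans (cong (_+ r) (+-identityʳ q)) eq)))
            (Σ₂-cong m {f = λ q r → len q (suc r) 0 (suc q) r 0} {g = Side₂.step} λ q r eq →
              len≡ q (suc r) 0 (suc q) r 0 (sum₂ q r 0 (trans (+-identityʳ (q + r)) eq)) (cong suc (trans (+-identityʳ (q + r)) eq))))))))) double-volume≤
    where
    len : ℕ → ℕ → ℕ → ℕ → ℕ → ℕ → ℕ
    len p q r p′ q′ r′ = length₁ (vertexNode p q r) (vertexNode p′ q′ r′)

    len≡ : ∀ p q r p′ q′ r′ → p + q + r ≡ N → p′ + q′ + r′ ≡ N →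
           len p q r p′ q′ r′ ≡ ℓ₁ (contract p q r) (contract p′ q′ r′)
    len≡ p q r p′ q′ r′ eq eq′ = cong₂ ℓ₁ (coordinates-node (contract p q r) (contract-total₃ p q r eq))
                                                      (coordinates-node (contract p′ q′ r′) (contract-total₃ p′ q′ r′ eq′))

    sum₂ : ∀ p q r → p + q + r ≡ m → p + suc q + r ≡ N
    sum₂ p q r eq = trans (cong (_+ r) (+-suc p q)) (cong suc eq)

    sum₃ : ∀ p q r → p + q + r ≡ m → p + q + suc r ≡ N
    sum₃ p q r eq = trans (+-suc (p + q) r) (cong suc eq)

-- The graph as an instance, with its straight-line embedding.

module GapInstance (em : ∀ ℓ → ExcludedMiddle ℓ) (ℝ : CompleteOrderedField) (k : ℕ) where
  open OrderedField ℝ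
  open Cuts em ℝ
  open import Data.List.Base using (length; lookup)
  open ListSums using (Σˡ)
  open TriangularGrid using (Triple; ℓ₁)
  module Graph = GapGraph k
  open TriangularGrid.Contraction k using (N; n)
  open Graph using (Edge; edge-list; coordinates; corner; total₃; cut-cost≥12n; total-length≤; length₁)
  open import Relation.Binary.Reasoning.Setoid setoid

  G : Instance 3
  G = record
    { nodes = _ ; edges = length edge-list
    ; end₁ = λ e → proj₁ (lookup edge-list e)
    ; end₂ = λ e → proj₁ (proj₂ (lookup edge-list e))
    ; cost = λ e → fromℕ (proj₂ (proj₂ (lookup edge-list e)))
    ; cost-nonNeg = λ e → fromℕ-nonNeg (proj₂ (proj₂ (lookup edge-list e)))
    ; terminal = Graph.terminal
    ; terminal-injective = Graph.terminal-injective }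
  open Instance G

  Σˡ≤sum : ∀ {A : Set} {h : A → ℕ} {F : A → Carrier} → (∀ x → fromℕ (h x) ≤ F x) →
           ∀ xs → fromℕ (Σˡ h xs) ≤ sum (λ i → F (lookup xs i))
  Σˡ≤sum h≤F []       = ≤-refl
  Σˡ≤sum {h = h} h≤F (x ∷ xs) =
    ≤-respˡ (sym (fromℕ-+ (h x) (Σˡ h xs))) (+-mono-≤ (h≤F x) (Σˡ≤sum h≤F xs))

  Σˡ≈sum : ∀ {A : Set} c {h : A → ℕ} {F : A → Carrier} → (∀ x → c * F x ≈ fromℕ (h x)) →
           ∀ xs → c * sum (λ i → F (lookup xs i)) ≈ fromℕ (Σˡ h xs)
  Σˡ≈sum c h≈F []       = zeroʳ c
  Σˡ≈sum c {h} {F} h≈F (x ∷ xs) = begin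
    c * (F x + sum (λ i → F (lookup xs i)))      ≈⟨ distribˡ c _ _ ⟩
    c * F x + c * sum (λ i → F (lookup xs i))    ≈⟨ +-cong (h≈F x) (Σˡ≈sum c h≈F xs) ⟩
    fromℕ (h x) + fromℕ (Σˡ h xs)                ≈⟨ fromℕ-+ (h x) (Σˡ h xs) ⟨
    fromℕ (h x ℕ.+ Σˡ h xs)                      ∎

  cutCost≥12n : CutBound G (fromℕ (12 ℕ.* n))
  cutCost≥12n S cut with cut⇒labelling G S cut
  ... | g , g-terminal , cost≤ = ≤-trans (fromℕ-mono (cut-cost≥12n g g-terminal)) (≤-trans
    (Σˡ≤sum {F = λ (u , v , w) → crossing (does (g u ≟ g v)) w} (λ (u , v , w) → weight≤ w (does (g u ≟ g v))) edge-list) cost≤)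
    where
    crossing : Bool → ℕ → Carrier
    crossing b w = if b then 0# else fromℕ w

    weight≤ : ∀ w b → fromℕ (w ℕ.* (if b then 0 else 1)) ≤ crossing b w
    weight≤ w true  = ≤-reflexive (reflexive (≡.cong fromℕ (ℕ.*-zeroʳ w)))
    weight≤ w false = ≤-reflexive (reflexive (≡.cong fromℕ (ℕ.*-identityʳ w)))

  private
    0<N : 0# < fromℕ N
    0<N = fromℕ-pos (TriangularGrid.Contraction.m k)

    N≉0 : ¬ fromℕ N ≈ 0#
    N≉0 = pos⇒≉0 0<N

    component : Fin 3 → Triple → ℕ
    component 0F (p , q , r) = p
    component 1F (p , q , r) = q
    component 2F (p , q , r) = r

  grid-point : Triple → Point 3
  grid-point t i = fromℕ (component i t) ÷ fromℕ N

  embedding : Fin nodes → Point 3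
  embedding v = grid-point (coordinates v)

  embedding-isEmbedding : IsEmbedding embedding
  embedding-isEmbedding = (λ v → (λ i → *-nonNeg (fromℕ-nonNeg (component i (coordinates v))) (<⇒≤ (⁻¹-pos 0<N))) , sum≈1 (coordinates v) (Graph.total₃-coordinates v))
                        , λ i j → trans (*-congʳ (reflexive (≡.cong (λ t → fromℕ (component j t)) (Graph.coordinates-corner i)))) (corner-vertex i j)
    where
    sum≈1 : ∀ t → total₃ t ≡ N → sum (grid-point t) ≈ 1#
    sum≈1 (p , q , r) eq = begin
      fromℕ p * N⁻¹ + (fromℕ q * N⁻¹ + (fromℕ r * N⁻¹ + 0#))
        ≈⟨ solve 4 (λ p q r i → p :* i :+ (q :* i :+ (r :* i :+ # 0)) := (p :+ q :+ r) :* i) refl (fromℕ p) (fromℕ q) (fromℕ r) N⁻¹ ⟩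
      (fromℕ p + fromℕ q + fromℕ r) * N⁻¹
        ≈⟨ *-congʳ (trans (fromℕ-+ (p ℕ.+ q) r) (+-congʳ (fromℕ-+ p q))) ⟨
      fromℕ (p ℕ.+ q ℕ.+ r) * N⁻¹   ≡⟨ ≡.cong (λ z → fromℕ z * N⁻¹) eq ⟩
      fromℕ N * N⁻¹                 ≈⟨ ⁻¹-inverseʳ (fromℕ N) N≉0 ⟩
      1#                            ∎
      where N⁻¹ = fromℕ N ⁻¹

    one : fromℕ N ÷ fromℕ N ≈ 1#
    one = ⁻¹-inverseʳ (fromℕ N) N≉0

    corner-vertex : ∀ i j → fromℕ (component j (corner i)) ÷ fromℕ N ≈ vertex i j
    corner-vertex 0F 0F = one
    corner-vertex 0F 1F = zeroˡ _
    corner-vertex 0F 2F = zeroˡ _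
    corner-vertex 1F 0F = zeroˡ _
    corner-vertex 1F 1F = one
    corner-vertex 1F 2F = zeroˡ _
    corner-vertex 2F 0F = zeroˡ _
    corner-vertex 2F 1F = zeroˡ _
    corner-vertex 2F 2F = one

  ∣fromℕ-fromℕ∣ : ∀ p q → ∣ fromℕ p - fromℕ q ∣ ≈ fromℕ (ℕ.∣ p - q ∣)
  ∣fromℕ-fromℕ∣ p       zero    = trans (∣x∣-cong (solve 1 (λ p → p :- # 0 := p) refl (fromℕ p)))
    (trans (nonNeg⇒∣x∣≈x (fromℕ-nonNeg p)) (reflexive (≡.cong fromℕ (≡.sym (ℕ.∣-∣-identityʳ p)))))
  ∣fromℕ-fromℕ∣ zero    (suc q) = trans (∣x-y∣≈∣y-x∣ 0# (fromℕ (suc q)))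
    (trans (∣x∣-cong (solve 1 (λ p → p :- # 0 := p) refl (fromℕ (suc q)))) (nonNeg⇒∣x∣≈x (fromℕ-nonNeg (suc q))))
  ∣fromℕ-fromℕ∣ (suc p) (suc q) = trans
    (∣x∣-cong (solve 2 (λ p q → (# 1 :+ p) :- (# 1 :+ q) := p :- q) refl (fromℕ p) (fromℕ q))) (∣fromℕ-fromℕ∣ p q)

  -- The factor N clears the denominators of the coordinates, and the factor 2 the half in `dist`;
  -- lengths become natural numbers.
  dist-grid-point : ∀ s t → fromℕ (N ℕ.+ N) * dist (grid-point s) (grid-point t) ≈ fromℕ (ℓ₁ s t)
  dist-grid-point (p , q , r) (p′ , q′ , r′) = begin
    fromℕ (N ℕ.+ N) * dist′ ≈⟨ *-cong (fromℕ-+ N N) (*-congʳ (+-cong (scaled p p′) (+-cong (scaled q q′) (+-congʳ (scaled r r′))))) ⟩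
    (fromℕ N + fromℕ N) * ((fromℕ a * N⁻¹ + (fromℕ b * N⁻¹ + (fromℕ c * N⁻¹ + 0#))) * fromℕ 2 ⁻¹)
      ≈⟨ solve 6 (λ N a b c i h → (N :+ N) :* ((a :* i :+ (b :* i :+ (c :* i :+ # 0))) :* h) :=
           (N :* i) :* (# 2 :* h) :* (a :+ (b :+ c))) refl (fromℕ N) (fromℕ a) (fromℕ b) (fromℕ c) N⁻¹ (fromℕ 2 ⁻¹) ⟩
    (fromℕ N * N⁻¹) * (fromℕ 2 * fromℕ 2 ⁻¹) * (fromℕ a + (fromℕ b + fromℕ c))
      ≈⟨ *-cong (*-cong (⁻¹-inverseʳ _ N≉0) (⁻¹-inverseʳ _ (pos⇒≉0 (fromℕ-pos 1)))) (sym (trans (fromℕ-+ a (b ℕ.+ c)) (+-congˡ (fromℕ-+ b c)))) ⟩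
    1# * 1# * fromℕ (a ℕ.+ (b ℕ.+ c)) ≈⟨ solve 1 (λ x → # 1 :* # 1 :* x := x) refl _ ⟩
    fromℕ (a ℕ.+ (b ℕ.+ c)) ∎
    where
    N⁻¹ = fromℕ N ⁻¹
    a = ℕ.∣ p - p′ ∣
    b = ℕ.∣ q - q′ ∣
    c = ℕ.∣ r - r′ ∣
    dist′ = (∣ fromℕ p * N⁻¹ - fromℕ p′ * N⁻¹ ∣ + (∣ fromℕ q * N⁻¹ - fromℕ q′ * N⁻¹ ∣ + (∣ fromℕ r * N⁻¹ - fromℕ r′ * N⁻¹ ∣ + 0#))) ÷ fromℕ 2

    scaled : ∀ x y → ∣ fromℕ x * N⁻¹ - fromℕ y * N⁻¹ ∣ ≈ fromℕ (ℕ.∣ x - y ∣) * N⁻¹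
    scaled x y = trans (∣x∣-cong (solve 3 (λ x y i → x :* i :- y :* i := (x :- y) :* i) refl (fromℕ x) (fromℕ y) N⁻¹))
      (trans (∣x*c∣≈ _ (<⇒≤ (⁻¹-pos 0<N))) (*-congʳ (∣fromℕ-fromℕ∣ x y)))

  volume≤11n+1 : volume embedding ≤ fromℕ (11 ℕ.* n ℕ.+ 1)
  volume≤11n+1 = *-cancelˡ-≤ (fromℕ-pos (TriangularGrid.Contraction.m k ℕ.+ N)) (≤-respˡ (sym (Σˡ≈sum (fromℕ (N ℕ.+ N)) {F = λ (u , v , w) → fromℕ w * dist (embedding u) (embedding v)} edge-length edge-list))
    (≤-respʳ (fromℕ-* (N ℕ.+ N) (11 ℕ.* n ℕ.+ 1)) (fromℕ-mono total-length≤)))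
    where
    edge-length : ∀ ((u , v , w) : Edge) → fromℕ (N ℕ.+ N) * (fromℕ w * dist (embedding u) (embedding v)) ≈ fromℕ (w ℕ.* length₁ u v)
    edge-length (u , v , w) = begin
      fromℕ (N ℕ.+ N) * (fromℕ w * dist (embedding u) (embedding v))
        ≈⟨ solve 3 (λ a b c → a :* (b :* c) := b :* (a :* c)) refl (fromℕ (N ℕ.+ N)) (fromℕ w) _ ⟩
      fromℕ w * (fromℕ (N ℕ.+ N) * dist (embedding u) (embedding v))  ≈⟨ *-congˡ (dist-grid-point (coordinates u) (coordinates v)) ⟩
      fromℕ w * fromℕ (length₁ u v)                                   ≈⟨ fromℕ-* w (length₁ u v) ⟨
      fromℕ (w ℕ.* length₁ u v)                                       ∎

-- Minimum, maximum and truncation to an interval.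

module Clamp (ℝ : CompleteOrderedField) where
  open OrderedField ℝ

  infixl 7 _⊓_
  infixl 6 _⊔_
  _⊓_ _⊔_ : Carrier → Carrier → Carrier
  x ⊓ y with total x y
  ... | inj₁ _ = x
  ... | inj₂ _ = y
  x ⊔ y with total x y
  ... | inj₁ _ = y
  ... | inj₂ _ = x

  x⊓y≤x : ∀ x y → x ⊓ y ≤ x
  x⊓y≤x x y with total x y
  ... | inj₁ _   = ≤-refl
  ... | inj₂ y≤x = y≤x

  x⊓y≤y : ∀ x y → x ⊓ y ≤ y
  x⊓y≤y x y with total x y
  ... | inj₁ x≤y = x≤y
  ... | inj₂ _   = ≤-refl

  x≤x⊔y : ∀ x y → x ≤ x ⊔ y
  x≤x⊔y x y with total x y
  ... | inj₁ x≤y = x≤y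
  ... | inj₂ _   = ≤-refl

  y≤x⊔y : ∀ x y → y ≤ x ⊔ y
  y≤x⊔y x y with total x y
  ... | inj₁ _   = ≤-refl
  ... | inj₂ y≤x = y≤x

  ⊓-glb : ∀ {x y z} → z ≤ x → z ≤ y → z ≤ x ⊓ y
  ⊓-glb {x} {y} z≤x z≤y with total x y
  ... | inj₁ _ = z≤x
  ... | inj₂ _ = z≤y

  ⊔-lub : ∀ {x y z} → x ≤ z → y ≤ z → x ⊔ y ≤ z
  ⊔-lub {x} {y} x≤z y≤z with total x y
  ... | inj₁ _ = y≤z
  ... | inj₂ _ = x≤z

  ⊔-⊓≤∣-∣ : ∀ x y → (x ⊔ y) - (x ⊓ y) ≤ ∣ x - y ∣
  ⊔-⊓≤∣-∣ x y with total x y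
  ... | inj₁ _ = ≤-respˡ (solve 2 (λ x y → :- (x :- y) := y :- x) refl x y) (-x≤∣x∣ (x - y))
  ... | inj₂ _ = x≤∣x∣ (x - y)

  -- For a ≤ b, the point of [a, b] nearest to x. The difference of the clamps of r and l, for l ≤
  -- r, is the length of the overlap of [l, r] with [a, b].
  clamp : Carrier → Carrier → Carrier → Carrier
  clamp a b x = a ⊔ (b ⊓ x)

  clamp-below : ∀ {a b x} → x ≤ a → clamp a b x ≈ a
  clamp-below {a} {b} {x} x≤a = ≤-antisym (⊔-lub ≤-refl (≤-trans (x⊓y≤y b x) x≤a)) (x≤x⊔y a _)

  clamp-mid : ∀ {a b x} → a ≤ x → x ≤ b → clamp a b x ≈ x
  clamp-mid {a} {b} {x} a≤x x≤b =
    ≤-antisym (⊔-lub a≤x (x⊓y≤y b x)) (≤-trans (⊓-glb x≤b ≤-refl) (y≤x⊔y a _))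

  clamp-above : ∀ {a b x} → a ≤ b → b ≤ x → clamp a b x ≈ b
  clamp-above {a} {b} {x} a≤b b≤x =
    ≤-antisym (⊔-lub a≤b (x⊓y≤x b x)) (≤-trans (⊓-glb ≤-refl b≤x) (y≤x⊔y a _))

  a≤clamp : ∀ a b x → a ≤ clamp a b x
  a≤clamp a b x = x≤x⊔y a _

  clamp≤b : ∀ {a b} x → a ≤ b → clamp a b x ≤ b
  clamp≤b {a} {b} x a≤b = ⊔-lub a≤b (x⊓y≤x b x)

  clamp-mono : ∀ a b {x y} → x ≤ y → clamp a b x ≤ clamp a b y
  clamp-mono a b {x} {y} x≤y =
    ⊔-lub (x≤x⊔y a _) (≤-trans (⊓-glb (x⊓y≤x b x) (≤-trans (x⊓y≤y b x) x≤y)) (y≤x⊔y a _))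

  clamp-additive : ∀ {a b c} x → a ≤ b → b ≤ c → clamp a b x + clamp b c x ≈ clamp a c x + b
  clamp-additive {a} {b} {c} x a≤b b≤c with total x b
  ... | inj₁ x≤b = trans (+-congˡ (clamp-below x≤b)) (+-congʳ below)
    where
    below : clamp a b x ≈ clamp a c x
    below with total x a
    ... | inj₁ x≤a = trans (clamp-below x≤a) (sym (clamp-below x≤a))
    ... | inj₂ a≤x = trans (clamp-mid a≤x x≤b) (sym (clamp-mid a≤x (≤-trans x≤b b≤c)))
  ... | inj₂ b≤x = trans (+-congʳ (clamp-above a≤b b≤x)) (trans (+-comm _ _) (+-congʳ above))
    where
    above : clamp b c x ≈ clamp a c x
    above with total x c
    ... | inj₁ x≤c = trans (clamp-mid b≤x x≤c) (sym (clamp-mid (≤-trans a≤b b≤x) x≤c))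
    ... | inj₂ c≤x = trans (clamp-above b≤c c≤x) (sym (clamp-above (≤-trans a≤b b≤c) c≤x))

-- Averages of step functions over an interval.

module StepFunctions (em : ∀ ℓ → ExcludedMiddle ℓ) (ℝ : CompleteOrderedField) where
  open OrderedField ℝ
  open Clamp ℝ

  -- ∫ bounds from above the averages of φ over intervals, in the only form that is
  -- needed: a lower bound of φ on (a, b) is at most the average of φ there.
  record Majorises (φ : Carrier → Carrier) (∫ : Carrier → Carrier → Carrier) : Set where
    field
      additive : ∀ {a b c} → a ≤ b → b ≤ c → ∫ a b + ∫ b c ≈ ∫ a c
      bound    : ∀ {a b κ} → a ≤ b → (∀ t → a < t → t < b → κ ≤ φ t) → κ * (b - a) ≤ ∫ a b
  open Majorises

  -- Unlike Majorises itself, this is closed under addition.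
  Integrates : (Carrier → Carrier) → (Carrier → Carrier → Carrier) → Set
  Integrates φ ∫ = ∀ {ψ ∫ψ} → Majorises ψ ∫ψ → Majorises (λ t → φ t + ψ t) (λ a b → ∫ a b + ∫ψ a b)

  Majorises-cong : ∀ {φ φ′ ∫ ∫′} → (∀ t → φ′ t ≤ φ t) → (∀ a b → ∫ a b ≈ ∫′ a b) → Majorises φ ∫ → Majorises φ′ ∫′
  Majorises-cong φ′≤φ ∫≈ maj = record
    { additive = λ {a} {b} {c} a≤b b≤c → trans (+-cong (sym (∫≈ a b)) (sym (∫≈ b c))) (trans (additive maj a≤b b≤c) (∫≈ a c))
    ; bound    = λ {a} {b} a≤b κ≤φ′ → ≤-respʳ (∫≈ a b) (bound maj a≤b λ t a<t t<b → ≤-trans (κ≤φ′ t a<t t<b) (φ′≤φ t)) }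

  integrates-0 : Integrates (λ _ → 0#) (λ _ _ → 0#)
  integrates-0 = Majorises-cong (λ t → ≤-reflexive (+-identityˡ _)) (λ a b → sym (+-identityˡ _))

  integrates-+ : ∀ {φ ψ ∫φ ∫ψ} → Integrates φ ∫φ → Integrates ψ ∫ψ →
                 Integrates (λ t → φ t + ψ t) (λ a b → ∫φ a b + ∫ψ a b)
  integrates-+ int-φ int-ψ maj =
    Majorises-cong (λ t → ≤-reflexive (+-assoc _ _ _)) (λ a b → sym (+-assoc _ _ _)) (int-φ (int-ψ maj))

  integrates-sum : ∀ {n} {φ : Fin n → Carrier → Carrier} {∫ : Fin n → Carrier → Carrier → Carrier} →
                   (∀ i → Integrates (φ i) (∫ i)) → Integrates (λ t → sum (λ i → φ i t)) (λ a b → sum (λ i → ∫ i a b))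
  integrates-sum {zero}  int = integrates-0
  integrates-sum {suc n} {φ} {∫} int {ψ} {∫ψ} = integrates-+ {φ fzero} {λ t → sum (λ i → φ (fsuc i) t)} {∫ fzero} {λ a b → sum (λ i → ∫ (fsuc i) a b)}
    (int fzero) (integrates-sum {φ = λ i → φ (fsuc i)} {∫ = λ i → ∫ (fsuc i)} (λ i → int (fsuc i))) {ψ} {∫ψ}

  -- The clamped ends of [l, r] cut [a, b] into three pieces. If κ ≤ φ + ψ, then ψ is at least κ - c
  -- on the inner piece and at least κ on the outer ones; the property of ψ on each piece and its
  -- additivity give the claim.
  integrates-step : ∀ {φ c l r} → l ≤ r → (∀ t → φ t ≤ c) → (∀ t → ¬ (l ≤ t × t ≤ r) → φ t ≤ 0#) →
                    Integrates φ (λ a b → c * (clamp a b r - clamp a b l))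
  integrates-step {φ} {c} {l} {r} l≤r φ≤c φ≤0 {ψ} {∫ψ} maj = record { additive = add ; bound = bnd }
    where
    add : ∀ {x y z} → x ≤ y → y ≤ z → (c * (clamp x y r - clamp x y l) + ∫ψ x y) + (c * (clamp y z r - clamp y z l) + ∫ψ y z) ≈
                                      c * (clamp x z r - clamp x z l) + ∫ψ x z
    add {x} {y} {z} x≤y y≤z = trans
      (solve 7 (λ c p q u v i j → (c :* (p :- q) :+ i) :+ (c :* (u :- v) :+ j) := c :* ((p :+ u) :- (q :+ v)) :+ (i :+ j)) refl
        c (clamp x y r) (clamp x y l) (clamp y z r) (clamp y z l) (∫ψ x y) (∫ψ y z))
      (+-cong (*-congˡ (trans (+-cong (clamp-additive r x≤y y≤z) (-‿cong (clamp-additive l x≤y y≤z)))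
        (solve 3 (λ p q y → (p :+ y) :- (q :+ y) := p :- q) refl (clamp x z r) (clamp x z l) y))) (additive maj x≤y y≤z))

    bnd : ∀ {a b κ} → a ≤ b → (∀ t → a < t → t < b → κ ≤ φ t + ψ t) → κ * (b - a) ≤ c * (clamp a b r - clamp a b l) + ∫ψ a b
    bnd {a} {b} {κ} a≤b κ≤ = ≤-by
      (+-nonNeg (+-nonNeg (x≤y⇒0≤y-x left) (x≤y⇒0≤y-x middle)) (x≤y⇒0≤y-x right))
      (trans (+-congʳ (+-congˡ split))
        (solve 9 (λ c κ a b l r i j k → (c :* (r :- l) :+ (i :+ j :+ k)) :- κ :* (b :- a) :=
          ((i :- κ :* (l :- a)) :+ (j :- (κ :- c) :* (r :- l))) :+ (k :- κ :* (b :- r))) refl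
          c κ a b l′ r′ (∫ψ a l′) (∫ψ l′ r′) (∫ψ r′ b)))
      where
      l′ = clamp a b l
      r′ = clamp a b r
      a≤l′ = a≤clamp a b l
      l′≤r′ = clamp-mono a b l≤r
      r′≤b = clamp≤b r a≤b

      split : ∫ψ a b ≈ ∫ψ a l′ + ∫ψ l′ r′ + ∫ψ r′ b
      split = sym (trans (+-congʳ (additive maj a≤l′ l′≤r′)) (additive maj (≤-trans a≤l′ l′≤r′) r′≤b))

      drop : ∀ t → a < t → t < b → ¬ (l ≤ t × t ≤ r) → κ ≤ ψ t
      drop t a<t t<b outside = ≤-trans (κ≤ t a<t t<b) (≤-respʳ (+-identityˡ _) (+-mono-≤ (φ≤0 t outside) ≤-refl))

      left : κ * (l′ - a) ≤ ∫ψ a l′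
      left = bound maj a≤l′ λ t a<t t<l′ → drop t a<t (<-≤-trans t<l′ (clamp≤b l a≤b)) λ (l≤t , _) →
        <⇒≱ t<l′ (⊔-lub (<⇒≤ a<t) (≤-trans (x⊓y≤y b l) l≤t))

      middle : (κ - c) * (r′ - l′) ≤ ∫ψ l′ r′
      middle = bound maj l′≤r′ λ t l′<t t<r′ → ≤-by
        (+-nonNeg (x≤y⇒0≤y-x (κ≤ t (≤-<-trans a≤l′ l′<t) (<-≤-trans t<r′ r′≤b))) (x≤y⇒0≤y-x (φ≤c t)))
        (solve 4 (λ c κ p q → q :- (κ :- c) := ((p :+ q) :- κ) :+ (c :- p)) refl c κ (φ t) (ψ t))

      right : κ * (b - r′) ≤ ∫ψ r′ b
      right = bound maj r′≤b λ t r′<t t<b → drop t (≤-<-trans (≤-trans a≤l′ l′≤r′) r′<t) t<b λ (_ , t≤r) →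
        <⇒≱ r′<t (≤-trans (⊓-glb (<⇒≤ t<b) t≤r) (y≤x⊔y a _))

  integral-bound : ∀ {φ ∫ κ} → Integrates φ ∫ → (∀ t → 0# < t → t < 1# → κ ≤ φ t) → κ ≤ ∫ 0# 1#
  integral-bound {φ} {∫} {κ} int κ≤φ = ≤-respˡ (solve 1 (λ κ → κ :* (# 1 :- # 0) := κ) refl κ)
    (≤-respʳ (trans (+-congˡ (zeroˡ _)) (+-identityʳ _)) (bound (int zero-maj) 0≤1 λ t 0<t t<1 →
      ≤-respʳ (sym (+-identityʳ _)) (κ≤φ t 0<t t<1)))
    where
    zero-maj : Majorises (λ _ → 0#) (λ a b → 0# * (b - a))
    zero-maj = record
      { additive = λ {a} {b} {c} _ _ → solve 3 (λ a b c → # 0 :* (b :- a) :+ # 0 :* (c :- b) := # 0 :* (c :- a)) refl a b c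
      ; bound = λ {a} {b} {κ} a≤b κ≤0 → zero-bound a≤b κ≤0 }
      where
      zero-bound : ∀ {a b κ} → a ≤ b → (∀ t → a < t → t < b → κ ≤ 0#) → κ * (b - a) ≤ 0# * (b - a)
      zero-bound {a} {b} {κ} a≤b κ≤0 with em 0ℓ {a ≈ b}
      ... | yes a≈b = ≤-reflexive (trans (*-congˡ b-a≈0) (trans (zeroʳ κ) (sym (zeroˡ _))))
        where
        b-a≈0 : b - a ≈ 0#
        b-a≈0 = trans (+-congʳ (sym a≈b)) (-‿inverseʳ a)
      -- The hypothesis speaks of interior points only. As a < b, the midpoint is one.
      ... | no a≉b = *-monoʳ-≤ (<⇒≤ 0<b-a) (κ≤0 (a + half (b - a))
          (<-by (half-pos 0<b-a) (solve 2 (λ a h → (a :+ h) :- a := h) refl a _))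
          (<-by (half-pos 0<b-a) (trans (+-congʳ b≈) (solve 2 (λ a h → (a :+ (h :+ h)) :- (a :+ h) := h) refl a _))))
        where
        0<b-a = x<y⇒0<y-x (a≤b , a≉b)
        b≈ : b ≈ a + (half (b - a) + half (b - a))
        b≈ = trans (solve 2 (λ a b → b := a :+ (b :- a)) refl a b) (+-congˡ (sym (half+half (b - a))))

-- Rounding rules as Boolean functions.

module RoundingRules where
  open import Data.Nat.Base
  open import Data.Nat.Properties hiding (_≟_)
  open import Relation.Nullary.Decidable using (map′; _×-dec_; _→-dec_)
  import Data.Bool.Properties as Bool
  open ListSums using (Σˡ)

  pick : Fin 3 → Fin 3 → Fin 3 → (Fin 3 → Bool) → Fin 3
  pick i j k a = if a i then i else if a j then j else k

  Rule : Set
  Rule = (Fin 3 → Bool) → Fin 3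

  -- Ball cuts use all six orders of the coordinates. Corner cuts take every pair of coordinates in
  -- one order only; this is balanced enough, as each coordinate is consulted by two of the three
  -- rules.
  ball-rules corner-rules : List Rule
  ball-rules   = pick 0F 1F 2F ∷ pick 0F 2F 1F ∷ pick 1F 0F 2F ∷ pick 1F 2F 0F ∷ pick 2F 0F 1F ∷ pick 2F 1F 0F ∷ []
  corner-rules = pick 0F 1F 2F ∷ pick 0F 2F 1F ∷ pick 1F 2F 0F ∷ []

  differ : Fin 3 → Fin 3 → ℕ
  differ a b = if does (a ≟ b) then 0 else 1

  cuts : List Rule → (Fin 3 → Bool) → (Fin 3 → Bool) → ℕ
  cuts R a b = Σˡ (λ ρ → differ (ρ a) (ρ b)) R

  flip : Bool → Bool → ℕ
  flip a b = if a xor b then 1 else 0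

  flips : (Fin 3 → Bool) → (Fin 3 → Bool) → ℕ
  flips a b = flip (a 0F) (b 0F) + flip (a 1F) (b 1F) + flip (a 2F) (b 2F)

  ∀Bool? : ∀ {P : Bool → Set} → (∀ b → Dec (P b)) → Dec (∀ b → P b)
  ∀Bool? P? = map′ (λ { (t , f) true → t ; (t , f) false → f }) (λ h → h true , h false) (P? true ×-dec P? false)

  -- The rules evaluate their argument at the three literals only, so a statement about
  -- `table (a 0F) (a 1F) (a 2F)` is one about `a` by computation, and finitely many cases remain to
  -- be checked.
  table : Bool → Bool → Bool → Fin 3 → Bool
  table x y z 0F = x
  table x y z 1F = y
  table x y z 2F = z

  -- Each of the two rules that look at coordinate i first can be cut there; of the other
  -- two that ever look at i, both would be cut only if no other coordinate is above its
  -- threshold.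
  ball-cuts : ∀ a b → a 0F ∨ a 1F ∨ a 2F ≡ true → b 0F ∨ b 1F ∨ b 2F ≡ true → cuts ball-rules a b ≤ 3 * flips a b
  ball-cuts a b = check (a 0F) (a 1F) (a 2F) (b 0F) (b 1F) (b 2F)
    where
    check : ∀ a₀ a₁ a₂ b₀ b₁ b₂ → a₀ ∨ a₁ ∨ a₂ ≡ true → b₀ ∨ b₁ ∨ b₂ ≡ true →
            cuts ball-rules (table a₀ a₁ a₂) (table b₀ b₁ b₂) ≤ 3 * flips (table a₀ a₁ a₂) (table b₀ b₁ b₂)
    check = toWitness {a? = ∀Bool? λ a₀ → ∀Bool? λ a₁ → ∀Bool? λ a₂ → ∀Bool? λ b₀ → ∀Bool? λ b₁ → ∀Bool? λ b₂ →
      (_ Bool.≟ true) →-dec ((_ Bool.≟ true) →-dec (_ ≤? _))} tt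

  corner-cuts : ∀ a b → cuts corner-rules a b ≤ 2 * flips a b
  corner-cuts a b = check (a 0F) (a 1F) (a 2F) (b 0F) (b 1F) (b 2F)
    where
    check : ∀ a₀ a₁ a₂ b₀ b₁ b₂ →
            cuts corner-rules (table a₀ a₁ a₂) (table b₀ b₁ b₂) ≤ 2 * flips (table a₀ a₁ a₂) (table b₀ b₁ b₂)
    check = toWitness {a? = ∀Bool? λ a₀ → ∀Bool? λ a₁ → ∀Bool? λ a₂ → ∀Bool? λ b₀ → ∀Bool? λ b₁ → ∀Bool? λ b₂ → _ ≤? _} tt

-- Rounding an embedding to cuts.

module Rounding (em : ∀ ℓ → ExcludedMiddle ℓ) (ℝ : CompleteOrderedField)
                (G : Multiway.Instance ℝ 3) where
  open OrderedField ℝ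
  open Clamp ℝ
  open StepFunctions em ℝ
  open Cuts em ℝ
  open RoundingRules
  open import Data.List.Base using (length)
  open import Data.List.Relation.Unary.All using (All; []; _∷_)
  open Instance G

  module _ (f : Fin nodes → Point 3) (f-embedding : IsEmbedding f) {κ : Carrier} (bound : CutBound G κ) where

    X : Fin nodes → Fin 3 → Carrier
    X v i = fromℕ 3 * f v i

    -- Coordinates are scaled by 3. In the ball cuts the three coordinates get the
    -- thresholds t, 1 + t and 2 - 2t in some order; as these sum to 3, they are the
    -- coordinates of a point of the scaled simplex.
    threshold : Fin 4 → Carrier → Carrier
    threshold 0F t = t
    threshold 1F t = 1# + t
    threshold 2F t = fromℕ 2 - fromℕ 2 * t
    threshold 3F t = fromℕ 2 + t

    above : Fin 4 → Carrier → Fin nodes → Fin 3 → Bool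
    above w t v i = does (em 0ℓ {threshold w t ≤ X v i})

    crossed : Fin 4 → Carrier → Fin edges → Fin 3 → ℕ
    crossed w t e i = flip (above w t (end₁ e) i) (above w t (end₂ e) i)

    Assignment : Set
    Assignment = Fin 3 → Fin 4

    bits : Assignment → Carrier → Fin nodes → Fin 3 → Bool
    bits τ t v i = above (τ i) t v i

    private
      δ : Fin 3 → Fin 3 → Bool
      δ i j = does (i ≟ j)

    -- The 18 ball cuts (3 cyclic shifts of the thresholds, 6 rules) count 4 times each and
    -- the 3 corner cuts 9 times, which gives them the probabilities 8/11 and 3/11.
    weight : Fin 4 → ℕ
    weight 3F = 18
    weight _  = 12

    module AtParameter (t : Carrier) (0<t : 0# < t) (t<1 : t < 1#) where

      threshold-pos : ∀ w → 0# < threshold w t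
      threshold-pos 0F = 0<t
      threshold-pos 1F = +-pos-nonNeg 0<1 (<⇒≤ 0<t)
      threshold-pos 2F = <-respʳ (solve 1 (λ t → # 2 :* (# 1 :- t) := # 2 :- # 2 :* t) refl t) (*-pos (fromℕ-pos 1) (x<y⇒0<y-x t<1))
      threshold-pos 3F = +-pos-nonNeg (fromℕ-pos 1) (<⇒≤ 0<t)

      threshold≤3 : ∀ w → threshold w t ≤ fromℕ 3
      threshold≤3 0F = ≤-by (+-nonNeg (fromℕ-nonNeg 2) (x≤y⇒0≤y-x (<⇒≤ t<1))) (solve 1 (λ t → # 3 :- t := # 2 :+ (# 1 :- t)) refl t)
      threshold≤3 1F = ≤-by (+-nonNeg 0≤1 (x≤y⇒0≤y-x (<⇒≤ t<1))) (solve 1 (λ t → # 3 :- (# 1 :+ t) := # 1 :+ (# 1 :- t)) refl t)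
      threshold≤3 2F = ≤-by (+-nonNeg 0≤1 (*-nonNeg (fromℕ-nonNeg 2) (<⇒≤ 0<t))) (solve 1 (λ t → # 3 :- (# 2 :- # 2 :* t) := # 1 :+ # 2 :* t) refl t)
      threshold≤3 3F = ≤-by (x≤y⇒0≤y-x (<⇒≤ t<1)) (solve 1 (λ t → # 3 :- (# 2 :+ t) := # 1 :- t) refl t)

      -- At a vertex the scaled coordinates are 3 and 0, and all thresholds lie in (0, 3]. Here t
      -- has to avoid the ends of [0, 1]: at 0 the threshold t vanishes, at 1 the threshold 2 - 2t.
      bits-terminal : ∀ τ i j → bits τ t (terminal i) j ≡ δ i j
      bits-terminal τ i j with i ≟ j | proj₂ f-embedding i j
      ... | yes _ | x≈1 = dec-true (em 0ℓ) (≤-respʳ (trans (solve 0 (# 3 := # 3 :* # 1) refl) (*-congˡ (sym x≈1))) (threshold≤3 (τ j)))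
      ... | no _  | x≈0 = dec-false (em 0ℓ) λ thr≤ → <⇒≱ (threshold-pos (τ j)) (≤-respʳ (trans (*-congˡ x≈0) (zeroʳ _)) thr≤)

      Fair : Rule → Set
      Fair ρ = ∀ a i → (∀ j → a j ≡ δ i j) → ρ a ≡ i

      -- Every fair rule turns the bits into a labelling that keeps the terminals apart, hence into
      -- a cut of cost at least κ; the costs of these cuts are added edge by edge.
      rules-bound : ∀ τ R → All Fair R → fromℕ (length R) * κ ≤ sum (λ e → cost e * fromℕ (cuts R (bits τ t (end₁ e)) (bits τ t (end₂ e))))
      rules-bound τ []      []            = ≤-respˡ (sym (zeroˡ κ)) (sum-nonNeg {n = edges} λ e → *-nonNeg (cost-nonNeg e) ≤-refl)
      rules-bound τ (ρ ∷ R) (fair ∷ fairs) = ≤-respˡ (solve 2 (λ κ l → κ :+ l :* κ := (# 1 :+ l) :* κ) refl κ (fromℕ (length R)))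
        (≤-respʳ (trans (sym (∑-distrib-+ (crossing-cost G g) _)) (sum-cong-≋ combine)) (+-mono-≤ rule-bound (rules-bound τ R fairs)))
        where
        g : Fin nodes → Fin 3
        g v = ρ (bits τ t v)

        g-terminal : ∀ i → g (terminal i) ≡ i
        g-terminal i = fair (bits τ t (terminal i)) i (bits-terminal τ i)

        rule-bound : κ ≤ sum (crossing-cost G g)
        rule-bound = labelling-bound G bound g λ i j i≢j eq → i≢j (≡.trans (≡.sym (g-terminal i)) (≡.trans eq (g-terminal j)))

        combine : ∀ e → crossing-cost G g e + cost e * fromℕ (cuts R (bits τ t (end₁ e)) (bits τ t (end₂ e))) ≈
                        cost e * fromℕ (cuts (ρ ∷ R) (bits τ t (end₁ e)) (bits τ t (end₂ e)))
        combine e = trans (+-congʳ (if≈ (does (g (end₁ e) ≟ g (end₂ e)))))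
          (trans (sym (distribˡ (cost e) _ _)) (*-congˡ (sym (fromℕ-+ (differ (g (end₁ e)) (g (end₂ e))) _))))
          where
          if≈ : ∀ b → (if b then 0# else cost e) ≈ cost e * fromℕ (if b then 0 else 1)
          if≈ true  = sym (zeroʳ _)
          if≈ false = solve 1 (λ c → c := c :* (# 1 :+ # 0)) refl (cost e)

      Flow : Fin 4 → Fin 3 → Carrier
      Flow w i = sum (λ e → cost e * fromℕ (crossed w t e i))

      pick-fair : ∀ i j k {exhaustive : True (all? λ l → (l ≟ i) ⊎-dec ((l ≟ j) ⊎-dec (l ≟ k)))} → Fair (pick i j k)
      pick-fair i j k {exhaustive} a l eq rewrite eq i | eq j with l ≟ i | l ≟ j | toWitness exhaustive l
      ... | yes l≡i | _       | _               = ≡.sym l≡i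
      ... | no _    | yes l≡j | _               = ≡.sym l≡j
      ... | no l≢i  | no _    | inj₁ l≡i        = contradiction l≡i l≢i
      ... | no _    | no l≢j  | inj₂ (inj₁ l≡j) = contradiction l≡j l≢j
      ... | no _    | no _    | inj₂ (inj₂ l≡k) = ≡.sym l≡k

      ball-fair : All Fair ball-rules
      ball-fair = pick-fair 0F 1F 2F ∷ pick-fair 0F 2F 1F ∷ pick-fair 1F 0F 2F ∷
                  pick-fair 1F 2F 0F ∷ pick-fair 2F 0F 1F ∷ pick-fair 2F 1F 0F ∷ []

      corner-fair : All Fair corner-rules
      corner-fair = pick-fair 0F 1F 2F ∷ pick-fair 0F 2F 1F ∷ pick-fair 1F 2F 0F ∷ []

      flow-sum : ∀ c τ → sum (λ e → cost e * fromℕ (c ℕ.* flips (bits τ t (end₁ e)) (bits τ t (end₂ e)))) ≈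
                         fromℕ c * (Flow (τ 0F) 0F + Flow (τ 1F) 1F + Flow (τ 2F) 2F)
      flow-sum c τ = begin
        sum (λ e → cost e * fromℕ (c ℕ.* (x e ℕ.+ y e ℕ.+ z e)))
          ≈⟨ sum-cong-≋ (λ e → trans (*-congˡ (trans (fromℕ-* c _) (*-congˡ (trans (fromℕ-+ (x e ℕ.+ y e) (z e)) (+-congʳ (fromℕ-+ (x e) (y e)))))))
               (solve 5 (λ k c x y z → k :* (c :* (x :+ y :+ z)) := c :* (k :* x :+ k :* y :+ k :* z)) refl (cost e) (fromℕ c) (fromℕ (x e)) (fromℕ (y e)) (fromℕ (z e)))) ⟩
        sum (λ e → fromℕ c * (cost e * fromℕ (x e) + cost e * fromℕ (y e) + cost e * fromℕ (z e)))
          ≈⟨ *-distribˡ-sum {edges} (fromℕ c) (λ e → cost e * fromℕ (x e) + cost e * fromℕ (y e) + cost e * fromℕ (z e)) ⟨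
        fromℕ c * sum (λ e → cost e * fromℕ (x e) + cost e * fromℕ (y e) + cost e * fromℕ (z e))
          ≈⟨ *-congˡ (trans (∑-distrib-+ (λ e → cost e * fromℕ (x e) + cost e * fromℕ (y e)) _) (+-congʳ (∑-distrib-+ (λ e → cost e * fromℕ (x e)) _))) ⟩
        fromℕ c * (Flow (τ 0F) 0F + Flow (τ 1F) 1F + Flow (τ 2F) 2F) ∎
        where
        open import Relation.Binary.Reasoning.Setoid setoid
        x y z : Fin edges → ℕ
        x e = crossed (τ 0F) t e 0F
        y e = crossed (τ 1F) t e 1F
        z e = crossed (τ 2F) t e 2F

      sum₃≈3 : ∀ v → X v 0F + X v 1F + X v 2F ≈ fromℕ 3
      sum₃≈3 v = trans (solve 3 (λ x y z → # 3 :* x :+ # 3 :* y :+ # 3 :* z := # 3 :* (x :+ (y :+ (z :+ # 0)))) refl (f v 0F) (f v 1F) (f v 2F))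
        (trans (*-congˡ (proj₂ (proj₁ f-embedding v))) (*-identityʳ _))

      -- The thresholds have the same sum 3 as the coordinates of every node, so no node is below
      -- all three of them. This excludes the pattern of bits that `ball-cuts` must exclude.
      ball-bound : ∀ τ → threshold (τ 0F) t + threshold (τ 1F) t + threshold (τ 2F) t ≈ fromℕ 3 →
                   fromℕ 6 * κ ≤ fromℕ 3 * (Flow (τ 0F) 0F + Flow (τ 1F) 1F + Flow (τ 2F) 2F)
      ball-bound τ Σthr≈3 = ≤-trans (rules-bound τ ball-rules ball-fair) (≤-respʳ (flow-sum 3 τ) (sum-mono λ e →
        *-monoˡ-≤ (cost-nonNeg e) (fromℕ-mono (ball-cuts (bits τ t (end₁ e)) (bits τ t (end₂ e)) (some-above (end₁ e)) (some-above (end₂ e))))))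
        where
        some-above : ∀ v → bits τ t v 0F ∨ bits τ t v 1F ∨ bits τ t v 2F ≡ true
        some-above v with em 0ℓ {threshold (τ 0F) t ≤ X v 0F} | em 0ℓ {threshold (τ 1F) t ≤ X v 1F} | em 0ℓ {threshold (τ 2F) t ≤ X v 2F}
        ... | yes _ | _     | _     = ≡.refl
        ... | no _  | yes _ | _     = ≡.refl
        ... | no _  | no _  | yes _ = ≡.refl
        ... | no a  | no b  | no c  = ⊥-elim (<-irrefl (<-respʳ (trans Σthr≈3 (sym (sum₃≈3 v))) (<-by
          (+-pos-nonNeg (x<y⇒0<y-x (≰⇒> a)) (+-nonNeg (x≤y⇒0≤y-x (<⇒≤ (≰⇒> b))) (x≤y⇒0≤y-x (<⇒≤ (≰⇒> c)))))
          (solve 6 (λ a b c x y z → (a :+ b :+ c) :- (x :+ y :+ z) := (a :- x) :+ ((b :- y) :+ (c :- z))) refl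
            (threshold (τ 0F) t) (threshold (τ 1F) t) (threshold (τ 2F) t) (X v 0F) (X v 1F) (X v 2F)))))

      corner-bound : fromℕ 3 * κ ≤ fromℕ 2 * (Flow 3F 0F + Flow 3F 1F + Flow 3F 2F)
      corner-bound = ≤-trans (rules-bound (λ _ → 3F) corner-rules corner-fair) (≤-respʳ (flow-sum 2 (λ _ → 3F)) (sum-mono λ e →
        *-monoˡ-≤ (cost-nonNeg e) (fromℕ-mono (corner-cuts (bits (λ _ → 3F) t (end₁ e)) (bits (λ _ → 3F) t (end₂ e))))))

      -- A Latin square: every coordinate gets each of the first three thresholds exactly once, so
      -- in the sum of the three ball bounds each of these flows occurs once.
      τ₀ τ₁ τ₂ : Assignment
      τ₀ = λ { 0F → 0F ; 1F → 1F ; 2F → 2F }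
      τ₁ = λ { 0F → 1F ; 1F → 2F ; 2F → 0F }
      τ₂ = λ { 0F → 2F ; 1F → 0F ; 2F → 1F }

      -- Four times the three ball bounds plus nine times the corner bound: 99 = 4 * 3 * 6 + 9 * 3,
      -- with the coefficients 12 = 4 * 3 and 18 = 9 * 2 of `weight`.
      weighted-flows : fromℕ 99 * κ ≤ sum (λ i → sum (λ w → fromℕ (weight w) * Flow w i))
      weighted-flows = ≤-by
        (+-nonNeg (*-nonNeg (fromℕ-nonNeg 4) (+-nonNeg (x≤y⇒0≤y-x (ball-bound τ₀ (solve 1 (λ t → t :+ (# 1 :+ t) :+ (# 2 :- # 2 :* t) := # 3) refl t)))
                    (+-nonNeg (x≤y⇒0≤y-x (ball-bound τ₁ (solve 1 (λ t → (# 1 :+ t) :+ (# 2 :- # 2 :* t) :+ t := # 3) refl t)))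
                              (x≤y⇒0≤y-x (ball-bound τ₂ (solve 1 (λ t → (# 2 :- # 2 :* t) :+ t :+ (# 1 :+ t) := # 3) refl t))))))
                  (*-nonNeg (fromℕ-nonNeg 9) (x≤y⇒0≤y-x corner-bound)))
        (solve 13 (λ κ a₀ a₁ a₂ b₀ b₁ b₂ c₀ c₁ c₂ d₀ d₁ d₂ →
          ((# 12 :* a₀ :+ (# 12 :* b₀ :+ (# 12 :* c₀ :+ (# 18 :* d₀ :+ # 0)))) :+
          ((# 12 :* a₁ :+ (# 12 :* b₁ :+ (# 12 :* c₁ :+ (# 18 :* d₁ :+ # 0)))) :+
          ((# 12 :* a₂ :+ (# 12 :* b₂ :+ (# 12 :* c₂ :+ (# 18 :* d₂ :+ # 0)))) :+ # 0))) :- # 99 :* κ :=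
          # 4 :* ((# 3 :* (a₀ :+ b₁ :+ c₂) :- # 6 :* κ) :+ ((# 3 :* (b₀ :+ c₁ :+ a₂) :- # 6 :* κ) :+ (# 3 :* (c₀ :+ a₁ :+ b₂) :- # 6 :* κ))) :+
          # 9 :* (# 2 :* (d₀ :+ d₁ :+ d₂) :- # 3 :* κ)) refl
          κ (Flow 0F 0F) (Flow 0F 1F) (Flow 0F 2F) (Flow 1F 0F) (Flow 1F 1F) (Flow 1F 2F)
            (Flow 2F 0F) (Flow 2F 1F) (Flow 2F 2F) (Flow 3F 0F) (Flow 3F 1F) (Flow 3F 2F))

    contribution : Fin edges → Fin 3 → Fin 4 → Carrier → Carrier
    contribution e i w t = fromℕ (weight w) * (cost e * fromℕ (crossed w t e i))

    99κ≤contributions : ∀ t → 0# < t → t < 1# →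
      fromℕ 99 * κ ≤ sum (λ e → sum (λ i → sum (λ w → contribution e i w t)))
    99κ≤contributions t 0<t t<1 = ≤-respʳ regroup weighted-flows
      where
      open AtParameter t 0<t t<1
      open import Relation.Binary.Reasoning.Setoid setoid
      regroup : sum (λ i → sum (λ w → fromℕ (weight w) * Flow w i)) ≈ sum (λ e → sum (λ i → sum (λ w → contribution e i w t)))
      regroup = begin
        sum (λ i → sum (λ w → fromℕ (weight w) * Flow w i))
          ≈⟨ sum-cong-≋ {3} (λ i → sum-cong-≋ {4} λ w → *-distribˡ-sum {edges} (fromℕ (weight w)) (λ e → cost e * fromℕ (crossed w t e i))) ⟩
        sum (λ i → sum (λ w → sum (λ e → contribution e i w t)))
          ≈⟨ sum-cong-≋ {3} (λ i → ∑-comm {4} {edges} (λ w e → contribution e i w t)) ⟩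
        sum (λ i → sum (λ e → sum (λ w → contribution e i w t)))
          ≈⟨ ∑-comm {3} {edges} (λ i e → sum (λ w → contribution e i w t)) ⟩
        sum (λ e → sum (λ i → sum (λ w → contribution e i w t))) ∎

    lo hi : Fin edges → Fin 3 → Carrier
    lo e i = X (end₁ e) i ⊓ X (end₂ e) i
    hi e i = X (end₁ e) i ⊔ X (end₂ e) i

    lo≤hi : ∀ e i → lo e i ≤ hi e i
    lo≤hi e i = ≤-trans (x⊓y≤x _ _) (x≤x⊔y _ _)

    -- Ends of the interval of parameters t whose threshold lies in [m, M]. The threshold 2 - 2t
    -- runs backwards at double speed, which exchanges the ends and halves them.
    start stop : Fin 4 → Carrier → Carrier → Carrier
    start 0F m M = m
    start 1F m M = m - 1#
    start 2F m M = 1# - half M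
    start 3F m M = m - fromℕ 2
    stop 0F m M = M
    stop 1F m M = M - 1#
    stop 2F m M = 1# - half m
    stop 3F m M = M - fromℕ 2

    half-mono : ∀ {x y} → x ≤ y → half x ≤ half y
    half-mono = *-monoʳ-≤ (<⇒≤ (⁻¹-pos (fromℕ-pos 1)))

    start≤stop : ∀ w {m M} → m ≤ M → start w m M ≤ stop w m M
    start≤stop 0F m≤M = m≤M
    start≤stop 1F m≤M = +-mono-≤ m≤M ≤-refl
    start≤stop 2F m≤M = +-mono-≤ ≤-refl (-‿mono-≤ (half-mono m≤M))
    start≤stop 3F m≤M = +-mono-≤ m≤M ≤-refl

    doubled : ∀ t x → fromℕ 2 * (1# - half x - t) ≈ fromℕ 2 - fromℕ 2 * t - x
    doubled t x = trans (solve 2 (λ h t → # 2 :* (# 1 :- h :- t) := # 2 :- # 2 :* t :- (h :+ h)) refl (half x) t)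
      (+-congˡ (-‿cong (half+half x)))

    halve-nonNeg : ∀ {x} → 0# ≤ fromℕ 2 * x → 0# ≤ x
    halve-nonNeg {x} 0≤2x = *-cancelˡ-≤ (fromℕ-pos 1) (≤-respˡ (sym (zeroʳ _)) 0≤2x)

    between : ∀ w t {m M} → m ≤ threshold w t → threshold w t ≤ M → start w m M ≤ t × t ≤ stop w m M
    between 0F t {m} {M} m≤ ≤M = m≤ , ≤M
    between 1F t {m} {M} m≤ ≤M = ≤-by (x≤y⇒0≤y-x m≤) (solve 2 (λ m t → t :- (m :- # 1) := (# 1 :+ t) :- m) refl m t)
                               , ≤-by (x≤y⇒0≤y-x ≤M) (solve 2 (λ m t → (m :- # 1) :- t := m :- (# 1 :+ t)) refl M t)
    between 2F t {m} {M} m≤ ≤M =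
        ≤-by (halve-nonNeg (≤-respʳ (trans (solve 2 (λ t M → M :- (# 2 :- # 2 :* t) := :- (# 2 :- # 2 :* t :- M)) refl t M)
            (trans (-‿cong (sym (doubled t M))) (solve 1 (λ x → :- (# 2 :* x) := # 2 :* (:- x)) refl _))) (x≤y⇒0≤y-x ≤M)))
          (solve 2 (λ h t → t :- (# 1 :- h) := :- (# 1 :- h :- t)) refl (half M) t)
      , ≤-by (halve-nonNeg (≤-respʳ (sym (doubled t m)) (x≤y⇒0≤y-x m≤))) refl
    between 3F t {m} {M} m≤ ≤M = ≤-by (x≤y⇒0≤y-x m≤) (solve 2 (λ m t → t :- (m :- # 2) := (# 2 :+ t) :- m) refl m t)
                               , ≤-by (x≤y⇒0≤y-x ≤M) (solve 2 (λ m t → (m :- # 2) :- t := m :- (# 2 :+ t)) refl M t)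

    crossed⇒between : ∀ w t e i → crossed w t e i ≡ 0 ⊎ crossed w t e i ≡ 1 × lo e i ≤ threshold w t × threshold w t ≤ hi e i
    crossed⇒between w t e i with em 0ℓ {threshold w t ≤ X (end₁ e) i} | em 0ℓ {threshold w t ≤ X (end₂ e) i}
    ... | yes _ | yes _ = inj₁ ≡.refl
    ... | no _  | no _  = inj₁ ≡.refl
    ... | yes p | no ¬q = inj₂ (≡.refl , ≤-trans (x⊓y≤y _ _) (<⇒≤ (≰⇒> ¬q)) , ≤-trans p (x≤x⊔y _ _))
    ... | no ¬p | yes q = inj₂ (≡.refl , ≤-trans (x⊓y≤x _ _) (<⇒≤ (≰⇒> ¬p)) , ≤-trans q (y≤x⊔y _ _))

    measure : Fin edges → Fin 3 → Fin 4 → Carrier → Carrier → Carrier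
    measure e i w a b = (fromℕ (weight w) * cost e) *
      (clamp a b (stop w (lo e i) (hi e i)) - clamp a b (start w (lo e i) (hi e i)))

    contribution-integrates : ∀ e i w → Integrates (contribution e i w) (measure e i w)
    contribution-integrates e i w = integrates-step (start≤stop w (lo≤hi e i)) ≤c ≤0
      where
      c = fromℕ (weight w) * cost e
      0≤c : 0# ≤ c
      0≤c = *-nonNeg (fromℕ-nonNeg (weight w)) (cost-nonNeg e)

      value : ∀ t {x} → crossed w t e i ≡ x → contribution e i w t ≈ c * fromℕ x
      value t eq = trans (*-congˡ (*-congˡ (reflexive (≡.cong fromℕ eq)))) (sym (*-assoc _ _ _))

      ≤c : ∀ t → contribution e i w t ≤ c
      ≤c t with crossed⇒between w t e i
      ... | inj₁ eq       = ≤-trans (≤-reflexive (trans (value t eq) (zeroʳ c))) 0≤c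
      ... | inj₂ (eq , _) = ≤-reflexive (trans (value t eq) (solve 1 (λ c → c :* (# 1 :+ # 0) := c) refl c))

      ≤0 : ∀ t → ¬ (start w (lo e i) (hi e i) ≤ t × t ≤ stop w (lo e i) (hi e i)) → contribution e i w t ≤ 0#
      ≤0 t outside with crossed⇒between w t e i
      ... | inj₁ eq              = ≤-reflexive (trans (value t eq) (zeroʳ c))
      ... | inj₂ (_ , m≤ , ≤M)  = contradiction (between w t m≤ ≤M) outside

    private
      cl : Carrier → Carrier
      cl = clamp 0# 1#

    -- Up to the constant 12, the weighted measure of the parameters in [0, 1] whose threshold is at
    -- most x. The negative term comes from 2 - 2t, which is at most x exactly when t is at least 1
    -- - x/2.
    coverage : Carrier → Carrier
    coverage x = fromℕ 12 * cl x + fromℕ 12 * cl (x - 1#) - fromℕ 12 * cl (1# - half x) + fromℕ 18 * cl (x - fromℕ 2)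

    -- The thresholds sweep [0, 3] with constant total density.
    coverage≈ : ∀ {x} → 0# ≤ x → x ≤ fromℕ 3 → coverage x ≈ fromℕ 18 * x - fromℕ 12
    coverage≈ {x} 0≤x x≤3 = go (total x 1#) (total x (fromℕ 2))
      where
      h = half x
      x≈2h : h + h ≈ x
      x≈2h = half+half x

      0≤h : 0# ≤ h
      0≤h = *-nonNeg 0≤x (<⇒≤ (⁻¹-pos (fromℕ-pos 1)))

      value : ∀ {p q r s} → cl x ≈ p → cl (x - 1#) ≈ q → cl (1# - h) ≈ r → cl (x - fromℕ 2) ≈ s →
              coverage x ≈ fromℕ 12 * p + fromℕ 12 * q - fromℕ 12 * r + fromℕ 18 * s
      value p q r s = +-cong (+-cong (+-cong (*-congˡ p) (*-congˡ q)) (-‿cong (*-congˡ r))) (*-congˡ s)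

      1-h≤1 : 1# - h ≤ 1#
      1-h≤1 = ≤-by 0≤h (solve 1 (λ h → # 1 :- (# 1 :- h) := h) refl h)

      0≤1-h : x ≤ fromℕ 2 → 0# ≤ 1# - h
      0≤1-h x≤2 = halve-nonNeg (≤-respʳ (trans (+-congˡ (-‿cong (sym x≈2h)))
        (solve 1 (λ h → # 2 :- (h :+ h) := # 2 :* (# 1 :- h)) refl h)) (x≤y⇒0≤y-x x≤2))

      via-h : ∀ {y} → y ≈ fromℕ 12 * x - fromℕ 12 + fromℕ 12 * h → y ≈ fromℕ 18 * x - fromℕ 12
      via-h y≈ = trans y≈ (trans (solve 2 (λ x h → # 12 :* x :- # 12 :+ # 12 :* h := # 12 :* x :- # 12 :+ # 6 :* (h :+ h)) refl x h)
        (trans (+-congˡ (*-congˡ x≈2h)) (solve 1 (λ x → # 12 :* x :- # 12 :+ # 6 :* x := # 18 :* x :- # 12) refl x)))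

      x-c≤0 : ∀ {c} → x ≤ c → x - c ≤ 0#
      x-c≤0 {c} x≤c = ≤-by (x≤y⇒0≤y-x x≤c) (solve 2 (λ x c → # 0 :- (x :- c) := c :- x) refl x c)

      1≤2 : 1# ≤ fromℕ 2
      1≤2 = ≤-by 0≤1 (solve 0 (# 2 :- # 1 := # 1) refl)

      go : x ≤ 1# ⊎ 1# ≤ x → x ≤ fromℕ 2 ⊎ fromℕ 2 ≤ x → coverage x ≈ fromℕ 18 * x - fromℕ 12
      go (inj₁ x≤1) _ = via-h (trans (value (clamp-mid 0≤x x≤1) (clamp-below (x-c≤0 x≤1))
          (clamp-mid (0≤1-h (≤-trans x≤1 1≤2)) 1-h≤1) (clamp-below (x-c≤0 (≤-trans x≤1 1≤2))))
        (solve 2 (λ x h → # 12 :* x :+ # 12 :* # 0 :- # 12 :* (# 1 :- h) :+ # 18 :* # 0 := # 12 :* x :- # 12 :+ # 12 :* h) refl x h))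
      go (inj₂ 1≤x) (inj₁ x≤2) = via-h (trans (value (clamp-above 0≤1 1≤x)
          (clamp-mid (x≤y⇒0≤y-x 1≤x) (≤-by (x≤y⇒0≤y-x x≤2) (solve 1 (λ x → # 1 :- (x :- # 1) := # 2 :- x) refl x)))
          (clamp-mid (0≤1-h x≤2) 1-h≤1) (clamp-below (x-c≤0 x≤2)))
        (solve 2 (λ x h → # 12 :* # 1 :+ # 12 :* (x :- # 1) :- # 12 :* (# 1 :- h) :+ # 18 :* # 0 := # 12 :* x :- # 12 :+ # 12 :* h) refl x h))
      go (inj₂ 1≤x) (inj₂ 2≤x) = trans (value (clamp-above 0≤1 1≤x)
          (clamp-above 0≤1 (≤-by (x≤y⇒0≤y-x 2≤x) (solve 1 (λ x → x :- # 1 :- # 1 := x :- # 2) refl x)))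
          (clamp-below (≤-by (halve-nonNeg (≤-respʳ (trans (+-congʳ (sym x≈2h)) (solve 1 (λ h → (h :+ h) :- # 2 := # 2 :* (h :- # 1)) refl h)) (x≤y⇒0≤y-x 2≤x)))
            (solve 1 (λ h → # 0 :- (# 1 :- h) := h :- # 1) refl h)))
          (clamp-mid (x≤y⇒0≤y-x 2≤x) (≤-by (x≤y⇒0≤y-x x≤3) (solve 1 (λ x → # 1 :- (x :- # 2) := # 3 :- x) refl x))))
        (solve 1 (λ x → # 12 :* # 1 :+ # 12 :* # 1 :- # 12 :* # 0 :+ # 18 :* (x :- # 2) := # 18 :* x :- # 12) refl x)

    X-range : ∀ v i → 0# ≤ X v i × X v i ≤ fromℕ 3
    X-range v i = *-nonNeg (fromℕ-nonNeg 3) (proj₁ (proj₁ f-embedding v) i)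
      , ≤-respʳ (*-identityʳ _) (*-monoˡ-≤ (fromℕ-nonNeg 3) (≤-respʳ (proj₂ (proj₁ f-embedding v)) (term≤sum (proj₁ (proj₁ f-embedding v)) i)))

    -- The slope 18 of `coverage` times the scaling factor 3 of the coordinates gives 54.
    measures : ∀ e i → sum (λ w → measure e i w 0# 1#) ≤ cost e * (fromℕ 54 * ∣ f (end₁ e) i - f (end₂ e) i ∣)
    measures e i = ≤-respˡ (sym measures≈) (≤-trans (*-monoˡ-≤ (cost-nonNeg e) (*-monoˡ-≤ (fromℕ-nonNeg 18) (⊔-⊓≤∣-∣ _ _)))
      (≤-reflexive (*-congˡ scale)))
      where
      m = lo e i
      M = hi e i
      open import Relation.Binary.Reasoning.Setoid setoid
      measures≈ : sum (λ w → measure e i w 0# 1#) ≈ cost e * (fromℕ 18 * (M - m))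
      measures≈ = begin
        sum (λ w → measure e i w 0# 1#)
          ≈⟨ solve 9 (λ c a b a₁ b₁ a₂ b₂ a₃ b₃ →
               ((# 12 :* c) :* (b :- a) :+ ((# 12 :* c) :* (b₁ :- a₁) :+ ((# 12 :* c) :* (a₂ :- b₂) :+ ((# 18 :* c) :* (b₃ :- a₃) :+ # 0)))) :=
               c :* ((# 12 :* b :+ # 12 :* b₁ :- # 12 :* b₂ :+ # 18 :* b₃) :- (# 12 :* a :+ # 12 :* a₁ :- # 12 :* a₂ :+ # 18 :* a₃))) refl
               (cost e) (cl m) (cl M) (cl (m - 1#)) (cl (M - 1#)) (cl (1# - half m)) (cl (1# - half M)) (cl (m - fromℕ 2)) (cl (M - fromℕ 2)) ⟩
        cost e * (coverage M - coverage m)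
          ≈⟨ *-congˡ (+-cong (coverage≈ 0≤M M≤3) (-‿cong (coverage≈ 0≤m m≤3))) ⟩
        cost e * ((fromℕ 18 * M - fromℕ 12) - (fromℕ 18 * m - fromℕ 12))
          ≈⟨ solve 3 (λ c m M → c :* ((# 18 :* M :- # 12) :- (# 18 :* m :- # 12)) := c :* (# 18 :* (M :- m))) refl (cost e) m M ⟩
        cost e * (fromℕ 18 * (M - m)) ∎
        where
        0≤m = ⊓-glb (proj₁ (X-range (end₁ e) i)) (proj₁ (X-range (end₂ e) i))
        M≤3 = ⊔-lub (proj₂ (X-range (end₁ e) i)) (proj₂ (X-range (end₂ e) i))
        0≤M = ≤-trans 0≤m (lo≤hi e i)
        m≤3 = ≤-trans (lo≤hi e i) M≤3

      scale : fromℕ 18 * ∣ X (end₁ e) i - X (end₂ e) i ∣ ≈ fromℕ 54 * ∣ f (end₁ e) i - f (end₂ e) i ∣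
      scale = trans (*-congˡ (trans (∣x∣-cong (solve 2 (λ x y → # 3 :* x :- # 3 :* y := (x :- y) :* # 3) refl (f (end₁ e) i) (f (end₂ e) i)))
                (∣x*c∣≈ _ (fromℕ-nonNeg 3)))) (solve 1 (λ x → # 18 :* (x :* # 3) := # 54 :* x) refl _)

    -- Averaging over t in (0, 1) and adding the three coordinates gives 54 times the L1 distance of
    -- the ends of each edge, which is 108 times its length.
    99κ≤108volume : fromℕ 99 * κ ≤ fromℕ 108 * volume f
    99κ≤108volume = ≤-trans (integral-bound
        {φ = λ t → sum (λ e → sum (λ i → sum (λ w → contribution e i w t)))}
        {∫ = λ a b → sum (λ e → sum (λ i → sum (λ w → measure e i w a b)))}
        (integrates-sum {φ = λ e t → sum (λ i → sum (λ w → contribution e i w t))} {∫ = λ e a b → sum (λ i → sum (λ w → measure e i w a b))} λ e →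
         integrates-sum {φ = λ i t → sum (λ w → contribution e i w t)} {∫ = λ i a b → sum (λ w → measure e i w a b)} λ i →
         integrates-sum {φ = λ w t → contribution e i w t} {∫ = λ w a b → measure e i w a b} λ w → contribution-integrates e i w)
        99κ≤contributions)
      (≤-respʳ (sym (*-distribˡ-sum {edges} (fromℕ 108) (λ e → cost e * dist (f (end₁ e)) (f (end₂ e))))) (sum-mono λ e →
        ≤-respʳ (edge e) (sum-mono {3} (measures e))))
      where
      edge : ∀ e → sum (λ i → cost e * (fromℕ 54 * ∣ f (end₁ e) i - f (end₂ e) i ∣)) ≈
                   fromℕ 108 * (cost e * dist (f (end₁ e)) (f (end₂ e)))
      edge e = trans (solve 5 (λ c x y z j → c :* (# 54 :* x) :+ (c :* (# 54 :* y) :+ (c :* (# 54 :* z) :+ # 0)) :=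
                 # 54 :* c :* ((x :+ (y :+ (z :+ # 0))))) refl (cost e) (d 0F) (d 1F) (d 2F) (fromℕ 2 ⁻¹))
        (trans (*-congˡ (sym (*-÷-cancel _ (pos⇒≉0 (fromℕ-pos 1)))))
          (solve 2 (λ c x → # 54 :* c :* (# 2 :* x) := # 108 :* (c :* x)) refl (cost e) _))
        where
        d : Fin 3 → Carrier
        d i = ∣ f (end₁ e) i - f (end₂ e) i ∣

  cut≤12/11volume : ∀ {f κ} → IsEmbedding f → CutBound G κ → κ ≤ 12/11 * volume f
  cut≤12/11volume {f} {κ} f-embedding bound = *-cancelˡ-≤ (fromℕ-pos 98) (≤-respʳ
    (trans (solve 1 (λ v → # 108 :* v := # 9 :* # 12 :* v) refl (volume f))
      (trans (*-congʳ (*-congˡ (sym (*-÷-cancel (fromℕ 12) (pos⇒≉0 (fromℕ-pos 10))))))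
        (solve 2 (λ v r → # 9 :* (# 11 :* r) :* v := # 99 :* (r :* v)) refl (volume f) 12/11)))
    (99κ≤108volume f f-embedding bound))

-- Lipschitz functions attain their minimum on a box.

module LipschitzMinima (em : ∀ ℓ → ExcludedMiddle ℓ) (ℝ : CompleteOrderedField) where
  open OrderedField ℝ
  open Suprema em ℝ
  open Clamp ℝ
  open import Data.Vec.Functional using (tail) renaming (_∷_ to _◂_)

  InUnit : Carrier → Set
  InUnit t = 0# ≤ t × t ≤ 1#

  0∈Unit : InUnit 0#
  0∈Unit = ≤-refl , 0≤1

  ∣x∣≤0 : ∀ {x} → x ≈ 0# → ∣ x ∣ ≤ 0#
  ∣x∣≤0 x≈0 = ∣x∣≤ (≤-reflexive x≈0) (≤-reflexive (trans (-‿cong x≈0) (solve 0 (:- # 0 := # 0) refl)))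

  ⊓-pos : ∀ {x y} → 0# < x → 0# < y → 0# < x ⊓ y
  ⊓-pos {x} {y} 0<x 0<y with total x y
  ... | inj₁ _ = 0<x
  ... | inj₂ _ = 0<y

  module _ (g : Carrier → Carrier) {L : Carrier} (0≤L : 0# ≤ L)
           (lipschitz : ∀ x y → g x ≤ g y + L * ∣ x - y ∣) where

    infimum : ∃[ v ] (∀ t → InUnit t → v ≤ g t) × (∀ z → (∀ t → InUnit t → z ≤ g t) → z ≤ v)
    infimum = - u , (λ t t∈ → ≤-respʳ (negneg (g t)) (-‿mono-≤ (proj₁ (proj₂ lub) (- g t) (t , t∈ , refl))))
            , λ z z≤ → ≤-respˡ (negneg z) (-‿mono-≤ (proj₂ (proj₂ lub) (- z) λ { y (t , t∈ , y≈) → ≤-respˡ (sym y≈) (-‿mono-≤ (z≤ t t∈)) }))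
      where
      negneg : ∀ x → - - x ≈ x
      negneg = solve 1 (λ x → :- (:- x) := x) refl

      Values : Carrier → Set
      Values y = ∃[ t ] InUnit t × y ≈ - g t

      lub = complete Values (- g 0# , 0# , 0∈Unit , refl) (L - g 0# , λ { y (t , (0≤t , t≤1) , y≈) → ≤-respˡ (sym y≈)
        (≤-by (+-nonNeg (x≤y⇒0≤y-x (lipschitz 0# t)) (x≤y⇒0≤y-x (*-monoˡ-≤ 0≤L (∣0-t∣≤1 0≤t t≤1))))
          (solve 4 (λ L g0 gt d → (L :- g0) :- :- gt := ((gt :+ L :* d) :- g0) :+ (L :* # 1 :- L :* d)) refl L (g 0#) (g t) ∣ 0# - t ∣)) })
        where
        ∣0-t∣≤1 : ∀ {t} → 0# ≤ t → t ≤ 1# → ∣ 0# - t ∣ ≤ 1#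
        ∣0-t∣≤1 {t} 0≤t t≤1 = ∣x∣≤ (≤-by (+-nonNeg 0≤1 0≤t) (solve 1 (λ t → # 1 :- (# 0 :- t) := # 1 :+ t) refl t))
                                   (≤-respˡ (solve 1 (λ t → t := :- (# 0 :- t)) refl t) t≤1)
      u = proj₁ lub

    -- If g were above its infimum v everywhere, consider the supremum t* of the t for
    -- which g is bounded away from v on [0, t].
    module _ (v : Carrier) (greatest : ∀ z → (∀ t → InUnit t → z ≤ g t) → z ≤ v) (v<g : ∀ t → InUnit t → v < g t) where

      Away : Carrier → Set
      Away t = InUnit t × ∃[ ε ] 0# < ε × (∀ s → 0# ≤ s → s ≤ t → v + ε ≤ g s)

      away-0 : Away 0#
      away-0 = 0∈Unit , g 0# - v , x<y⇒0<y-x (v<g 0# 0∈Unit) , λ s 0≤s s≤0 → ≤-respˡ (solve 2 (λ v g → g := v :+ (g :- v)) refl v (g 0#))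
        (≤-trans (lipschitz 0# s) (≤-respʳ (+-identityʳ _) (+-mono-≤ ≤-refl (≤-respʳ (zeroʳ L)
          (*-monoˡ-≤ 0≤L (∣x∣≤0 (trans (+-congˡ (-‿cong (≤-antisym s≤0 0≤s))) (solve 0 (# 0 :- # 0 := # 0) refl))))))))

      no-supremum : ∀ t* → ¬ IsLUB _≤_ Away t*
      no-supremum t* (upper , least) = contradiction (greatest (v + proj₁ everywhere) (proj₂ (proj₂ everywhere)))
          (<⇒≱ (<-by (proj₁ (proj₂ everywhere)) (solve 2 (λ v e → (v :+ e) :- v := e) refl v (proj₁ everywhere))))
        where
        t*∈ : InUnit t*
        t*∈ = upper 0# away-0 , least 1# λ { t ((_ , t≤1) , _) → t≤1 }

        η = half (g t* - v)
        0<η : 0# < η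
        0<η = half-pos (x<y⇒0<y-x (v<g t* t*∈))

        1+L-pos : 0# < 1# + L
        1+L-pos = +-pos-nonNeg 0<1 0≤L

        -- Dividing by 1 + L instead of L covers L = 0 and still gives L δ ≤ η.
        δ = η ÷ (1# + L)
        0<δ : 0# < δ
        0<δ = *-pos 0<η (⁻¹-pos 1+L-pos)

        Lδ≤η : L * δ ≤ η
        Lδ≤η = ≤-by (<⇒≤ 0<δ) (trans (+-congʳ (sym (*-÷-cancel η (pos⇒≉0 1+L-pos)))) (solve 2 (λ L d → (# 1 :+ L) :* d :- L :* d := d) refl L δ))

        near-t* : ∀ s → t* - δ ≤ s → s ≤ t* + δ → v + η ≤ g s
        near-t* s lo hi = ≤-by (+-nonNeg (x≤y⇒0≤y-x (lipschitz t* s)) (+-nonNeg (x≤y⇒0≤y-x (*-monoˡ-≤ 0≤L ∣t*-s∣≤δ)) (x≤y⇒0≤y-x Lδ≤η)))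
          (trans (solve 7 (λ gs v e L a d gt → gs :- (v :+ e) := ((gs :+ L :* a) :- (v :+ (e :+ e))) :+ ((L :* d :- L :* a) :+ (e :- L :* d))) refl
              (g s) v η L ∣ t* - s ∣ δ (g t*))
            (+-congʳ (+-congˡ (-‿cong (trans (+-congˡ (half+half (g t* - v))) (solve 2 (λ v g → v :+ (g :- v) := g) refl v (g t*)))))))
          where
          ∣t*-s∣≤δ : ∣ t* - s ∣ ≤ δ
          ∣t*-s∣≤δ = ∣x∣≤ (≤-by (x≤y⇒0≤y-x lo) (solve 3 (λ t s d → d :- (t :- s) := s :- (t :- d)) refl t* s δ))
                         (≤-by (x≤y⇒0≤y-x hi) (solve 3 (λ t s d → d :- :- (t :- s) := (t :+ d) :- s) refl t* s δ))

        close : ∃[ t ] Away t × t* - δ < t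
        close = lub-approximable (upper , least) 0<δ

        ε = proj₁ (proj₂ (proj₁ (proj₂ close))) ⊓ η
        0<ε : 0# < ε
        0<ε = ⊓-pos (proj₁ (proj₂ (proj₂ (proj₁ (proj₂ close))))) 0<η

        beyond : ∀ s → 0# ≤ s → s ≤ t* + δ → v + ε ≤ g s
        beyond s 0≤s s≤ = by-cases (total s (proj₁ close))
          where
          by-cases : s ≤ proj₁ close ⊎ proj₁ close ≤ s → v + ε ≤ g s
          by-cases (inj₁ s≤t) = ≤-trans (+-mono-≤ ≤-refl (x⊓y≤x _ _)) (proj₂ (proj₂ (proj₂ (proj₁ (proj₂ close)))) s 0≤s s≤t)
          by-cases (inj₂ t≤s) = ≤-trans (+-mono-≤ ≤-refl (x⊓y≤y _ _)) (near-t* s (≤-trans (<⇒≤ (proj₂ (proj₂ close))) t≤s) s≤)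

        -- If t* + δ stays inside [0, 1], it satisfies `Away` and exceeds the supremum t*. Otherwise
        -- all of [0, 1] is covered, and v + ε is a lower bound above the infimum.
        everywhere : ∃[ ε ] 0# < ε × (∀ t → InUnit t → v + ε ≤ g t)
        everywhere with total 1# (t* + δ)
        ... | inj₁ 1≤ = ε , 0<ε , λ t (0≤t , t≤1) → beyond t 0≤t (≤-trans t≤1 1≤)
        ... | inj₂ ≤1 = contradiction
          (upper (t* + δ) ((≤-trans (proj₁ t*∈) (<⇒≤ t*<) , ≤1) , ε , 0<ε , beyond)) (<⇒≱ t*<)
          where
          t*< : t* < t* + δ
          t*< = <-by 0<δ (solve 2 (λ t d → (t :+ d) :- t := d) refl t* δ)

    Minimum : Set
    Minimum = ∃[ t ] InUnit t × (∀ s → InUnit s → g t ≤ g s)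

    minimum-at-infimum : ∀ v → (∀ t → InUnit t → v ≤ g t) → (∀ z → (∀ t → InUnit t → z ≤ g t) → z ≤ v) →
                         Dec (∃[ t ] InUnit t × g t ≤ v) → Minimum
    minimum-at-infimum v v≤ greatest (yes (t , t∈ , gt≤v)) = t , t∈ , λ s s∈ → ≤-trans gt≤v (v≤ s s∈)
    minimum-at-infimum v v≤ greatest (no ¬attained) = contradiction (proj₂ lub) (no-supremum v greatest v<g (proj₁ lub))
      where
      v<g : ∀ t → InUnit t → v < g t
      v<g t t∈ = ≰⇒> λ gt≤v → ¬attained (t , t∈ , gt≤v)

      lub : ∃ (IsLUB _≤_ (Away v greatest v<g))
      lub = complete (Away v greatest v<g) (0# , away-0 v greatest v<g) (1# , λ { t ((_ , t≤1) , _) → t≤1 })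

    minimum : Minimum
    minimum = minimum-at-infimum (proj₁ infimum) (proj₁ (proj₂ infimum)) (proj₂ (proj₂ infimum)) (em 0ℓ)

  InBox : ∀ {n} → (Fin n → Carrier) → Set
  InBox x = ∀ i → InUnit (x i)

  distance₁ : ∀ {n} → (Fin n → Carrier) → (Fin n → Carrier) → Carrier
  distance₁ x y = sum (λ i → ∣ x i - y i ∣)

  distance₁-refl : ∀ {n} (x : Fin n → Carrier) → distance₁ x x ≤ 0#
  distance₁-refl {n} x = ≤-respʳ (sum-replicate-zero n) (sum-mono λ i → ∣x∣≤0 (-‿inverseʳ (x i)))

  Lipschitz : ∀ {n} → Carrier → ((Fin n → Carrier) → Carrier) → Set
  Lipschitz L F = ∀ x y → F x ≤ F y + L * distance₁ x y

  BoxMinimum : ∀ {n} → ((Fin n → Carrier) → Carrier) → (Fin n → Carrier) → Set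
  BoxMinimum F x = InBox x × (∀ y → InBox y → F x ≤ F y)

  module _ {n} (F : (Fin (suc n) → Carrier) → Carrier) {L : Carrier} (0≤L : 0# ≤ L) (lip : Lipschitz L F) where

    lip-≤ : ∀ {x y d} → distance₁ x y ≤ d → F x ≤ F y + L * d
    lip-≤ {x} {y} dist≤d = ≤-trans (lip x y) (+-mono-≤ ≤-refl (*-monoˡ-≤ 0≤L dist≤d))

    slice-lipschitz : ∀ t → Lipschitz L (λ x → F (t ◂ x))
    slice-lipschitz t x y = lip-≤ (≤-respʳ (+-identityˡ _) (+-mono-≤ (∣x∣≤0 (-‿inverseʳ t)) ≤-refl))

    module _ (best : Carrier → Fin n → Carrier) (best-minimum : ∀ t → BoxMinimum (λ x → F (t ◂ x)) (best t)) where

      -- `best t` competes in the slice over s, and moving only the first coordinate from s to t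
      -- changes F by at most L times the distance.
      marginal-lipschitz : ∀ s t → F (s ◂ best s) ≤ F (t ◂ best t) + L * ∣ s - t ∣
      marginal-lipschitz s t = ≤-trans (proj₂ (best-minimum s) (best t) (proj₁ (best-minimum t)))
        (lip-≤ (≤-respʳ (+-identityʳ _) (+-mono-≤ ≤-refl (distance₁-refl (best t)))))

      extend-minimum : ∀ t → InUnit t → (∀ s → InUnit s → F (t ◂ best t) ≤ F (s ◂ best s)) → BoxMinimum F (t ◂ best t)
      extend-minimum t t∈ t-min = box , least
        where
        box : InBox (t ◂ best t)
        box fzero    = t∈
        box (fsuc i) = proj₁ (best-minimum t) i

        least : ∀ y → InBox y → F (t ◂ best t) ≤ F y
        least y y∈ = ≤-trans (t-min (y fzero) (y∈ fzero))
          (≤-trans (proj₂ (best-minimum (y fzero)) (tail y) (λ i → y∈ (fsuc i)))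
            (≤-respʳ (trans (+-congˡ (zeroʳ L)) (+-identityʳ _))
              (lip-≤ (≤-respʳ (+-identityˡ _) (+-mono-≤ (∣x∣≤0 (-‿inverseʳ (y fzero))) (distance₁-refl (tail y)))))))

      box-minimum-suc : ∃ (BoxMinimum F)
      box-minimum-suc = extend (minimum (λ t → F (t ◂ best t)) 0≤L marginal-lipschitz)
        where
        extend : (∃[ t ] InUnit t × (∀ s → InUnit s → F (t ◂ best t) ≤ F (s ◂ best s))) → ∃ (BoxMinimum F)
        extend (t , t∈ , t-min) = t ◂ best t , extend-minimum t t∈ t-min

  -- Induction on the dimension: the minima over the slices form a Lipschitz function of the first
  -- coordinate with the same constant, and the one-dimensional case minimises it.
  box-minimum : ∀ n (F : (Fin n → Carrier) → Carrier) {L} → 0# ≤ L → Lipschitz L F → ∃ (BoxMinimum F)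
  box-minimum zero    F {L} 0≤L lip = (λ ()) , (λ ()) , λ y _ →
    ≤-respʳ (trans (+-congˡ (zeroʳ L)) (+-identityʳ _)) (lip (λ ()) y)
  box-minimum (suc n) F 0≤L lip = box-minimum-suc F 0≤L lip (λ t → proj₁ (slice t)) (λ t → proj₂ (slice t))
    where
    slice : ∀ t → ∃ (BoxMinimum (λ x → F (t ◂ x)))
    slice t = box-minimum n (λ x → F (t ◂ x)) 0≤L (slice-lipschitz F 0≤L lip t)

-- Attainment of the minimum volume.

module MinimumVolume (em : ∀ ℓ → ExcludedMiddle ℓ) (ℝ : CompleteOrderedField) (G : Multiway.Instance ℝ 3) where
  open OrderedField ℝ
  open Clamp ℝ
  open LipschitzMinima em ℝ
  open import Data.Fin.Base using (_↑ˡ_; _↑ʳ_; splitAt)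
  open import Data.Fin.Properties using (splitAt-↑ˡ; splitAt-↑ʳ)
  open Instance G

  dist-triangle : ∀ (x y z : Point 3) → dist x z ≤ dist x y + dist y z
  dist-triangle x y z = ≤-respʳ (distribʳ (fromℕ 2 ⁻¹) _ _) (*-monoʳ-≤ (<⇒≤ (⁻¹-pos (fromℕ-pos 1)))
    (≤-respʳ (∑-distrib-+ (λ i → ∣ x i - y i ∣) (λ i → ∣ y i - z i ∣)) (sum-mono λ i →
      ≤-respˡ (∣x∣-cong (solve 3 (λ x y z → (x :- y) :+ (y :- z) := x :- z) refl (x i) (y i) (z i))) (∣x+y∣≤ (x i - y i) (y i - z i)))))

  dist-sym : ∀ (x y : Point 3) → dist x y ≈ dist y x
  dist-sym x y = *-congʳ (sum-cong-≋ {3} λ i → ∣x-y∣≈∣y-x∣ (x i) (y i))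

  dist-cong : ∀ {x x′ y y′ : Point 3} → x ≋ x′ → y ≋ y′ → dist x y ≈ dist x′ y′
  dist-cong x≋ y≋ = *-congʳ (sum-cong-≋ {3} λ i → ∣x∣-cong (+-cong (x≋ i) (-‿cong (y≋ i))))

  dist-self : ∀ (x : Point 3) → dist x x ≤ 0#
  dist-self x = ≤-respʳ (zeroˡ _) (*-monoʳ-≤ (<⇒≤ (⁻¹-pos (fromℕ-pos 1))) (distance₁-refl x))

  volume-cong : ∀ {f g : Fin nodes → Point 3} → (∀ v → f v ≋ g v) → volume f ≈ volume g
  volume-cong {f} {g} f≋g = sum-cong-≋ {edges} λ e → *-congˡ (dist-cong {f (end₁ e)} {g (end₁ e)} (f≋g (end₁ e)) (f≋g (end₂ e)))

  -- On [0, 1]² this is a Lipschitz retraction onto Δ, in the first two coordinates.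
  point : Carrier → Carrier → Point 3
  point a b 0F = a
  point a b 1F = (1# - a) ⊓ b
  point a b 2F = 1# - a - ((1# - a) ⊓ b)

  point∈Δ : ∀ {a b} → InUnit a → InUnit b → Δ (point a b)
  point∈Δ {a} {b} (0≤a , a≤1) (0≤b , _) =
      (λ { 0F → 0≤a ; 1F → ⊓-glb (x≤y⇒0≤y-x a≤1) 0≤b ; 2F → x≤y⇒0≤y-x (x⊓y≤x (1# - a) b) })
    , solve 2 (λ a m → a :+ (m :+ ((# 1 :- a :- m) :+ # 0)) := # 1) refl a ((1# - a) ⊓ b)

  Δ⇒point : ∀ {x : Point 3} → Δ x → x ≋ point (x 0F) (x 1F)
  Δ⇒point {x} (0≤x , Σx≈1) = λ { 0F → refl ; 1F → x₁≈ ; 2F → x₂≈ }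
    where
    1-x₀ : 1# - x 0F ≈ x 1F + x 2F
    1-x₀ = trans (+-congʳ (sym Σx≈1)) (solve 3 (λ x y z → (x :+ (y :+ (z :+ # 0))) :- x := y :+ z) refl (x 0F) (x 1F) (x 2F))
    x₁≈ : x 1F ≈ (1# - x 0F) ⊓ x 1F
    x₁≈ = ≤-antisym (⊓-glb (≤-respʳ (sym 1-x₀) (≤-respˡ (+-identityʳ _) (+-mono-≤ ≤-refl (0≤x 2F)))) ≤-refl) (x⊓y≤y _ _)
    x₂≈ : x 2F ≈ 1# - x 0F - ((1# - x 0F) ⊓ x 1F)
    x₂≈ = trans (solve 2 (λ y z → z := (y :+ z) :- y) refl (x 1F) (x 2F)) (+-cong (sym 1-x₀) (-‿cong x₁≈))

  ⊓-lipschitz : ∀ x y u v → x ⊓ y ≤ u ⊓ v + (∣ x - u ∣ + ∣ y - v ∣)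
  ⊓-lipschitz x y u v = ≤-by (x≤y⇒0≤y-x shifted) (solve 4 (λ p q i j → (q :+ (i :+ j)) :- p := q :- (p :- (i :+ j))) refl
      (x ⊓ y) (u ⊓ v) ∣ x - u ∣ ∣ y - v ∣)
    where
    shifted : x ⊓ y - (∣ x - u ∣ + ∣ y - v ∣) ≤ u ⊓ v
    shifted = ⊓-glb
      (≤-by (+-nonNeg (x≤y⇒0≤y-x (x⊓y≤x x y)) (+-nonNeg (x≤y⇒0≤y-x (x≤∣x∣ (x - u))) (∣x∣-nonNeg (y - v))))
        (solve 5 (λ m x u i j → u :- (m :- (i :+ j)) := (x :- m) :+ ((i :- (x :- u)) :+ j)) refl (x ⊓ y) x u ∣ x - u ∣ ∣ y - v ∣))
      (≤-by (+-nonNeg (x≤y⇒0≤y-x (x⊓y≤y x y)) (+-nonNeg (x≤y⇒0≤y-x (x≤∣x∣ (y - v))) (∣x∣-nonNeg (x - u))))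
        (solve 5 (λ m y v i j → v :- (m :- (i :+ j)) := (y :- m) :+ ((j :- (y :- v)) :+ i)) refl (x ⊓ y) y v ∣ x - u ∣ ∣ y - v ∣))

  ∣⊓-⊓∣≤ : ∀ x y u v → ∣ x ⊓ y - u ⊓ v ∣ ≤ ∣ x - u ∣ + ∣ y - v ∣
  ∣⊓-⊓∣≤ x y u v = ∣x∣≤
    (≤-by (x≤y⇒0≤y-x (⊓-lipschitz x y u v)) (solve 3 (λ p q d → d :- (p :- q) := (q :+ d) :- p) refl (x ⊓ y) (u ⊓ v) _))
    (≤-by (x≤y⇒0≤y-x (⊓-lipschitz u v x y)) (trans (+-congʳ (+-cong (∣x-y∣≈∣y-x∣ x u) (∣x-y∣≈∣y-x∣ y v)))
      (solve 3 (λ p q d → d :- :- (p :- q) := (p :+ d) :- q) refl (x ⊓ y) (u ⊓ v) _)))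

  -- The three coordinates move by at most s, 2s and 3s, and `dist` is half the sum.
  point-lipschitz : ∀ {a b a′ b′ s} → ∣ a - a′ ∣ ≤ s → ∣ b - b′ ∣ ≤ s → dist (point a b) (point a′ b′) ≤ fromℕ 3 * s
  point-lipschitz {a} {b} {a′} {b′} {s} ∣a∣≤s ∣b∣≤s = *-cancelˡ-≤ (fromℕ-pos 1) (≤-respˡ (sym (*-÷-cancel _ (pos⇒≉0 (fromℕ-pos 1)))) (≤-by
    (+-nonNeg (x≤y⇒0≤y-x ∣a∣≤s) (+-nonNeg (x≤y⇒0≤y-x mid≤) (x≤y⇒0≤y-x last≤)))
    (solve 4 (λ s x y z → # 2 :* (# 3 :* s) :- (x :+ (y :+ (z :+ # 0))) := (s :- x) :+ ((# 2 :* s :- y) :+ (# 3 :* s :- z))) refl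
      s (∣ a - a′ ∣) (∣ m - m′ ∣) (∣ 1# - a - m - (1# - a′ - m′) ∣))))
    where
    m = (1# - a) ⊓ b
    m′ = (1# - a′) ⊓ b′

    ∣1-a∣ : ∣ (1# - a) - (1# - a′) ∣ ≤ s
    ∣1-a∣ = ≤-respˡ (trans (∣x-y∣≈∣y-x∣ a a′) (∣x∣-cong (solve 2 (λ a b → b :- a := (# 1 :- a) :- (# 1 :- b)) refl a a′))) ∣a∣≤s

    mid≤ : ∣ m - m′ ∣ ≤ fromℕ 2 * s
    mid≤ = ≤-trans (∣⊓-⊓∣≤ (1# - a) b (1# - a′) b′) (≤-respʳ (solve 1 (λ s → s :+ s := # 2 :* s) refl s) (+-mono-≤ ∣1-a∣ ∣b∣≤s))

    last≤ : ∣ 1# - a - m - (1# - a′ - m′) ∣ ≤ fromℕ 3 * s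
    last≤ = ≤-respˡ (∣x∣-cong (solve 4 (λ a a′ m m′ → ((# 1 :- a) :- (# 1 :- a′)) :+ (m′ :- m) := # 1 :- a :- m :- (# 1 :- a′ :- m′)) refl a a′ m m′))
      (≤-trans (∣x+y∣≤ _ _) (≤-respʳ (solve 1 (λ s → s :+ # 2 :* s := # 3 :* s) refl s)
        (+-mono-≤ ∣1-a∣ (≤-respˡ (∣x-y∣≈∣y-x∣ m m′) mid≤))))

  Parameters : Set
  Parameters = Fin (nodes ℕ.+ nodes) → Carrier

  -- Terminals stay at their vertices whatever the parameters are. The decision is an argument, so
  -- that two placements of a node can be compared under the same answer.
  place : Parameters → (v : Fin nodes) → Dec (∃[ i ] terminal i ≡ v) → Point 3
  place x v (yes (i , _)) = vertex i
  place x v (no _)        = point (x (v ↑ˡ nodes)) (x (nodes ↑ʳ v))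

  embed : Parameters → Fin nodes → Point 3
  embed x v = place x v (em 0ℓ)

  vertex∈Δ : ∀ (i : Fin 3) → Δ (vertex i)
  vertex∈Δ i = nonNeg i , total-1 i
    where
    nonNeg : ∀ i j → 0# ≤ vertex {3} i j
    nonNeg i j with i ≟ j
    ... | yes _ = 0≤1
    ... | no _  = ≤-refl
    total-1 : ∀ i → sum (vertex {3} i) ≈ 1#
    total-1 0F = solve 0 (# 1 :+ (# 0 :+ (# 0 :+ # 0)) := # 1) refl
    total-1 1F = solve 0 (# 0 :+ (# 1 :+ (# 0 :+ # 0)) := # 1) refl
    total-1 2F = solve 0 (# 0 :+ (# 0 :+ (# 1 :+ # 0)) := # 1) refl

  embed-isEmbedding : ∀ {x} → InBox x → IsEmbedding (embed x)
  embed-isEmbedding {x} x∈ = (λ v → place∈Δ v (em 0ℓ)) , λ i → place-terminal i (em 0ℓ)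
    where
    place∈Δ : ∀ v d → Δ (place x v d)
    place∈Δ v (yes (i , _)) = vertex∈Δ i
    place∈Δ v (no _)        = point∈Δ (x∈ (v ↑ˡ nodes)) (x∈ (nodes ↑ʳ v))

    place-terminal : ∀ i d → place x (terminal i) d ≋ vertex i
    place-terminal i (yes (j , eq)) k = reflexive (≡.cong (λ i → vertex i k) (terminal-injective eq))
    place-terminal i (no ¬terminal)   = contradiction (i , ≡.refl) ¬terminal

  embed-lipschitz : ∀ x y v → dist (embed x v) (embed y v) ≤ fromℕ 3 * distance₁ x y
  embed-lipschitz x y v = go (em 0ℓ)
    where
    abs-nonNeg : ∀ i → 0# ≤ ∣ x i - y i ∣
    abs-nonNeg i = ∣x∣-nonNeg (x i - y i)
    go : ∀ d → dist (place x v d) (place y v d) ≤ fromℕ 3 * distance₁ x y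
    go (yes (i , _)) = ≤-trans (dist-self (vertex i)) (*-nonNeg (fromℕ-nonNeg 3) (sum-nonNeg abs-nonNeg))
    go (no _)        = point-lipschitz (term≤sum abs-nonNeg (v ↑ˡ nodes)) (term≤sum abs-nonNeg (nodes ↑ʳ v))

  total-cost : Carrier
  total-cost = sum cost

  -- Each end of an edge moves by at most 3 times the change of the parameters, which makes 6 for
  -- its length.
  volume-lipschitz : Lipschitz (total-cost * fromℕ 6) (λ x → volume (embed x))
  volume-lipschitz x y = ≤-respʳ (trans (∑-distrib-+ (λ e → cost e * dist (embed y (end₁ e)) (embed y (end₂ e))) _)
      (+-congˡ (trans (sum-cong-≋ λ e → solve 2 (λ c s → c :* (# 6 :* s) := (# 6 :* s) :* c) refl (cost e) (distance₁ x y))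
        (trans (sym (*-distribˡ-sum {edges} (fromℕ 6 * distance₁ x y) cost))
          (solve 2 (λ c s → (# 6 :* s) :* c := (c :* # 6) :* s) refl total-cost (distance₁ x y))))))
    (sum-mono λ e → ≤-respʳ (distribˡ (cost e) _ _) (*-monoˡ-≤ (cost-nonNeg e) (edge (end₁ e) (end₂ e))))
    where
    edge : ∀ u v → dist (embed x u) (embed x v) ≤ dist (embed y u) (embed y v) + fromℕ 6 * distance₁ x y
    edge u v = ≤-trans (dist-triangle (embed x u) (embed y u) (embed x v))
      (≤-trans (+-mono-≤ ≤-refl (dist-triangle (embed y u) (embed y v) (embed x v)))
        (≤-by (+-nonNeg (x≤y⇒0≤y-x (embed-lipschitz x y u)) (x≤y⇒0≤y-x (≤-respˡ (dist-sym (embed x v) (embed y v)) (embed-lipschitz x y v))))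
          (solve 4 (λ d i j s → (d :+ # 6 :* s) :- (i :+ (d :+ j)) := (# 3 :* s :- i) :+ (# 3 :* s :- j)) refl
            (dist (embed y u) (embed y v)) (dist (embed x u) (embed y u)) (dist (embed y v) (embed x v)) (distance₁ x y))))

  parameters : (Fin nodes → Point 3) → Parameters
  parameters f i with splitAt nodes i
  ... | inj₁ v = f v 0F
  ... | inj₂ v = f v 1F

  module _ {f : Fin nodes → Point 3} (f-embedding : IsEmbedding f) where

    in-unit : ∀ v i → InUnit (f v i)
    in-unit v i = proj₁ (proj₁ f-embedding v) i , ≤-respʳ (proj₂ (proj₁ f-embedding v)) (term≤sum (proj₁ (proj₁ f-embedding v)) i)

    parameters∈Box : InBox (parameters f)
    parameters∈Box i with splitAt nodes i
    ... | inj₁ v = in-unit v 0F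
    ... | inj₂ v = in-unit v 1F

    embed-parameters : ∀ v → embed (parameters f) v ≋ f v
    embed-parameters v = go (em 0ℓ)
      where
      go : ∀ d → place (parameters f) v d ≋ f v
      go (yes (i , ≡.refl)) j = sym (proj₂ f-embedding i j)
      go (no _) rewrite splitAt-↑ˡ nodes v nodes | splitAt-↑ʳ nodes nodes v = λ j → sym (Δ⇒point (proj₁ f-embedding v) j)

  -- Every embedding agrees with `embed` of its own first two coordinates, so a minimum over the box
  -- of parameters is one over all embeddings.
  minimum-volume : ∃ IsMinVolume
  minimum-volume = from-box (box-minimum _ (λ x → volume (embed x)) (*-nonNeg (sum-nonNeg cost-nonNeg) (fromℕ-nonNeg 6)) volume-lipschitz)
    where
    from-box : ∃ (BoxMinimum (λ x → volume (embed x))) → ∃ IsMinVolume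
    from-box (x , x∈ , least) = volume (embed x) , (embed x , embed-isEmbedding x∈ , refl) , λ f f-embedding →
      ≤-respʳ (volume-cong (embed-parameters f-embedding)) (least (parameters f) (parameters∈Box f-embedding))

-- Crossings of a segment with a cut of the simplex.

module Crossings (em : ∀ ℓ → ExcludedMiddle ℓ) (ℝ : CompleteOrderedField) where
  open OrderedField ℝ
  open Suprema em ℝ
  open Clamp ℝ
  open LipschitzMinima em ℝ using (InUnit; ⊓-pos)
  open import Data.List.Base using (concat; map; tabulate)
  open import Data.List.Relation.Unary.All as All using (All; []; _∷_)
  import Data.List.Relation.Unary.All.Properties as All
  open import Data.List.Relation.Unary.Any as Any using (Any; here; there)
  open import Function.Definitions using (Injective)

  -- The list of candidates may contain repetitions and points outside `P`. Splitting off its head,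
  -- when that satisfies `P`, and restricting `P` to the points different from it removes both.
  enumerate : ∀ (bs : List Carrier) (P : Carrier → Set) → (∀ {s t} → s ≈ t → P s → P t) → (∀ t → P t → Any (t ≈_) bs) →
    ∃[ n ] Σ (Fin n → Carrier) λ t → Injective _≡_ _≈_ t × (∀ i → P (t i)) × (∀ s → P s → ∃[ i ] s ≈ t i)
  enumerate []       P resp P⊆ = 0 , (λ ()) , (λ {}) , (λ ()) , λ s Ps → contradiction (P⊆ s Ps) λ ()
  enumerate (b ∷ bs) P resp P⊆ with em 0ℓ {P b} | enumerate bs (λ t → P t × ¬ t ≈ b)
      (λ s≈t (Ps , s≉b) → resp s≈t Ps , λ t≈b → s≉b (trans s≈t t≈b))
      (λ t (Pt , t≉b) → later t≉b (P⊆ t Pt))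
    where
    later : ∀ {t} → ¬ t ≈ b → Any (t ≈_) (b ∷ bs) → Any (t ≈_) bs
    later t≉b (here t≈b) = contradiction t≈b t≉b
    later t≉b (there p)  = p
  ... | no ¬Pb | n , t , inj , Pt , complete′ = n , t , inj , (λ i → proj₁ (Pt i)) ,
    λ s Ps → complete′ s (Ps , λ s≈b → ¬Pb (resp s≈b Ps))
  ... | yes Pb | n , t , inj , Pt , complete′ = suc n , t′ , inj′ , Pt′ , complete″
    where
    t′ : Fin (suc n) → Carrier
    t′ fzero    = b
    t′ (fsuc i) = t i

    inj′ : Injective _≡_ _≈_ t′
    inj′ {fzero}  {fzero}  _  = ≡.refl
    inj′ {fzero}  {fsuc j} eq = contradiction (sym eq) (proj₂ (Pt j))
    inj′ {fsuc i} {fzero}  eq = contradiction eq (proj₂ (Pt i))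
    inj′ {fsuc i} {fsuc j} eq = ≡.cong fsuc (inj eq)

    Pt′ : ∀ i → P (t′ i)
    Pt′ fzero    = Pb
    Pt′ (fsuc i) = proj₁ (Pt i)

    complete″ : ∀ s → P s → ∃[ i ] s ≈ t′ i
    complete″ s Ps with em 0ℓ {s ≈ b}
    ... | yes s≈b = fzero , s≈b
    ... | no s≉b  = let (i , eq) = complete′ s (Ps , s≉b) in fsuc i , eq

  OneSide : Carrier → Carrier → Carrier → Set
  OneSide b s t = (s < b × t < b) ⊎ (b < s × b < t)

  OneSide-sym : ∀ {b s t} → OneSide b s t → OneSide b t s
  OneSide-sym (inj₁ (p , q)) = inj₁ (q , p)
  OneSide-sym (inj₂ (p , q)) = inj₂ (q , p)

  gap : ∀ (bs : List Carrier) t → ¬ Any (t ≈_) bs →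
        ∃[ ε ] 0# < ε × (∀ s → ∣ s - t ∣ < ε → All (λ b → OneSide b s t) bs)
  gap []       t t∉ = 1# , 0<1 , λ _ _ → []
  gap (b ∷ bs) t t∉ with gap bs t (λ t∈ → t∉ (there t∈)) | total b t
  ... | ε , 0<ε , one-side | inj₁ b≤t = ε ⊓ (t - b) , ⊓-pos 0<ε (x<y⇒0<y-x b<t) , λ s ∣s-t∣< →
    inj₂ (<-by (x<y⇒0<y-x (proj₂ (∣x∣<⇒ (<-≤-trans ∣s-t∣< (x⊓y≤y ε (t - b))))))
           (solve 3 (λ s b t → s :- b := (t :- b) :- :- (s :- t)) refl s b t) , b<t)
    ∷ one-side s (<-≤-trans ∣s-t∣< (x⊓y≤x ε (t - b)))
    where
    b<t : b < t
    b<t = b≤t , λ b≈t → t∉ (here (sym b≈t))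
  ... | ε , 0<ε , one-side | inj₂ t≤b = ε ⊓ (b - t) , ⊓-pos 0<ε (x<y⇒0<y-x t<b) , λ s ∣s-t∣< →
    inj₁ (<-by (x<y⇒0<y-x (proj₁ (∣x∣<⇒ (<-≤-trans ∣s-t∣< (x⊓y≤y ε (b - t))))))
           (solve 3 (λ s b t → b :- s := (b :- t) :- (s :- t)) refl s b t) , t<b)
    ∷ one-side s (<-≤-trans ∣s-t∣< (x⊓y≤x ε (b - t)))
    where
    t<b : t < b
    t<b = t≤b , λ t≈b → t∉ (here t≈b)

  module _ {k : ℕ} where

    _·_ : Point k → Point k → Carrier
    a · x = sum (λ i → a i * x i)

    Satisfies-cong : ∀ {x y : Point k} (h : HalfSpace k) → HalfSpace.normal h · x ≈ HalfSpace.normal h · y → Satisfies x h → Satisfies y h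
    Satisfies-cong h eq sat with HalfSpace.strict h
    ... | true  = <-respʳ eq sat
    ... | false = ≤-respʳ eq sat

    Satisfies⇒≤ : ∀ {x : Point k} (h : HalfSpace k) → Satisfies x h → HalfSpace.offset h ≤ HalfSpace.normal h · x
    Satisfies⇒≤ h sat with HalfSpace.strict h
    ... | true  = <⇒≤ sat
    ... | false = sat

    <⇒Satisfies : ∀ {x : Point k} (h : HalfSpace k) → HalfSpace.offset h < HalfSpace.normal h · x → Satisfies x h
    <⇒Satisfies h lt with HalfSpace.strict h
    ... | true  = lt
    ... | false = <⇒≤ lt

    ∈ₚ-cong : ∀ {x y : Point k} → x ≋ y → ∀ {R} → x ∈ₚ R → y ∈ₚ R
    ∈ₚ-cong {x} {y} x≋y = Any.map (All.map λ {h} → Satisfies-cong {x} {y} h (sum-cong-≋ {k} λ i → *-congˡ (x≋y i)))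

  module OnSegment {k : ℕ} (C : SimplexCut k) (e : Segment k) where
    open SimplexCut C
    open Segment e

    at∈Δ : ∀ {t} → InUnit t → Δ (at t)
    at∈Δ {t} (0≤t , t≤1) = (λ i → ≤-respʳ (solve 3 (λ s e t → (# 1 :- t) :* s :+ t :* e := s :+ t :* (e :- s)) refl (start i) (end i) t)
        (+-nonNeg (*-nonNeg (x≤y⇒0≤y-x t≤1) (proj₁ start∈Δ i)) (*-nonNeg 0≤t (proj₁ end∈Δ i))))
      , trans (sum-cong-≋ {k} λ i → solve 3 (λ s e t → s :+ t :* (e :- s) := (# 1 :- t) :* s :+ t :* e) refl (start i) (end i) t)
        (trans (∑-distrib-+ {k} (λ i → (1# - t) * start i) (λ i → t * end i))
          (trans (+-cong (trans (sym (*-distribˡ-sum {k} (1# - t) start)) (*-congˡ (proj₂ start∈Δ)))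
                         (trans (sym (*-distribˡ-sum {k} t end)) (*-congˡ (proj₂ end∈Δ))))
            (solve 1 (λ t → (# 1 :- t) :* # 1 :+ t :* # 1 := # 1) refl t)))

    at-0 : at 0# ≋ start
    at-0 i = solve 2 (λ s e → s :+ # 0 :* (e :- s) := s) refl (start i) (end i)

    at-1 : at 1# ≋ end
    at-1 i = solve 2 (λ s e → s :+ # 1 :* (e :- s) := e) refl (start i) (end i)

    block-at : ∀ {t} → InUnit t → ∃[ b ] at t ∈ₚ block b
    block-at t∈ = let (b , at∈b , _) = partition (at _) (at∈Δ t∈) in b , at∈b

    block-unique : ∀ {t b b′} → InUnit t → at t ∈ₚ block b → at t ∈ₚ block b′ → b ≡ b′
    block-unique t∈ p q = let (_ , _ , unique) = partition (at _) (at∈Δ t∈) in ≡.trans (≡.sym (unique p)) (unique q)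

    -- The supremum of the parameters that lie in the first block is a crossing: there are points of
    -- that block arbitrarily close below or at it, and none beyond it.
    crossing-exists : ∀ {b₀ b₁} → start ∈ₚ block b₀ → end ∈ₚ block b₁ → b₀ ≢ b₁ → ∃ (IsCrossing C e)
    crossing-exists {b₀} {b₁} start∈ end∈ b₀≢b₁ = from-lub (complete InFirst (0# , first-0) (1# , λ { t ((_ , t≤1) , _) → t≤1 }))
      where
      InFirst : Carrier → Set
      InFirst t = InUnit t × at t ∈ₚ block b₀

      first-0 : InFirst 0#
      first-0 = (≤-refl , 0≤1) , ∈ₚ-cong (λ i → sym (at-0 i)) start∈

      from-lub : ∃ (IsLUB _≤_ InFirst) → ∃ (IsCrossing C e)
      from-lub (t , lub@(upper , least)) = t , t∈ , crosses
        where
        t∈ : InUnit t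
        t∈ = upper 0# first-0 , least 1# λ { s ((_ , s≤1) , _) → s≤1 }

        Crosses : Carrier → Set
        Crosses ε = ∃[ s ] ∃[ s′ ] ∃[ b ] ∃[ b′ ] InUnit s × InUnit s′ × ∣ s - t ∣ < ε × ∣ s′ - t ∣ < ε ×
          at s ∈ₚ block b × at s′ ∈ₚ block b′ × b ≢ b′

        crosses : ∀ ε → 0# < ε → Crosses ε
        crosses ε 0<ε = after (lub-approximable lub 0<ε) (total (t + half ε) 1#)
          where
          near : ∀ s → t ≤ s → s ≤ t + half ε → ∣ s - t ∣ < ε
          near s t≤s s≤ = ∣x∣<
            (≤-<-trans (≤-by (x≤y⇒0≤y-x s≤) (solve 3 (λ s t h → h :- (s :- t) := (t :+ h) :- s) refl s t (half ε))) (half-< 0<ε))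
            (≤-<-trans (≤-by (x≤y⇒0≤y-x t≤s) (solve 2 (λ s t → # 0 :- :- (s :- t) := s :- t) refl s t)) 0<ε)

          t≤t+h : t < t + half ε
          t≤t+h = <-by (half-pos 0<ε) (solve 2 (λ t h → (t :+ h) :- t := h) refl t (half ε))

          before : ∀ s → InFirst s → t - ε < s → ∣ s - t ∣ < ε
          before s s∈ t-ε<s = ∣x∣<
            (≤-<-trans (≤-by (x≤y⇒0≤y-x (upper s s∈)) (solve 2 (λ s t → # 0 :- (s :- t) := t :- s) refl s t)) 0<ε)
            (<-by (x<y⇒0<y-x t-ε<s) (solve 3 (λ s t e → e :- :- (s :- t) := s :- (t :- e)) refl s t ε))

          after : (∃[ s ] InFirst s × t - ε < s) → t + half ε ≤ 1# ⊎ 1# ≤ t + half ε → Crosses ε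
          after (s , s∈ , t-ε<s) (inj₁ ≤1) = s , t + half ε , b₀ , proj₁ found , proj₁ s∈ , s′∈ , before s s∈ t-ε<s ,
              near (t + half ε) (<⇒≤ t≤t+h) ≤-refl , proj₂ s∈ , proj₂ found ,
              λ b₀≡b → <⇒≱ t≤t+h (upper (t + half ε) (s′∈ , ≡.subst (λ b → at (t + half ε) ∈ₚ block b) (≡.sym b₀≡b) (proj₂ found)))
            where
            s′∈ : InUnit (t + half ε)
            s′∈ = ≤-trans (proj₁ t∈) (<⇒≤ t≤t+h) , ≤1
            found : ∃[ b ] at (t + half ε) ∈ₚ block b
            found = block-at s′∈
          -- When there is no room for t + ε/2 inside the segment, its end serves as the point in
          -- another block.
          after (s , s∈ , t-ε<s) (inj₂ 1≤) = s , 1# , b₀ , b₁ , proj₁ s∈ , (0≤1 , ≤-refl) , before s s∈ t-ε<s ,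
            near 1# (proj₂ t∈) 1≤ , proj₂ s∈ , ∈ₚ-cong (λ i → sym (at-1 i)) end∈ , b₀≢b₁

    module _ (h : HalfSpace k) where
      open HalfSpace h

      slope : Carrier
      slope = normal · (λ i → end i - start i)

      -- The parameter where the segment meets the bounding hyperplane. For slope 0 the value is
      -- arbitrary; membership in the half-space is then constant along the segment.
      breakpoint : Carrier
      breakpoint = (offset - normal · start) ÷ slope

      ·-at : ∀ t → normal · at t ≈ normal · start + t * slope
      ·-at t = trans (sum-cong-≋ {k} λ i → solve 4 (λ n s e t → n :* (s :+ t :* (e :- s)) := n :* s :+ t :* (n :* (e :- s))) refl (normal i) (start i) (end i) t)
        (trans (∑-distrib-+ {k} (λ i → normal i * start i) (λ i → t * (normal i * (end i - start i))))
          (+-congˡ (sym (*-distribˡ-sum {k} t (λ i → normal i * (end i - start i))))))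

      -- Strictly on one side of the breakpoint the linear form minus its offset has constant
      -- nonzero sign when the slope is not 0. A weak inequality at s thus becomes strict at t,
      -- which covers open and closed half-spaces alike.
      Satisfies-transfer : ∀ {s t} → OneSide breakpoint s t → Satisfies (at s) h → Satisfies (at t) h
      Satisfies-transfer {s} {t} side sat with em 0ℓ {slope ≈ 0#}
      ... | yes slope≈0 = Satisfies-cong {x = at s} {y = at t} h (trans (flat s) (sym (flat t))) sat
        where
        flat : ∀ t → normal · at t ≈ normal · start
        flat t = trans (·-at t) (trans (+-congˡ (trans (*-congˡ slope≈0) (zeroʳ t))) (+-identityʳ _))
      ... | no slope≉0 = <⇒Satisfies {x = at t} h (0<y-x⇒x<y (<-respʳ (sym (relative t)) (positive side (≤-respʳ (relative s) (x≤y⇒0≤y-x (Satisfies⇒≤ {x = at s} h sat))))))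
        where
        b = breakpoint
        relative : ∀ t → normal · at t - offset ≈ (t - b) * slope
        relative t = trans (+-congʳ (·-at t)) (trans
          (solve 4 (λ a t m o → (a :+ t :* m) :- o := t :* m :- (o :- a)) refl (normal · start) t slope offset)
          (trans (+-congˡ (-‿cong (sym (÷-*-cancel _ slope≉0)))) (solve 3 (λ t m b → t :* m :- b :* m := (t :- b) :* m) refl t slope b)))

        0≉slope : ¬ 0# ≈ slope
        0≉slope eq = slope≉0 (sym eq)

        positive : OneSide b s t → 0# ≤ (s - b) * slope → 0# < (t - b) * slope
        positive (inj₂ (b<s , b<t)) 0≤ = *-pos (x<y⇒0<y-x b<t)
          (*-cancelˡ-≤ (x<y⇒0<y-x b<s) (≤-respˡ (sym (zeroʳ _)) 0≤) , 0≉slope)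
        positive (inj₁ (s<b , t<b)) 0≤ = <-respʳ (solve 3 (λ t m b → (b :- t) :* (:- m) := (t :- b) :* m) refl t slope b)
          (*-pos (x<y⇒0<y-x t<b) (*-cancelˡ-≤ (x<y⇒0<y-x s<b)
              (≤-respˡ (sym (zeroʳ _)) (≤-respʳ (solve 3 (λ s m b → (s :- b) :* m := (b :- s) :* (:- m)) refl s slope b) 0≤))
            , λ 0≈-m → 0≉slope (trans (solve 0 (# 0 := :- # 0) refl) (trans (-‿cong 0≈-m) (solve 1 (λ m → :- (:- m) := m) refl slope)))))

    breakpoints : Polytope k → List Carrier
    breakpoints = concatMap (map breakpoint)

    ∈ₚ-transfer : ∀ {s t} R → All (λ b → OneSide b s t) (breakpoints R) → at s ∈ₚ R → at t ∈ₚ R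
    ∈ₚ-transfer {s} {t} (H ∷ R) sides (here sat) = here (all H (All.++⁻ˡ (map breakpoint H) sides) sat)
      where
      all : ∀ H → All (λ b → OneSide b s t) (map breakpoint H) → All (Satisfies (at s)) H → All (Satisfies (at t)) H
      all []      []             []           = []
      all (h ∷ H) (side ∷ sides) (sat ∷ sats) = Satisfies-transfer h {s} {t} side sat ∷ all H sides sats
    ∈ₚ-transfer (H ∷ R) sides (there sat) = there (∈ₚ-transfer R (All.++⁻ʳ (map breakpoint H) sides) sat)

    all-breakpoints : List Carrier
    all-breakpoints = concat (tabulate (λ b → breakpoints (block b)))

    -- A neighbourhood of t that avoids all breakpoints lies in the block of t: by transfer, points
    -- from two blocks near t would put t itself into both.
    crossing⇒breakpoint : ∀ t → IsCrossing C e t → Any (t ≈_) all-breakpoints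
    crossing⇒breakpoint t (t∈ , crosses) with em 0ℓ {Any (t ≈_) all-breakpoints}
    ... | yes found = found
    ... | no ¬found with gap all-breakpoints t ¬found
    ...   | ε , 0<ε , one-side with crosses ε 0<ε
    ...     | s , s′ , b , b′ , _ , _ , ∣s-t∣< , ∣s′-t∣< , s∈b , s′∈b′ , b≢b′ =
      contradiction (block-unique t∈ (transfer b s ∣s-t∣< s∈b) (transfer b′ s′ ∣s′-t∣< s′∈b′)) b≢b′
      where
      transfer : ∀ b s → ∣ s - t ∣ < ε → at s ∈ₚ block b → at t ∈ₚ block b
      transfer b s ∣s-t∣< = ∈ₚ-transfer (block b) (All.tabulate⁻ (All.concat⁻ (one-side s ∣s-t∣<)) b)

    IsCrossing-cong : ∀ {s t} → s ≈ t → IsCrossing C e s → IsCrossing C e t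
    IsCrossing-cong {s} {t} s≈t ((0≤s , s≤1) , crosses) = (≤-respʳ s≈t 0≤s , ≤-respˡ s≈t s≤1) , λ ε 0<ε →
      let (r , r′ , b , b′ , r∈ , r′∈ , r< , r′< , rest) = crosses ε 0<ε in
      r , r′ , b , b′ , r∈ , r′∈ , moved r< , moved r′< , rest
      where
      moved : ∀ {r ε} → ∣ r - s ∣ < ε → ∣ r - t ∣ < ε
      moved = <-respˡ (∣x∣-cong (+-congˡ (-‿cong s≈t)))

    crossings-finite : ∃ (HasCrossings C e)
    crossings-finite = enumerate all-breakpoints (IsCrossing C e) IsCrossing-cong crossing⇒breakpoint

    no-crossings : HasCrossings C e 0 → ¬ ∃ (IsCrossing C e)
    no-crossings (_ , _ , _ , complete′) (t , t-crossing) with complete′ t t-crossing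
    ... | () , _

    crossing-number-unique : ∀ {m n} → HasCrossings C e m → HasCrossings C e n → m ≡ n
    crossing-number-unique p q = ℕ.≤-antisym (at-most p q) (at-most q p)
      where
      open import Data.Fin.Properties using (injective⇒≤)
      at-most : ∀ {m n} → HasCrossings C e m → HasCrossings C e n → m ℕ.≤ n
      at-most (t , t-inj , t-crossing , _) (u , _ , _ , u-complete) =
        injective⇒≤ {f = λ i → proj₁ (u-complete (t i) (t-crossing i))} λ {i} {j} eq →
          t-inj (trans (proj₂ (u-complete (t i) (t-crossing i)))
            (trans (reflexive (≡.cong u eq)) (sym (proj₂ (u-complete (t j) (t-crossing j))))))

-- Values of series in the extended reals.

module ExtendedReals (em : ∀ ℓ → ExcludedMiddle ℓ) (ℝ : CompleteOrderedField) where
  open OrderedField ℝ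
  open import Relation.Binary.Construct.Add.Supremum.NonStrict _≤_ using ([_]; _≤⊤⁺)

  [≤]⁻¹ : ∀ {x y} → [ x ] ≤∞ [ y ] → x ≤ y
  [≤]⁻¹ [ x≤y ] = x≤y

  series-sum : ∀ f → ∃ (IsSeriesSum f)
  series-sum f = decide (em 0ℓ)
    where
    partial : ℕ → Carrier
    partial N = sum {N} (λ i → f (toℕ i))

    Bounded : Set
    Bounded = ∃[ b ] (∀ N → partial N ≤ b)

    Partial : Carrier → Set
    Partial x = ∃[ N ] x ≈ partial N

    from-lub : ∃ (IsLUB _≤_ Partial) → ∃ (IsSeriesSum f)
    from-lub (x , upper , least) = [ x ] , (λ { _ (N , ≡.refl) → [ upper (partial N) (N , refl) ] }) , below
      where
      below : ∀ z → (∀ y → (∃[ N ] y ≡ [ partial N ]) → y ≤∞ z) → [ x ] ≤∞ z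
      below ⊤⁺    _   = _ ≤⊤⁺
      below [ z ] y≤z = [ least z (λ { y (N , y≈) → ≤-respˡ (sym y≈) ([≤]⁻¹ (y≤z [ partial N ] (N , ≡.refl))) }) ]

    decide : Dec Bounded → ∃ (IsSeriesSum f)
    decide (yes (b , ≤b)) = from-lub (complete Partial (partial 0 , 0 , refl) (b , λ { y (N , y≈) → ≤-respˡ (sym y≈) (≤b N) }))
    decide (no unbounded) = ⊤⁺ , (λ y _ → _ ≤⊤⁺) , λ
      { ⊤⁺ _ → _ ≤⊤⁺
      ; [ z ] y≤z → contradiction (z , λ N → [≤]⁻¹ (y≤z [ partial N ] (N , ≡.refl))) unbounded }

-- Finite additivity and averaging over events.

module Probability (em : ∀ ℓ → ExcludedMiddle ℓ) (ℝ : CompleteOrderedField) {A : Set}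
                   (P : Multiway.ProbabilityMeasure ℝ A) where
  open OrderedField ℝ
  open ExtendedReals em ℝ
  open ProbabilityMeasure P
  open import Relation.Unary using (Pred; U; ∁; _∩_; _∪_; _≐_; _⊥_)
  open import Relation.Binary.Construct.Add.Supremum.NonStrict _≤_ using ([_])

  ⊘ : Pred A 0ℓ
  ⊘ = ∁ U

  ⊘-meas : Measurable ⊘
  ⊘-meas = ∁-meas U-meas

  -- Countably many copies of the empty set are disjoint with empty union, and already two of them
  -- force 2 μ ≤ μ.
  μ-⊘ : μ ⊘ ≈ 0#
  μ-⊘ = ≤-antisym (≤-by (x≤y⇒0≤y-x (≤-respʳ ⋃≈ twice)) (solve 1 (λ m → # 0 :- m := m :- (m :+ (m :+ # 0))) refl (μ ⊘))) (μ-nonNeg ⊘-meas)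
    where
    E : ℕ → Pred A 0ℓ
    E _ = ⊘
    ⋃≈ : μ (λ a → Σ ℕ λ n → E n a) ≈ μ ⊘
    ⋃≈ = μ-cong (proj₂ , (0 ,_)) (⋃-meas E (λ _ → ⊘-meas))
    twice : μ ⊘ + (μ ⊘ + 0#) ≤ μ (λ a → Σ ℕ λ n → E n a)
    twice = [≤]⁻¹ (proj₁ (μ-⋃ E (λ _ → ⊘-meas) (λ m n _ (x , _) → x tt)) [ μ ⊘ + (μ ⊘ + 0#) ] (2 , ≡.refl))

  module _ {E F : Pred A 0ℓ} (E-meas : Measurable E) (F-meas : Measurable F) where

    private
      pair : ℕ → Pred A 0ℓ
      pair 0             = E
      pair 1             = F
      pair (suc (suc _)) = ⊘

      pair-meas : ∀ n → Measurable (pair n)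
      pair-meas 0             = E-meas
      pair-meas 1             = F-meas
      pair-meas (suc (suc _)) = ⊘-meas

      ⋃-pair : (λ a → Σ ℕ λ n → pair n a) ≐ (E ∪ F)
      ⋃-pair = (λ { (0 , x) → inj₁ x ; (1 , x) → inj₂ x ; (suc (suc _) , x) → ⊥-elim (x tt) })
             , λ { (inj₁ x) → 0 , x ; (inj₂ x) → 1 , x }

    ∪-meas : Measurable (E ∪ F)
    ∪-meas = resp-≐ ⋃-pair (⋃-meas pair pair-meas)

    μ-∪ : E ⊥ F → μ (E ∪ F) ≈ μ E + μ F
    μ-∪ E⊥F = trans (sym (μ-cong ⋃-pair (⋃-meas pair pair-meas))) (≤-antisym
        ([≤]⁻¹ (proj₂ series [ μ E + μ F ] λ { _ (N , ≡.refl) → [ partial≤ N ] }))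
        (≤-respˡ (+-congˡ (+-identityʳ _)) ([≤]⁻¹ (proj₁ series [ μ E + (μ F + 0#) ] (2 , ≡.refl)))))
      where
      disjoint : ∀ m n → m ≢ n → pair m ⊥ pair n
      disjoint 0 0 m≢n _ = m≢n ≡.refl
      disjoint 0 1 _ (x , y) = E⊥F (x , y)
      disjoint 1 0 _ (x , y) = E⊥F (y , x)
      disjoint 1 1 m≢n _ = m≢n ≡.refl
      disjoint (suc (suc _)) _ _ (x , _) = x tt
      disjoint 0 (suc (suc _)) _ (_ , y) = y tt
      disjoint 1 (suc (suc _)) _ (_ , y) = y tt

      series = μ-⋃ pair pair-meas disjoint

      rest≤0 : ∀ N → sum {N} (λ i → μ (pair (suc (suc (toℕ i))))) ≤ 0#
      rest≤0 N = ≤-respʳ (sum-replicate-zero N) (sum-mono {N} λ _ → ≤-reflexive μ-⊘)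

      partial≤ : ∀ N → sum {N} (λ i → μ (pair (toℕ i))) ≤ μ E + μ F
      partial≤ 0             = +-nonNeg (μ-nonNeg E-meas) (μ-nonNeg F-meas)
      partial≤ 1             = +-mono-≤ ≤-refl (μ-nonNeg F-meas)
      partial≤ (suc (suc N)) = +-mono-≤ ≤-refl (≤-respʳ (+-identityʳ _) (+-mono-≤ ≤-refl (rest≤0 N)))

  ∩-meas : ∀ {E F} → Measurable E → Measurable F → Measurable (E ∩ F)
  ∩-meas {E} {F} E-meas F-meas = resp-≐ de-morgan (∁-meas (∪-meas (∁-meas E-meas) (∁-meas F-meas)))
    where
    de-morgan : ∁ (∁ E ∪ ∁ F) ≐ (E ∩ F)
    de-morgan = (λ {ω} ¬∪ → stable (λ ¬E → ¬∪ (inj₁ ¬E)) , stable (λ ¬F → ¬∪ (inj₂ ¬F)))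
              , λ { (x , y) (inj₁ ¬x) → ¬x x ; (x , y) (inj₂ ¬y) → ¬y y }
      where
      stable : ∀ {Q : Set} → ¬ ¬ Q → Q
      stable {Q} ¬¬q with em 0ℓ {Q}
      ... | yes q = q
      ... | no ¬q = contradiction ¬q ¬¬q

  μ-split : ∀ {B E} → Measurable B → Measurable E → μ B ≈ μ (B ∩ E) + μ (B ∩ ∁ E)
  μ-split {B} {E} B-meas E-meas = trans (μ-cong ((λ {ω} x → either x (em 0ℓ {E ω})) , λ { (inj₁ (x , _)) → x ; (inj₂ (x , _)) → x }) B-meas)
    (μ-∪ (∩-meas B-meas E-meas) (∩-meas B-meas (∁-meas E-meas)) λ { ((_ , x) , (_ , ¬x)) → ¬x x })
    where
    either : ∀ {ω} → B ω → Dec (E ω) → ((B ∩ E) ∪ (B ∩ ∁ E)) ω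
    either x (yes y) = inj₁ (x , y)
    either x (no ¬y) = inj₂ (x , ¬y)

  indicator : Carrier → (E : Pred A 0ℓ) → A → Carrier
  indicator c E ω = if does (em 0ℓ {E ω}) then c else 0#

  -- The expectation of a finite combination of indicators, without an integral. B is split along
  -- the first event; inside it κ becomes κ - c, outside it κ stays. When no event is left, κ ≤ 0 if
  -- B has a point, and otherwise B has measure 0.
  weighted-events : ∀ n (c : Fin n → Carrier) (E : Fin n → Pred A 0ℓ) → (∀ i → Measurable (E i)) →
    ∀ {B κ} → Measurable B → (∀ ω → B ω → κ ≤ sum (λ i → indicator (c i) (E i) ω)) →
    κ * μ B ≤ sum (λ i → c i * μ (E i ∩ B))
  weighted-events zero c E E-meas {B} {κ} B-meas bound with em 0ℓ {∃ B}
  ... | yes (ω , ω∈B) = ≤-respʳ (zeroˡ _) (*-monoʳ-≤ (μ-nonNeg B-meas) (bound ω ω∈B))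
  ... | no empty = ≤-reflexive (trans (*-congˡ (trans (μ-cong ((λ {ω} x → contradiction (ω , x) empty) , λ x → ⊥-elim (x tt)) B-meas) μ-⊘)) (zeroʳ κ))
  weighted-events (suc n) c E E-meas {B} {κ} B-meas bound = ≤-by
      (+-nonNeg (x≤y⇒0≤y-x inside) (x≤y⇒0≤y-x outside))
      (trans (+-cong (+-cong (*-congˡ (μ-cong ((λ (x , y) → y , x) , λ (y , x) → x , y) (∩-meas (E-meas fzero) B-meas)))
               (trans (sum-cong-≋ {n} split) (∑-distrib-+ (λ i → c (fsuc i) * μ (E (fsuc i) ∩ B₁)) (λ i → c (fsuc i) * μ (E (fsuc i) ∩ B₂)))))
             (-‿cong (*-congˡ (μ-split B-meas (E-meas fzero)))))
        (solve 6 (λ κ c m₁ m₂ s₁ s₂ → (c :* m₁ :+ (s₁ :+ s₂)) :- κ :* (m₁ :+ m₂) := (s₁ :- (κ :- c) :* m₁) :+ (s₂ :- κ :* m₂)) refl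
          κ (c fzero) (μ B₁) (μ B₂) _ _))
    where
    B₁ B₂ : Pred A 0ℓ
    B₁ = B ∩ E fzero
    B₂ = B ∩ ∁ (E fzero)
    B₁-meas = ∩-meas B-meas (E-meas fzero)
    B₂-meas = ∩-meas B-meas (∁-meas (E-meas fzero))

    split : ∀ i → c (fsuc i) * μ (E (fsuc i) ∩ B) ≈ c (fsuc i) * μ (E (fsuc i) ∩ B₁) + c (fsuc i) * μ (E (fsuc i) ∩ B₂)
    split i = trans (*-congˡ (trans (μ-split (∩-meas (E-meas (fsuc i)) B-meas) (E-meas fzero))
        (+-cong (μ-cong ((λ ((x , y) , z) → x , (y , z)) , λ (x , (y , z)) → (x , y) , z) (∩-meas (∩-meas (E-meas (fsuc i)) B-meas) (E-meas fzero)))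
                (μ-cong ((λ ((x , y) , z) → x , (y , z)) , λ (x , (y , z)) → (x , y) , z) (∩-meas (∩-meas (E-meas (fsuc i)) B-meas) (∁-meas (E-meas fzero)))))))
      (distribˡ (c (fsuc i)) _ _)

    rest : A → Carrier
    rest ω = sum (λ i → indicator (c (fsuc i)) (E (fsuc i)) ω)

    inside : (κ - c fzero) * μ B₁ ≤ sum (λ i → c (fsuc i) * μ (E (fsuc i) ∩ B₁))
    inside = weighted-events n (λ i → c (fsuc i)) (λ i → E (fsuc i)) (λ i → E-meas (fsuc i)) B₁-meas λ ω (ω∈B , ω∈E) →
      ≤-by (x≤y⇒0≤y-x (≤-respʳ (+-congʳ (reflexive (≡.cong (if_then c fzero else 0#) (dec-true (em 0ℓ {E fzero ω}) ω∈E)))) (bound ω ω∈B)))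
        (solve 3 (λ r κ c → r :- (κ :- c) := (c :+ r) :- κ) refl (rest ω) κ (c fzero))

    outside : κ * μ B₂ ≤ sum (λ i → c (fsuc i) * μ (E (fsuc i) ∩ B₂))
    outside = weighted-events n (λ i → c (fsuc i)) (λ i → E (fsuc i)) (λ i → E-meas (fsuc i)) B₂-meas λ ω (ω∈B , ω∉E) →
      ≤-respʳ (trans (+-congʳ (reflexive (≡.cong (if_then c fzero else 0#) (dec-false (em 0ℓ {E fzero ω}) ω∉E)))) (+-identityˡ _)) (bound ω ω∈B)

  weighted-events-U : ∀ n (c : Fin n → Carrier) (E : Fin n → Pred A 0ℓ) → (∀ i → Measurable (E i)) →
    ∀ {κ} → (∀ ω → κ ≤ sum (λ i → indicator (c i) (E i) ω)) → κ ≤ sum (λ i → c i * μ (E i))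
  weighted-events-U n c E E-meas {κ} bound = ≤-respˡ (trans (*-congˡ μ-U) (*-identityʳ κ))
    (≤-respʳ (sum-cong-≋ {n} λ i → *-congˡ (μ-cong (proj₁ , (_, tt)) (∩-meas (E-meas i) U-meas)))
      (weighted-events n c E E-meas U-meas λ ω _ → bound ω))

  μ-∁ : ∀ {E} → Measurable E → μ E + μ (∁ E) ≈ 1#
  μ-∁ {E} E-meas = trans (+-cong (μ-cong ((λ x → tt , x) , proj₂) E-meas) (μ-cong ((λ x → tt , x) , proj₂) (∁-meas E-meas)))
    (trans (sym (μ-split U-meas E-meas)) μ-U)

-- Averaging an instance over a cutting scheme.

module SchemeBound (em : ∀ ℓ → ExcludedMiddle ℓ) (ℝ : CompleteOrderedField) {k : ℕ}
                   (P : Multiway.CuttingScheme ℝ k) where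
  open OrderedField ℝ
  open Cuts em ℝ
  open Crossings em ℝ
  open ExtendedReals em ℝ
  open CuttingScheme P
  open Probability em ℝ probability
  open import Relation.Unary using (Pred; ∁)
  open import Relation.Binary.Construct.Add.Supremum.NonStrict _≤_ using ([_]; _≤⊤⁺)

  exactly : Segment k → ℕ → Pred (SimplexCut k) 0ℓ
  exactly e n C = HasCrossings C e n

  expected-term : Segment k → ℕ → Carrier
  expected-term e n = fromℕ n * μ (exactly e n)

  -- `IsMaximumDensity` bounds the numbers that are densities of some segment; to be applied to e it
  -- has to be given one for e.
  density-exists : ∀ e → ∃ (IsSegmentDensity P e)
  density-exists e = rescale (series-sum (expected-term e))
    where
    len = Segment.length e
    rescale : ∃ (IsSeriesSum (expected-term e)) → ∃ (IsSegmentDensity P e)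
    rescale (⊤⁺ , is-sum) = ⊤⁺ , is-sum
    rescale ([ x ] , upper , least) = [ x ÷ len ]
      , (λ y y∈ → ≤∞-respʳ x≈ (upper y y∈))
      , (λ z z≥ → ≤∞-respˡ x≈ (least z z≥))
      where
      x≈ : x ≈ x ÷ len * len
      x≈ = sym (÷-*-cancel x (pos⇒≉0 (Segment.nondegenerate e)))
      ≤∞-respʳ : ∀ {a b y} → a ≈ b → y ≤∞ [ a ] → y ≤∞ [ b ]
      ≤∞-respʳ a≈b [ y≤a ] = [ ≤-respʳ a≈b y≤a ]
      ≤∞-respˡ : ∀ {a b y} → a ≈ b → [ a ] ≤∞ y → [ b ] ≤∞ y
      ≤∞-respˡ a≈b [ a≤y ]   = [ ≤-respˡ a≈b a≤y ]
      ≤∞-respˡ a≈b (_ ≤⊤⁺) = _ ≤⊤⁺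

  module _ {τ : Carrier} (τ-max : IsMaximumDensity P [ τ ]) where

    expected-crossings≤ : ∀ e N → sum {N} (λ i → expected-term e (toℕ i)) ≤ τ * Segment.length e
    expected-crossings≤ e N = from-density (density-exists e)
      where
      from-density : ∃ (IsSegmentDensity P e) → sum {N} (λ i → expected-term e (toℕ i)) ≤ τ * Segment.length e
      from-density (d , is-density) with proj₁ τ-max d (e , is-density) | is-density
      ... | [ d≤τ ] | upper , _ = ≤-trans ([≤]⁻¹ (upper _ (N , ≡.refl))) (*-monoʳ-≤ (<⇒≤ (Segment.nondegenerate e)) d≤τ)

    -- Markov's inequality: n is at least 1 in every term of the expectation but the first. As
    -- crossing numbers are finite, the events `exactly e n` exhaust the space.
    crossed-probability≤ : ∀ e → μ (∁ (exactly e 0)) ≤ τ * Segment.length e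
    crossed-probability≤ e = ≤-by (x≤y⇒0≤y-x one≤)
        (trans (solve 3 (λ t h c → t :- c := (h :+ t) :- (h :+ c)) refl (τ * Segment.length e) (μ (exactly e 0)) (μ (∁ (exactly e 0))))
          (+-congˡ (-‿cong (μ-∁ (crossings-meas e 0)))))
      where
      t = τ * Segment.length e
      disjoint : ∀ m n → m ≢ n → ∀ {C} → ¬ (exactly e m C × exactly e n C)
      disjoint m n m≢n {C} (p , q) = m≢n (OnSegment.crossing-number-unique C e p q)

      tail≤ : ∀ N → sum {N} (λ i → μ (exactly e (suc (toℕ i)))) ≤ t
      tail≤ N = ≤-trans (≤-trans (sum-mono {N} λ i → ≤-by (*-nonNeg (fromℕ-nonNeg (toℕ i)) (μ-nonNeg (crossings-meas e (suc (toℕ i)))))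
            (solve 2 (λ n m → (# 1 :+ n) :* m :- m := n :* m) refl (fromℕ (toℕ i)) (μ (exactly e (suc (toℕ i))))))
          (≤-reflexive (sym (trans (+-congʳ (zeroˡ _)) (+-identityˡ _)))))
        (expected-crossings≤ e (suc N))

      partial≤ : ∀ N → sum {N} (λ i → μ (exactly e (toℕ i))) ≤ μ (exactly e 0) + t
      partial≤ zero    = +-nonNeg (μ-nonNeg (crossings-meas e 0)) (expected-crossings≤ e 0)
      partial≤ (suc N) = +-mono-≤ ≤-refl (tail≤ N)

      one≤ : 1# ≤ μ (exactly e 0) + t
      one≤ = ≤-respˡ (trans (μ-cong ((λ _ → tt) , λ {C} _ → OnSegment.crossings-finite C e) (⋃-meas (exactly e) (crossings-meas e))) μ-U)
        ([≤]⁻¹ (proj₂ (μ-⋃ (exactly e) (crossings-meas e) disjoint) [ μ (exactly e 0) + t ] λ { _ (N , ≡.refl) → [ partial≤ N ] }))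

    module _ (G : Instance k) {f : Fin (Instance.nodes G) → Point k} (f-embedding : Instance.IsEmbedding G f) where
      open Instance G

      label : SimplexCut k → Fin nodes → Fin k
      label C v = proj₁ (SimplexCut.partition C (f v) (proj₁ f-embedding v))

      label-block : ∀ C v → f v ∈ₚ SimplexCut.block C (label C v)
      label-block C v = proj₁ (proj₂ (SimplexCut.partition C (f v) (proj₁ f-embedding v)))

      label-separates : ∀ C i j → i ≢ j → label C (terminal i) ≢ label C (terminal j)
      label-separates C i j i≢j eq = i≢j (≡.trans (≡.sym (unique (vertex∈ i)))
          (unique (≡.subst (λ b → vertex j ∈ₚ block b) (≡.sym eq) (vertex∈ j))))
        where
        open SimplexCut C
        vertex∈ : ∀ i → vertex i ∈ₚ block (label C (terminal i))
        vertex∈ i = ∈ₚ-cong (proj₂ f-embedding i) (label-block C (terminal i))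
        unique : ∀ {l} → vertex l ∈ₚ block (label C (terminal i)) → _ ≡ l
        unique = proj₂ (proj₂ (one-vertex (label C (terminal i))))

      length-of : Fin edges → Carrier
      length-of e = dist (f (end₁ e)) (f (end₂ e))

      -- A measurable event containing all cuts that separate the ends of the edge. The separation
      -- itself need not be measurable, as the σ-algebra is only known to contain the events about
      -- crossing numbers.
      record EdgeEvent (e : Fin edges) : Set₁ where
        field
          event      : Pred (SimplexCut k) 0ℓ
          event-meas : Measurable event
          μ-event≤   : μ event ≤ τ * length-of e
          separated  : ∀ C → label C (end₁ e) ≢ label C (end₂ e) → event C

      long-edge : ∀ e → 0# < length-of e → EdgeEvent e
      long-edge e 0<len = record
        { event      = ∁ (exactly segment 0)
        ; event-meas = ∁-meas (crossings-meas segment 0)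
        ; μ-event≤   = crossed-probability≤ segment
        ; separated  = λ C differ no-crossing → OnSegment.no-crossings C segment no-crossing
            (OnSegment.crossing-exists C segment (label-block C (end₁ e)) (label-block C (end₂ e)) differ) }
        where
        segment : Segment k
        segment = record { start = f (end₁ e) ; end = f (end₂ e) ; start∈Δ = proj₁ f-embedding (end₁ e)
                         ; end∈Δ = proj₁ f-embedding (end₂ e) ; nondegenerate = 0<len }

      -- An edge of length 0 does not form a `Segment`, but its ends are the same point of Δ and lie
      -- in the same block, so the empty event serves.
      degenerate-edge : ∀ e → ¬ 0# < length-of e → EdgeEvent e
      degenerate-edge e ¬0<len = record
        { event      = ⊘
        ; event-meas = ⊘-meas
        ; μ-event≤   = ≤-reflexive (trans μ-⊘ (sym (trans (*-congˡ len≈0) (zeroʳ τ))))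
        ; separated  = λ C differ → ⊥-elim (differ (≡.sym (proj₂ (proj₂ (SimplexCut.partition C (f (end₂ e)) (proj₁ f-embedding (end₂ e))))
            (∈ₚ-cong same (label-block C (end₁ e)))))) }
        where
        x y : Point k
        x = f (end₁ e)
        y = f (end₂ e)

        len≤0 : length-of e ≤ 0#
        len≤0 with em 0ℓ {length-of e ≤ 0#}
        ... | yes p = p
        ... | no ¬p = contradiction (≰⇒> ¬p) ¬0<len

        abs-nonNeg : ∀ i → 0# ≤ ∣ x i - y i ∣
        abs-nonNeg i = ∣x∣-nonNeg (x i - y i)

        sum≤0 : sum (λ i → ∣ x i - y i ∣) ≤ 0#
        sum≤0 = ≤-respˡ (*-÷-cancel _ (pos⇒≉0 (fromℕ-pos 1))) (≤-respʳ (zeroʳ _) (*-monoˡ-≤ (fromℕ-nonNeg 2) len≤0))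

        len≈0 : length-of e ≈ 0#
        len≈0 = ≤-antisym len≤0 (*-nonNeg (sum-nonNeg abs-nonNeg) (<⇒≤ (⁻¹-pos (fromℕ-pos 1))))

        same : x ≋ y
        same i = ≤-antisym
          (≤-by (x≤y⇒0≤y-x (≤-trans (x≤∣x∣ (x i - y i)) ∣∣≤0)) (solve 2 (λ x y → y :- x := # 0 :- (x :- y)) refl (x i) (y i)))
          (≤-by (x≤y⇒0≤y-x (≤-trans (-x≤∣x∣ (x i - y i)) ∣∣≤0)) (solve 2 (λ x y → x :- y := # 0 :- :- (x :- y)) refl (x i) (y i)))
          where
          ∣∣≤0 : ∣ x i - y i ∣ ≤ 0#
          ∣∣≤0 = ≤-trans (term≤sum abs-nonNeg i) sum≤0

      edge-event : ∀ e → EdgeEvent e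
      edge-event e with em 0ℓ {0# < length-of e}
      ... | yes 0<len = long-edge e 0<len
      ... | no ¬0<len = degenerate-edge e ¬0<len

      -- For each cut of the simplex, the blocks of the nodes form a labelling that separates the
      -- terminals; its cost is at most the total cost of the edges whose event occurs. Averaging
      -- over the scheme bounds this by τ times the volume.
      cut-bound≤τ*volume : ∀ {κ} → CutBound G κ → κ ≤ τ * volume f
      cut-bound≤τ*volume {κ} bound = ≤-trans
        (weighted-events-U edges cost (λ e → event (edge-event e)) (λ e → event-meas (edge-event e)) λ C →
          ≤-trans (labelling-bound G bound (label C) (label-separates C)) (sum-mono (cost≤ C)))
        (≤-respʳ (sym (*-distribˡ-sum {edges} τ (λ e → cost e * length-of e))) (sum-mono λ e →
          ≤-respʳ (solve 3 (λ c t l → c :* (t :* l) := t :* (c :* l)) refl (cost e) τ (length-of e))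
            (*-monoˡ-≤ (cost-nonNeg e) (μ-event≤ (edge-event e)))))
        where
        open EdgeEvent
        cost≤ : ∀ C e → crossing-cost G (label C) e ≤ indicator (cost e) (event (edge-event e)) C
        cost≤ C e with label C (end₁ e) ≟ label C (end₂ e) | em 0ℓ {event (edge-event e) C}
        ... | yes _     | yes _ = cost-nonNeg e
        ... | yes _     | no _  = ≤-refl
        ... | no _      | yes _ = ≤-refl
        ... | no differ | no ¬p = contradiction (separated (edge-event e) C differ) ¬p

-- The two bounds combined.

module Gap (em : ∀ ℓ → ExcludedMiddle ℓ) (ℝ : CompleteOrderedField) where
  open OrderedField ℝ
  open Cuts em ℝ
  open ExtendedReals em ℝ using ([≤]⁻¹)
  open GapInstance em ℝ using (G; embedding; embedding-isEmbedding; cutCost≥12n; volume≤11n+1)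
  open import Relation.Unary using (Pred)
  open import Relation.Binary.Construct.Add.Supremum.NonStrict _≤_ using ([_]; _≤⊤⁺)

  11*12/11 : fromℕ 11 * 12/11 ≈ fromℕ 12
  11*12/11 = *-÷-cancel (fromℕ 12) (pos⇒≉0 (fromℕ-pos 10))

  -- For n = k + 1 the hypothesis says n (12 - 11 ζ) ≤ ζ, so the term 1 in the volume disappears by
  -- the Archimedean property.
  12/11≤limit : ∀ ζ → 0# ≤ ζ → (∀ k → fromℕ (12 ℕ.* suc k) ≤ ζ * fromℕ (11 ℕ.* suc k ℕ.+ 1)) → 12/11 ≤ ζ
  12/11≤limit ζ 0≤ζ bound = *-cancelˡ-≤ (fromℕ-pos 10) (≤-respˡ (sym 11*12/11)
      (≤-by (x≤y⇒0≤y-x (multiples-bounded⇒≤0 (fromℕ 12 - fromℕ 11 * ζ) ζ multiples))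
        (solve 1 (λ z → # 11 :* z :- # 12 := # 0 :- (# 12 :- # 11 :* z)) refl ζ)))
    where
    multiples : ∀ n → fromℕ n * (fromℕ 12 - fromℕ 11 * ζ) ≤ ζ
    multiples zero    = ≤-respˡ (sym (zeroˡ _)) 0≤ζ
    multiples (suc k) = ≤-by (x≤y⇒0≤y-x (≤-respˡ (fromℕ-* 12 (suc k)) (≤-respʳ (*-congˡ
        (trans (fromℕ-+ (11 ℕ.* suc k) 1) (+-congʳ (fromℕ-* 11 (suc k))))) (bound k))))
      (solve 2 (λ n z → z :- n :* (# 12 :- # 11 :* z) := z :* (# 11 :* n :+ (# 1 :+ # 0)) :- # 12 :* n) refl (fromℕ (suc k)) ζ)

  volume-nonNeg : ∀ {k} (G : Instance k) f → 0# ≤ Instance.volume G f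
  volume-nonNeg G f = sum-nonNeg λ e → *-nonNeg (Instance.cost-nonNeg G e)
    (*-nonNeg (sum-nonNeg λ i → ∣x∣-nonNeg (f (Instance.end₁ G e) i - f (Instance.end₂ G e) i)) (<⇒≤ (⁻¹-pos (fromℕ-pos 1))))

  0<12n : ∀ k → 0# < fromℕ (12 ℕ.* suc k)
  0<12n k = fromℕ-pos (k ℕ.+ 11 ℕ.* suc k)

  12/11≤density : ∀ {τ} (P : CuttingScheme 3) → IsMaximumDensity P [ τ ] → 12/11 ≤ τ
  12/11≤density {τ} P τ-max = 12/11≤limit τ 0≤τ λ k → ≤-trans (bound k) (*-monoˡ-≤ 0≤τ (volume≤11n+1 k))
    where
    bound : ∀ k → fromℕ (12 ℕ.* suc k) ≤ τ * Instance.volume (G k) (embedding k)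
    bound k = SchemeBound.cut-bound≤τ*volume em ℝ P τ-max (G k) (embedding-isEmbedding k) (cutCost≥12n k)

    0≤τ : 0# ≤ τ
    0≤τ with total 0# τ
    ... | inj₁ 0≤τ = 0≤τ
    ... | inj₂ τ≤0 = contradiction (≤-trans (bound 0) (≤-respʳ (zeroˡ _) (*-monoʳ-≤ (volume-nonNeg (G 0) (embedding 0)) τ≤0))) (<⇒≱ (0<12n 0))

  module _ {ℓ} (S : Pred ℝ∞ ℓ) where

    -- Completeness quantifies over small predicates only; excluded middle resizes.
    glb-exists : ∀ {l} → (∀ y → S y → [ l ] ≤∞ y) → ∃ (IsGLB _≤∞_ S)
    glb-exists {l} l≤ = decide (em ℓ)
      where
      Lower : Pred Carrier 0ℓ
      Lower x = True (em ℓ {∀ y → S [ y ] → x ≤ y})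

      from-lub : ∀ y → S [ y ] → ∃ (IsLUB _≤_ Lower) → ∃ (IsGLB _≤∞_ S)
      from-lub y₀ y₀∈ (x , upper , least) = [ x ] , lower , greatest
        where
        lower : ∀ y → S y → [ x ] ≤∞ y
        lower ⊤⁺    _  = _ ≤⊤⁺
        lower [ y ] y∈ = [ least y (λ z z∈ → toWitness z∈ y y∈) ]
        greatest : ∀ z → (∀ y → S y → z ≤∞ y) → z ≤∞ [ x ]
        greatest [ z ] z≤ = [ upper z (fromWitness λ y y∈ → [≤]⁻¹ (z≤ [ y ] y∈)) ]
        greatest ⊤⁺    z≤ with z≤ [ y₀ ] y₀∈
        ... | ()

      decide : Dec (∃[ y ] S [ y ]) → ∃ (IsGLB _≤∞_ S)
      decide (yes (y , y∈)) = from-lub y y∈ (complete Lower (l , fromWitness λ y y∈ → [≤]⁻¹ (l≤ [ y ] y∈)) (y , λ z z∈ → toWitness z∈ y y∈))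
      -- Without a finite member, `⊤⁺` is the infimum.
      decide (no infinite) = ⊤⁺ , (λ { ⊤⁺ _ → _ ≤⊤⁺ ; [ y ] y∈ → contradiction (y , y∈) infinite }) , λ z _ → _ ≤⊤⁺

  minimum-maximum-density : ∃[ τ ] IsMinimumMaximumDensity 3 τ × [ 12/11 ] ≤∞ τ
  minimum-maximum-density = let (τ , glb) = glb-exists _ lower in τ , glb , proj₂ glb [ 12/11 ] lower
    where
    lower : ∀ y → Σ (CuttingScheme 3) (λ P → IsMaximumDensity P y) → [ 12/11 ] ≤∞ y
    lower ⊤⁺    _           = _ ≤⊤⁺
    lower [ τ ] (P , τ-max) = [ 12/11≤density P τ-max ]

  ratio≤12/11 : ∀ (G : Instance 3) {c v} → Instance.IsMinCut G c → Instance.IsMinVolume G v → c ≤ 12/11 * v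
  ratio≤12/11 G (_ , c-min) ((f , f-embedding , v≈) , _) =
    ≤-respʳ (*-congˡ (sym v≈)) (Rounding.cut≤12/11volume em ℝ G f-embedding c-min)

  integrality-gap : IsIntegralityGap 3 [ 12/11 ]
  integrality-gap = upper , least
    where
    Ratio : Pred ℝ∞ 0ℓ
    Ratio r = ∃[ G ] ∃[ c ] ∃[ v ] Instance.IsMinCut {3} G c × Instance.IsMinVolume G v × 0# < v × r ≡ [ c ÷ v ]

    upper : ∀ r → Ratio r → r ≤∞ [ 12/11 ]
    upper _ (G , c , v , c-min , v-min , 0<v , ≡.refl) = [ *-cancelˡ-≤ 0<v
      (≤-respˡ (sym (*-÷-cancel c (pos⇒≉0 0<v))) (≤-respʳ (*-comm _ _) (ratio≤12/11 G c-min v-min))) ]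

    module _ (k : ℕ) where
      open Instance (G k)

      cut : ∃ IsMinCut
      cut = minimum-cut (G k)

      vol : ∃ IsMinVolume
      vol = MinimumVolume.minimum-volume em ℝ (G k)

      12n≤cut : ∀ {c} → IsMinCut c → fromℕ (12 ℕ.* suc k) ≤ c
      12n≤cut ((S , S-cut , c≈) , _) = ≤-respʳ (sym c≈) (cutCost≥12n k S S-cut)

      vol≤11n+1 : ∀ {v} → IsMinVolume v → v ≤ fromℕ (11 ℕ.* suc k ℕ.+ 1)
      vol≤11n+1 (_ , v-min) = ≤-trans (v-min (embedding k) (embedding-isEmbedding k)) (volume≤11n+1 k)

      -- Positivity comes from the upper bound on the gap: c ≤ 12/11 v with c ≥ 12n > 0 leaves no
      -- room for v ≤ 0.
      vol-pos : ∀ {c v} → IsMinCut c → IsMinVolume v → 0# < v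
      vol-pos {c} {v} c-min v-min = ≰⇒> λ v≤0 → <⇒≱ (<-≤-trans (0<12n k) (12n≤cut c-min))
        (≤-trans (ratio≤12/11 (G k) c-min v-min) (≤-respʳ (zeroʳ _) (*-monoˡ-≤ (*-nonNeg (fromℕ-nonNeg 12) (<⇒≤ (⁻¹-pos (fromℕ-pos 10)))) v≤0)))

      ratio-bound : ∀ {ζ} → (∀ r → Ratio r → r ≤∞ [ ζ ]) → ∃ IsMinCut → ∃ IsMinVolume →
                    0# ≤ ζ × fromℕ (12 ℕ.* suc k) ≤ ζ * fromℕ (11 ℕ.* suc k ℕ.+ 1)
      ratio-bound {ζ} ≤ζ (c , c-min) (v , v-min) = 0≤ζ , ≤-trans (12n≤cut c-min) (≤-trans c≤ζv (*-monoˡ-≤ 0≤ζ (vol≤11n+1 v-min)))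
        where
        0<v = vol-pos c-min v-min
        c÷v≤ζ : c ÷ v ≤ ζ
        c÷v≤ζ = [≤]⁻¹ (≤ζ [ c ÷ v ] (G k , c , v , c-min , v-min , 0<v , ≡.refl))
        0≤ζ : 0# ≤ ζ
        0≤ζ = ≤-trans (*-nonNeg (≤-trans (<⇒≤ (0<12n k)) (12n≤cut c-min)) (<⇒≤ (⁻¹-pos 0<v))) c÷v≤ζ
        c≤ζv : c ≤ ζ * v
        c≤ζv = ≤-respˡ (÷-*-cancel c (pos⇒≉0 0<v)) (*-monoʳ-≤ (<⇒≤ 0<v) c÷v≤ζ)

    least : ∀ z → (∀ r → Ratio r → r ≤∞ z) → [ 12/11 ] ≤∞ z
    least ⊤⁺    _  = _ ≤⊤⁺
    least [ ζ ] ≤ζ = [ 12/11≤limit ζ (proj₁ (bounds 0)) (λ k → proj₂ (bounds k)) ]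
      where
      bounds : ∀ k → 0# ≤ ζ × fromℕ (12 ℕ.* suc k) ≤ ζ * fromℕ (11 ℕ.* suc k ℕ.+ 1)
      bounds k = ratio-bound k ≤ζ (cut k) (vol k)

theorem5p1 : (∀ ℓ → ExcludedMiddle ℓ) → (ℝ : CompleteOrderedField) →
    let open Multiway ℝ in
    (∃[ τ ] IsMinimumMaximumDensity 3 τ × [ 12/11 ] ≤∞ τ) ×
    IsIntegralityGap 3 [ 12/11 ]
theorem5p1 em ℝ = Gap.minimum-maximum-density em ℝ , Gap.integrality-gap em ℝ
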